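{- Let $s\ge2r\ge2$ be integers, let $y=(j,d)\in T_{r,s}$, and put $K=\min\{r,d\}$. In the minimum-augmented trapezoidal lattice $T_{r,s}\sqcup\{\widehat 0\}$ with rank $\widehat\rho(\widehat0)=0$, $\widehat\rho(i,c)=c-i+1$, give the principal interval $[\widehat 0,y]$ the rank $\widehat\rho$. Then $$\mathbb{H}_{[\widehat0,y],\widehat\rho}(q,t)=\sum_{k=j}^{K}\Psi_{k-j,\,d-k}^{\,s-2k}(q,qt).$$ Consequently, every interval of the augmented trapezoidal lattice has a closed Gaussian-binomial $q$-Zeta numerator: for $x=(i,c)\le y=(j,d)$ in $T_{r,s}$ the interval $[x,y]$, with rank normalized to be $0$ at $x$, has numerator $\Phi_{i-j,\,d-c}^{\,s-i-c}(t,q)$; the intervals $[\widehat0,y]$ are given by the displayed formula; and the singleton $[\widehat0,\widehat0]$ has numerator $1$.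
   Context: $q$-Zeta numerator: let $P$ be a finite graded poset with a unique maximum and rank function $\rho:P\to\{0,\dots,H\}$, where $H$ is the maximal rank. For $m\ge 0$ put $A_m(P,\rho;q)=\sum_{x_1\le\cdots\le x_m}q^{\rho(x_1)+\cdots+\rho(x_m)}$ (sum over weak chains in $P$; $A_0=1$). The numerator $\mathbb{H}_{P,\rho}(q,t)$ is the polynomial determined by $\sum_{m\ge 0}A_m(P,\rho;q)t^m=\mathbb{H}_{P,\rho}(q,t)/\prod_{a=0}^{H}(1-q^at)$. Trapezoidal poset: $T_{r,s}=\{(i,c):1\le i\le r,\ i\le c\le s-i\}$, ordered by $(i,c)\le(j,d)\iff i\ge j$ and $c\le d$. The augmented lattice is $T_{r,s}\sqcup\{\widehat0\}$ with $\widehat0$ below every cell. Gaussian binomials: for integers $N,k$, $\genfrac{[}{]}{0pt}{}{N}{k}_q=\prod_{v=1}^{k}\frac{1-q^{N-k+v}}{1-q^v}$ if $0\le k\le N$, and $0$ otherwise (including when $N<0$). For integers $a,b,e\ge0$ with $b\le a+e$, $$\Phi_{a,b}^{e}(X,q)=\sum_{\nu\ge0}X^{\nu}q^{\nu^2}\left(\genfrac{[}{]}{0pt}{}{a}{\nu}_q\genfrac{[}{]}{0pt}{}{b}{\nu}_q-q^{e}\genfrac{[}{]}{0pt}{}{b-e+1}{\nu+1}_q\genfrac{[}{]}{0pt}{}{a+e-1}{\nu-1}_q\right),$$ and $\Psi_{a,b}^{e}(q,t)=1$ if $a=0$, while $\Psi_{a,b}^{e}(q,t)=\Phi_{a,b}^{e}(t,q)+(t-1)\,\Phi_{a-1,b}^{e+1}(qt,q)$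 if $a\ge1$. (So $\Psi(q,qt)$ means the second argument $t$ is replaced by $qt$.) -}

module Defs where

open import Level using (0ℓ)
open import Function.Base using (_on_; _∘_)
open import Algebra.Bundles using (RawRing)
open import Data.Bool.Base using (if_then_else_)
open import Data.Empty using (⊥-elim)
open import Data.Fin.Base using (Fin; toℕ)
open import Data.Integer.Base as ℤ using (ℤ; +_; 0ℤ; 1ℤ)
open import Data.List.Base as List using (List; []; _∷_; filter; foldr; cartesianProduct; cartesianProductWith; upTo)
import Data.List.Membership.Setoid.Properties as Membershipₛ
open import Data.List.Membership.Propositional using (_∈_)
open import Data.List.Membership.Propositional.Properties using (∈-cartesianProduct⁺; ∈-upTo⁺; ∈-filter⁺)
import Data.List.Relation.Unary.All as All
import Data.List.Relation.Unary.All.Properties as Allₚ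
open import Data.List.Relation.Unary.AllPairs using (_∷_)
import Data.List.Relation.Unary.AllPairs as AllPairs
import Data.List.Relation.Unary.AllPairs.Properties as AllPairsₚ
import Data.List.Relation.Unary.Any as Any
import Data.List.Relation.Unary.Any.Properties as Anyₚ
import Data.List.Relation.Unary.Enumerates.Setoid as Enumerates
import Data.List.Relation.Unary.Unique.Setoid as Uniqueₛ
open import Data.List.Relation.Unary.Unique.Propositional.Properties using (cartesianProduct⁺; upTo⁺; filter⁺)
open import Data.Nat.Base as ℕ using (ℕ; zero; suc; _+_; _*_; _∸_; _≤_; _<_; s≤s; z≤n; _≡ᵇ_; _≤ᵇ_)
import Data.Nat.Properties as ℕₚ
open import Data.Nat.Divisibility using (_∣?_)
open import Data.Product.Base using (Σ; ∃-syntax; _×_; _,_; proj₁; proj₂)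
open import Data.Product.Properties using (≡-dec)
open import Data.Sum.Base using (_⊎_; inj₁; inj₂)
open import Data.Vec.Base as Vec using (Vec; []; _∷_)
open import Data.Vec.Relation.Unary.Linked using (Linked; linked?)
open import Relation.Binary.Bundles using (DecPoset)
open import Relation.Binary.Core using (Rel)
open import Relation.Binary.Definitions using (Maximum)
open import Relation.Binary.Structures using (IsDecPartialOrder)
import Relation.Binary.Construct.Add.Infimum.Equality as AddEquality
import Relation.Binary.Construct.Add.Infimum.NonStrict as AddInfimum
import Relation.Binary.Construct.NonStrictToStrict as ToStrict
import Relation.Binary.Construct.On as On
open import Relation.Binary.PropositionalEquality using (_≡_; refl; sym; trans; cong; cong₂; subst; isEquivalence)
open import Relation.Nullary using (¬_; yes; no; does)
open import Relation.Nullary.Construct.Add.Infimum using (_₋; ⊥₋; [_])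
open import Relation.Nullary.Decidable using (_×-dec_)
open import Relation.Unary using (Pred; Decidable)

module PowerSeries {c ℓ} (R : RawRing c ℓ) where
  open RawRing R renaming (_+_ to _+ᴿ_; _*_ to _*ᴿ_; -_ to -ᴿ_)
  open import Algebra.Definitions.RawMonoid +-rawMonoid using (sum)

  Series : Set c
  Series = ℕ → Carrier

  infix 9 X^_
  X^_ : ℕ → Series
  (X^ m) n = if m ≡ᵇ n then 1# else 0#

  const : Carrier → Series
  const a zero    = a
  const a (suc _) = 0#

  rawRing : RawRing c ℓ
  rawRing = record
    { Carrier = Series
    ; _≈_     = λ f g → ∀ n → f n ≈ g n
    ; _+_     = λ f g n → f n +ᴿ g n
    ; _*_     = λ f g n → sum {suc n} (λ i → f (toℕ i) *ᴿ g (n ∸ toℕ i))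
    ; -_      = λ f n → -ᴿ f n
    ; 0#      = λ _ → 0#
    ; 1#      = X^ 0
    }

  infixl 6 _-_
  _-_ : Series → Series → Series
  (f - g) n = f n +ᴿ -ᴿ g n

module ℤ⟦q⟧ where
  open PowerSeries ℤ.+-*-rawRing public using (X^_; _-_)

  ring : RawRing 0ℓ 0ℓ
  ring = PowerSeries.rawRing ℤ.+-*-rawRing

  open RawRing ring public
  open import Algebra.Definitions.RawSemiring rawSemiring public using (product)

module ℤ⟦q,t⟧ where
  open PowerSeries ℤ⟦q⟧.ring public using (X^_; _-_; const)

  ring : RawRing 0ℓ 0ℓ
  ring = PowerSeries.rawRing ℤ⟦q⟧.ring

  open RawRing ring public
  open import Algebra.Definitions.RawSemiring rawSemiring public using (sum; product)

infix 9 q^_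
q^_ : ℕ → ℤ⟦q⟧.Carrier
q^ n = ℤ⟦q⟧.X^ n

t : ℤ⟦q,t⟧.Carrier
t = ℤ⟦q,t⟧.X^ 1

infixl 9 _[t↦qt]
_[t↦qt] : ℤ⟦q,t⟧.Carrier → ℤ⟦q,t⟧.Carrier
(f [t↦qt]) n = q^ n ℤ⟦q⟧.* f n

IsPolynomial : ℤ⟦q,t⟧.Carrier → Set
IsPolynomial f = ∃[ N ] ∀ m n → N ≤ m ⊎ N ≤ n → f m n ≡ 0ℤ

-- ∑[ a ⋯ b ] f is f a + f (a + 1) + ⋯ + f b, empty when b < a.
∑[_⋯_] : ℕ → ℕ → (ℕ → ℤ⟦q,t⟧.Carrier) → ℤ⟦q,t⟧.Carrier
∑[ a ⋯ b ] f = ℤ⟦q,t⟧.sum {suc b ∸ a} (λ i → f (a + toℕ i))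

record FiniteGradedPoset : Set₁ where
  field
    decPoset : DecPoset 0ℓ 0ℓ 0ℓ

  open DecPoset decPoset public using (Carrier; _≈_; _≟_; _≤?_; module Eq) renaming (_≤_ to _⊑_)
  open ToStrict _≈_ _⊑_ public using () renaming (_<_ to _⊏_)

  infix 4 _⋖_
  _⋖_ : Rel Carrier 0ℓ
  x ⋖ y = x ⊏ y × ¬ (∃[ z ] x ⊏ z × z ⊏ y)

  field
    elements   : List Carrier
    enumerates : Enumerates.IsEnumeration Eq.setoid elements
    unique     : Uniqueₛ.Unique Eq.setoid elements
    rank       : Carrier → ℕ
    rank-cong  : ∀ {x y} → x ≈ y → rank x ≡ rank y
    rank-mono  : ∀ {x y} → x ⊏ y → rank x < rank y
    rank-cover : ∀ {x y} → x ⋖ y → rank y ≡ suc (rank x)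

  rank-mono-⊑ : ∀ {x y} → x ⊑ y → rank x ≤ rank y
  rank-mono-⊑ {x} {y} x⊑y with x ≟ y
  ... | yes x≈y = ℕₚ.≤-reflexive (rank-cong x≈y)
  ... | no  x≉y = ℕₚ.<⇒≤ (rank-mono (x⊑y , x≉y))

record FiniteGradedPosetWithMaximum : Set₁ where
  field
    finiteGradedPoset : FiniteGradedPoset
  open FiniteGradedPoset finiteGradedPoset public
  field
    top     : Carrier
    maximum : Maximum _⊑_ top

module _ {A : Set} {P : Pred A 0ℓ} (P? : Decidable P) where

  restrict : List A → List (Σ A P)
  restrict []       = []
  restrict (x ∷ xs) with P? x
  ... | yes p = (x , p) ∷ restrict xs
  ... | no  _ = restrict xs

  map-proj₁-restrict : ∀ xs → List.map proj₁ (restrict xs) ≡ filter P? xs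
  map-proj₁-restrict []       = refl
  map-proj₁-restrict (x ∷ xs) with P? x
  ... | yes _ = cong (x ∷_) (map-proj₁-restrict xs)
  ... | no  _ = map-proj₁-restrict xs

module _ (P : FiniteGradedPosetWithMaximum) where
  open FiniteGradedPosetWithMaximum P

  tuples : ∀ m → List (Vec Carrier m)
  tuples zero    = [] ∷ []
  tuples (suc m) = cartesianProductWith _∷_ elements (tuples m)

  weakChains : ∀ m → List (Vec Carrier m)
  weakChains m = filter (linked? _≤?_) (tuples m)

  A : ℕ → ℤ⟦q⟧.Carrier
  A m = foldr (λ x f → q^ Vec.sum (Vec.map rank x) ℤ⟦q⟧.+ f) ℤ⟦q⟧.0# (weakChains m)

  denominator : ℤ⟦q,t⟧.Carrier
  denominator = ℤ⟦q,t⟧.product {suc (rank top)} λ a →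
    ℤ⟦q,t⟧.1# ℤ⟦q,t⟧.- ℤ⟦q,t⟧.const (q^ toℕ a) ℤ⟦q,t⟧.* t

  -- The sequence A is itself the series ∑ₘ A m tᵐ, and the equation with H
  -- over the (invertible) denominator is cleared of fractions.
  IsNumerator : ℤ⟦q,t⟧.Carrier → Set
  IsNumerator H = IsPolynomial H × denominator ℤ⟦q,t⟧.* A ℤ⟦q,t⟧.≈ H

-- The interval [ x , y ], with the rank shifted to be 0 at x.

module _ (P : FiniteGradedPoset) where
  open FiniteGradedPoset P

  private module D = DecPoset decPoset

  Between : Carrier → Carrier → Pred Carrier 0ℓ
  Between x y z = x ⊑ z × z ⊑ y

  between? : ∀ x y → Decidable (Between x y)
  between? x y z = (x ≤? z) ×-dec (z ≤? y)

  Between-resp : ∀ {x y u v} → u ≈ v → Between x y u → Between x y v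
  Between-resp u≈v (x⊑u , u⊑y) =
    D.trans x⊑u (D.reflexive u≈v) , D.trans (D.reflexive (Eq.sym u≈v)) u⊑y

  interval : ∀ x y → x ⊑ y → FiniteGradedPosetWithMaximum
  interval x y x⊑y = record
    { finiteGradedPoset = record
      { decPoset   = On.decPoset decPoset (proj₁ {B = Between x y})
      ; elements   = restrict (between? x y) elements
      ; enumerates = λ (z , z∈) → Anyₚ.map⁻ (subst (Any.Any (z ≈_))
          (sym (map-proj₁-restrict (between? x y) elements))
          (Membershipₛ.∈-filter⁺ Eq.setoid (between? x y) Between-resp (enumerates z) z∈))
      ; unique     = AllPairsₚ.map⁻ (subst (Uniqueₛ.Unique Eq.setoid)
          (sym (map-proj₁-restrict (between? x y) elements))
          (AllPairsₚ.filter⁺ (between? x y) unique))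
      ; rank       = λ z → rank (proj₁ z) ∸ rank x
      ; rank-cong  = λ z≈w → cong (_∸ rank x) (rank-cong z≈w)
      ; rank-mono  = λ {z} {w} z⊏w →
          ℕₚ.∸-monoˡ-< (rank-mono z⊏w) (rank-mono-⊑ (proj₁ (proj₂ z)))
      ; rank-cover = λ {z} {w} (z⊏w , none) → trans
          (cong (_∸ rank x) (rank-cover (z⊏w , λ (v , z⊏v , v⊏w) →
            none ((v , D.trans (proj₁ (proj₂ z)) (proj₁ z⊏v)
                     , D.trans (proj₁ v⊏w) (proj₂ (proj₂ w))) , z⊏v , v⊏w))))
          (ℕₚ.+-∸-assoc 1 (rank-mono-⊑ (proj₁ (proj₂ z))))
      }
    ; top     = y , x⊑y , D.refl
    ; maximum = λ z → proj₂ (proj₂ z)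
    }

module Trapezoid (r s : ℕ) where

  IsCell : Pred (ℕ × ℕ) 0ℓ
  IsCell (i , c) = (1 ≤ i × i ≤ r) × (i ≤ c × c ≤ s ∸ i)

  Cell : Set
  Cell = Σ (ℕ × ℕ) IsCell

  row col : Cell → ℕ
  row = proj₁ ∘ proj₁
  col = proj₂ ∘ proj₁

  infix 4 _≈ᶜ_ _≤ᶜ_
  _≈ᶜ_ : Rel Cell 0ℓ
  _≈ᶜ_ = _≡_ on proj₁

  _≤ᶜ_ : Rel Cell 0ℓ
  x ≤ᶜ y = row y ≤ row x × col x ≤ col y

  ≤ᶜ-isDecPartialOrder : IsDecPartialOrder _≈ᶜ_ _≤ᶜ_
  ≤ᶜ-isDecPartialOrder = record
    { isPartialOrder = record
      { isPreorder = record
        { isEquivalence = On.isEquivalence proj₁ isEquivalence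
        ; reflexive     = λ { refl → ℕₚ.≤-refl , ℕₚ.≤-refl }
        ; trans         = λ (a , b) (c , d) → ℕₚ.≤-trans c a , ℕₚ.≤-trans b d
        }
      ; antisym = λ (a , b) (c , d) → cong₂ _,_ (ℕₚ.≤-antisym c a) (ℕₚ.≤-antisym b d)
      }
    ; _≟_  = λ x y → ≡-dec ℕₚ._≟_ ℕₚ._≟_ (proj₁ x) (proj₁ y)
    ; _≤?_ = λ x y → (row y ℕₚ.≤? row x) ×-dec (col x ℕₚ.≤? col y)
    }

  open AddInfimum _≤ᶜ_ public using (_≤₋_; ⊥₋≤_; [_])
  open AddEquality _≈ᶜ_ public using (_≈₋_; ⊥₋≈⊥₋; [_])

  ρ̂ : Cell ₋ → ℕ
  ρ̂ ⊥₋    = 0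
  ρ̂ [ x ] = col x ∸ row x + 1

  isCell? : Decidable IsCell
  isCell? (i , c) = ((1 ℕₚ.≤? i) ×-dec (i ℕₚ.≤? r)) ×-dec ((i ℕₚ.≤? c) ×-dec (c ℕₚ.≤? (s ∸ i)))

  pairs : List (ℕ × ℕ)
  pairs = cartesianProduct (upTo (suc r)) (upTo (suc s))

  cells : List Cell
  cells = restrict isCell? pairs

  cells-enumerate : ∀ x → Any.Any (x ≈ᶜ_) cells
  cells-enumerate ((i , c) , p@((_ , i≤r) , (_ , c≤s∸i))) = Anyₚ.map⁻ (subst ((i , c) ∈_)
    (sym (map-proj₁-restrict isCell? pairs))
    (∈-filter⁺ isCell? (∈-cartesianProduct⁺ (∈-upTo⁺ (s≤s i≤r))
      (∈-upTo⁺ (s≤s (ℕₚ.≤-trans c≤s∸i (ℕₚ.m∸n≤m s i))))) p))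

  cells-unique : AllPairs.AllPairs (λ x y → ¬ x ≈ᶜ y) cells
  cells-unique = AllPairsₚ.map⁻ (subst (AllPairs.AllPairs (λ x y → ¬ x ≡ y))
    (sym (map-proj₁-restrict isCell? pairs))
    (filter⁺ isCell? (cartesianProduct⁺ (upTo⁺ (suc r)) (upTo⁺ (suc s)))))

  open ToStrict _≈₋_ _≤₋_ using () renaming (_<_ to _⊏_)

  []-injective : ∀ {x y} → [ x ] ≈₋ [ y ] → x ≈ᶜ y
  []-injective [ e ] = e

  ρ̂-mono : ∀ {x y} → x ⊏ y → ρ̂ x < ρ̂ y
  ρ̂-mono {⊥₋}    {⊥₋}    (_ , x≉y)     = ⊥-elim (x≉y ⊥₋≈⊥₋)
  ρ̂-mono {⊥₋}    {[ y ]} _             = ℕₚ.m≤n+m 1 (col y ∸ row y)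
  ρ̂-mono {[ (i , c) , _ , i≤c , _ ]} {[ (j , d) , _ ]} ([ j≤i , c≤d ] , x≉y) =
    ℕₚ.+-monoˡ-< 1 (lemma (ℕₚ.m≤n⇒m<n∨m≡n j≤i))
    where
    lemma : j < i ⊎ j ≡ i → c ∸ i < d ∸ j
    lemma (inj₁ j<i)  = ℕₚ.<-≤-trans (ℕₚ.∸-monoʳ-< j<i i≤c) (ℕₚ.∸-monoˡ-≤ j c≤d)
    lemma (inj₂ refl) with ℕₚ.m≤n⇒m<n∨m≡n c≤d
    ... | inj₁ c<d  = ℕₚ.∸-monoˡ-< c<d i≤c
    ... | inj₂ refl = ⊥-elim (x≉y [ refl ])

  -- If x ⊏ (j , d) does not raise the rank by exactly 1, then one of the
  -- cells (j , d - 1), (j + 1 , d) lies strictly in between.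
  ρ̂-cover : ∀ {x y} → x ⊏ y → ¬ (∃[ z ] x ⊏ z × z ⊏ y) → ρ̂ y ≡ suc (ρ̂ x)
  ρ̂-cover {⊥₋} {⊥₋} (_ , x≉y) none = ⊥-elim (x≉y ⊥₋≈⊥₋)
  ρ̂-cover {⊥₋} {[ (j , d) , j∈ , j≤d , d≤s∸j ]} _ none with ℕₚ.m≤n⇒m<n∨m≡n j≤d
  ... | inj₂ refl = cong (_+ 1) (ℕₚ.n∸n≡0 j)
  ... | inj₁ (s≤s {n = e} j≤e) = ⊥-elim (none
    ( [ (j , e) , j∈ , j≤e , ℕₚ.≤-trans (ℕₚ.n≤1+n e) d≤s∸j ]
    , (⊥₋≤ _ , λ ())
    , ([ ℕₚ.≤-refl , ℕₚ.n≤1+n e ] , λ { [ () ] })))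
  ρ̂-cover {[ (i , c) , (1≤i , i≤r) , i≤c , c≤s∸i ]} {[ (j , d) , j∈ , j≤d , d≤s∸j ]}
    ([ j≤i , c≤d ] , x≉y) none with ℕₚ.m≤n⇒m<n∨m≡n c≤d
  ρ̂-cover {[ (i , c) , (1≤i , i≤r) , i≤c , c≤s∸i ]} {[ (j , suc e) , j∈ , j≤d , d≤s∸j ]}
    ([ j≤i , c≤d ] , x≉y) none | inj₁ (s≤s c≤e)
    with ℕₚ.m≤n⇒m<n∨m≡n j≤i | ℕₚ.m≤n⇒m<n∨m≡n c≤e
  ... | inj₂ refl | inj₂ refl = cong (_+ 1) (ℕₚ.+-∸-assoc 1 i≤c)
  ... | inj₁ j<i  | _         = ⊥-elim (none
    ( [ (j , e) , j∈ , ℕₚ.≤-trans j≤i (ℕₚ.≤-trans i≤c c≤e) , ℕₚ.≤-trans (ℕₚ.n≤1+n e) d≤s∸j ]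
    , ([ j≤i , c≤e ] , λ { [ refl ] → ℕₚ.<-irrefl refl j<i })
    , ([ ℕₚ.≤-refl , ℕₚ.n≤1+n e ] , λ { [ () ] })))
  ... | inj₂ refl | inj₁ c<e  = ⊥-elim (none
    ( [ (j , e) , j∈ , ℕₚ.≤-trans i≤c c≤e , ℕₚ.≤-trans (ℕₚ.n≤1+n e) d≤s∸j ]
    , ([ ℕₚ.≤-refl , c≤e ] , λ { [ refl ] → ℕₚ.<-irrefl refl c<e })
    , ([ ℕₚ.≤-refl , ℕₚ.n≤1+n e ] , λ { [ () ] })))
  ρ̂-cover {[ (i , c) , (1≤i , i≤r) , i≤c , c≤s∸i ]} {[ (j , c) , j∈ , j≤d , d≤s∸j ]}
    ([ j≤i , c≤d ] , x≉y) none | inj₂ refl with ℕₚ.m≤n⇒m<n∨m≡n j≤i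
  ... | inj₂ refl = ⊥-elim (x≉y [ refl ])
  ... | inj₁ j<i with ℕₚ.m≤n⇒m<n∨m≡n j<i
  ...   | inj₂ refl = cong (_+ 1) (ℕₚ.+-∸-assoc 1 i≤c)
  ...   | inj₁ 1+j<i = ⊥-elim (none
    ( [ (suc j , c) , (s≤s z≤n , ℕₚ.≤-trans j<i i≤r) , ℕₚ.≤-trans j<i i≤c
      , ℕₚ.≤-trans c≤s∸i (ℕₚ.∸-monoʳ-≤ s j<i) ]
    , ([ j<i , ℕₚ.≤-refl ] , λ { [ refl ] → ℕₚ.<-irrefl refl 1+j<i })
    , ([ ℕₚ.n≤1+n j , ℕₚ.≤-refl ] , λ { [ () ] })))

  augmented : FiniteGradedPoset
  augmented = record
    { decPoset   = record
      { isDecPartialOrder = AddInfimum.≤₋-isDecPartialOrder _≤ᶜ_ ≤ᶜ-isDecPartialOrder }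
    ; elements   = ⊥₋ ∷ List.map [_] cells
    ; enumerates = λ { ⊥₋    → Any.here ⊥₋≈⊥₋
                     ; [ x ] → Any.there (Anyₚ.map⁺ (Any.map [_] (cells-enumerate x))) }
    ; unique     = Allₚ.map⁺ (All.universal (λ _ ()) cells)
                   ∷ AllPairsₚ.map⁺ (AllPairs.map (_∘ []-injective) cells-unique)
    ; rank       = ρ̂
    ; rank-cong  = λ { ⊥₋≈⊥₋ → refl ; [ refl ] → refl }
    ; rank-mono  = ρ̂-mono
    ; rank-cover = λ (x⊏y , none) → ρ̂-cover x⊏y none
    }

-- 1 / (1 - qᵛ) = ∑ₙ q^(v n), for v ≥ 1.
1/[1-q^_] : ℕ → ℤ⟦q⟧.Carrier
1/[1-q^ v ] n = if does (v ∣? n) then 1ℤ else 0ℤ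

gauss : ℤ → ℤ → ℤ⟦q⟧.Carrier
gauss (+ N) (+ k) =
  if k ≤ᵇ N
  then (ℤ⟦q⟧.product {k} λ i → let v = suc (toℕ i) in
         (ℤ⟦q⟧.1# ℤ⟦q⟧.- q^ (N ∸ k + v)) ℤ⟦q⟧.* 1/[1-q^ v ])
  else ℤ⟦q⟧.0#
gauss _ _ = ℤ⟦q⟧.0#

-- Φ a b e is Φ(t, q): the summand of index ν is the coefficient of t^ν.
Φ : (a b e : ℕ) → ℤ⟦q,t⟧.Carrier
Φ a b e ν = q^ (ν * ν) ℤ⟦q⟧.*
  (gauss (+ a) (+ ν) ℤ⟦q⟧.* gauss (+ b) (+ ν)
   ℤ⟦q⟧.- q^ e ℤ⟦q⟧.* (gauss (+ b ℤ.- + e ℤ.+ 1ℤ) (+ ν ℤ.+ 1ℤ) ℤ⟦q⟧.* gauss (+ a ℤ.+ + e ℤ.- 1ℤ) (+ ν ℤ.- 1ℤ)))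

Ψ : (a b e : ℕ) → ℤ⟦q,t⟧.Carrier
Ψ zero    b e = ℤ⟦q,t⟧.1#
Ψ (suc a) b e = Φ (suc a) b e ℤ⟦q,t⟧.+ (t ℤ⟦q,t⟧.- ℤ⟦q,t⟧.1#) ℤ⟦q,t⟧.* Φ a b (suc e) [t↦qt]

{-# OPTIONS --safe #-}

-- Send a cell to its coordinates (row, column) and 0̂ to (r + 1, 0); the order
-- becomes that of ℕ × ℕ with the rows reversed. Let F(j, e) be the generating
-- series in t of the weak chains whose elements have row ≥ j and column < e.
-- Conditioning on the last element of a chain gives, at every element (j, e),
--   (1 - q^ρ t) F(j, e + 1) = F(j + 1, e + 1) + F(j, e) - F(j + 1, e),
-- ρ being the rank of (j, e), while F does not change when a column strip
-- without elements is added. Multiplied by ∏ (1 - qᵃ t), this determines the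
-- numerators by a recursion in the coordinates of the maximum. Φ satisfies the
-- recursion because, by the q-Pascal rule, the mixed second difference in
-- (a, b) of both products of Gaussian binomials in Φ is q^(a+b+1) t times the
-- product itself; at the boundary b = a + e the two first differences in b
-- cancel. Ψ satisfies it for a ≥ 1, b ≥ 1, and the defects at a = 0 and b = 0
-- add up to what the bottom element contributes to the sum over k.

module Submission where

open import Defs
open import Algebra.Bundles using (CommutativeRing; RawRing)
open import Algebra.Morphism.Structures using (IsRingHomomorphism)
import Algebra.Properties.AbelianGroup as AbelianGroupProperties
import Algebra.Properties.CommutativeMonoid.Sum as CommutativeMonoidSum
import Algebra.Properties.Ring as RingProperties
import Algebra.Properties.Semiring.Mult.TCOptimised as Mult
import Algebra.Properties.Semiring.Sum as SemiringSum
import Algebra.Solver.Ring as RingSolver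
open import Algebra.Solver.Ring.AlmostCommutativeRing using (_-Raw-AlmostCommutative⟶_; fromCommutativeRing)
open import Algebra.Structures using (IsCommutativeRing)
open import Data.Bool.Base as Bool using (Bool; true; false; _∧_; if_then_else_)
open import Data.Empty using (⊥-elim)
open import Data.Fin.Base using (toℕ)
open import Data.Fin.Properties using (toℕ<n)
open import Data.Integer.Base as ℤ using (ℤ; +_; -[1+_]; 0ℤ; 1ℤ)
import Data.Integer.Properties as ℤₚ
open import Data.List.Base as List using (List; []; _++_; _∷_; cartesianProductWith; filter; foldr)
open import Data.List.Relation.Unary.All as All using (All; []; _∷_)
open import Data.List.Relation.Unary.AllPairs using ([]; _∷_)
open import Data.List.Relation.Unary.Any as Any using (Any)
import Data.List.Relation.Unary.Unique.Setoid as Uniqueₛ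
open import Data.Maybe.Base as Maybe using (Maybe)
open import Data.Nat.Base as ℕ using (ℕ; zero; suc; _∸_; _⊓_; _≤_; _<_; _≤ᵇ_; z≤n; s≤s)
open import Data.Nat.Divisibility as ∣ using (_∣?_; _∣_)
import Data.Nat.Properties as ℕₚ
open import Data.Nat.Solver using (module +-*-Solver)
open import Data.Product.Base using (_,_; _×_; proj₁; proj₂)
open import Data.Sum.Base using (_⊎_; inj₁; inj₂)
open import Data.Vec.Base as Vec using (Vec; []; _∷_)
open import Data.Vec.Relation.Unary.Linked using (linked?)
open import Function.Base using (_∘_)
open import Function.Bundles using (_⇔_; mk⇔; Equivalence)
open import Level using (0ℓ; _⊔_)
open import Relation.Binary.Bundles using (DecPoset)
open import Relation.Binary.Consequences using (dec⇒weaklyDec)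
open import Relation.Binary.Definitions using (tri<; tri≈; tri>)
open import Relation.Binary.PropositionalEquality as ≡ using (_≡_)
import Relation.Binary.Reasoning.Setoid as SetoidReasoning
open import Relation.Nullary using (¬_; Dec; yes; no; does)
open import Relation.Nullary.Construct.Add.Infimum using (_₋; ⊥₋; [_])
open import Relation.Nullary.Decidable using (_×-dec_; dec-false; dec-true; does-⇔)
open import Relation.Unary using (Pred; Decidable)

-- Formal power series

-- In both families of intervals the neighbours of a cell of rank n + 1 have ranks n, n and, at the
-- corner, n - 1. Clearing denominators leaves one surplus factor, at the corner alone: it enters
-- the series recursion with coefficient -1, but the recursion of the numerators with -(1 - qⁿ t).
-- The parameter e = s - i - c counts the cells to the right of the starting cell (i, c) in its row.
-- Each row with smaller index reaches one column further, whence the region b ≤ a + e. For [0̂, y]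
-- columns are counted from the diagonal c = i; a row then gains one cell at either end, which
-- accounts for the 2k in s - 2k. The sum over k, before the substitution, obeys the recursion with
-- weights that are too small by one power of q, because 0̂ takes up rank 0 and pushes every cell up
-- by one. The outer t ↦ qt repairs exactly this.

module IntegerSolver {c ℓ} (R : CommutativeRing c ℓ) where
  open CommutativeRing R
  open RingProperties ring
  open AbelianGroupProperties +-abelianGroup using (⁻¹-∙-comm)
  open Mult semiring renaming (_×_ to _·_)
  open import Relation.Binary.Reasoning.Setoid setoid

  private
    -- Equality of power series is undecidable, so the solver normalises with integer coefficients,
    -- which can be compared; this canonical map interprets them in the ring.
    ⟦_⟧ᶻ : ℤ → Carrier
    ⟦ + n ⟧ᶻ = n · 1#
    ⟦ -[1+ n ] ⟧ᶻ = - (suc n · 1#)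

    -‿homo : ∀ i → ⟦ ℤ.- i ⟧ᶻ ≈ - ⟦ i ⟧ᶻ
    -‿homo (+ zero)  = sym -0#≈0#
    -‿homo (+ suc n) = refl
    -‿homo -[1+ n ]  = sym (-‿involutive _)

    ⊖-homo : ∀ m n → ⟦ m ℤ.⊖ n ⟧ᶻ ≈ m · 1# - n · 1#
    ⊖-homo m zero = sym (trans (+-congˡ -0#≈0#) (+-identityʳ _))
    ⊖-homo zero (suc n) = sym (+-identityˡ _)
    ⊖-homo (suc m) (suc n) = begin
      ⟦ suc m ℤ.⊖ suc n ⟧ᶻ                ≡⟨ ≡.cong ⟦_⟧ᶻ (ℤₚ.[1+m]⊖[1+n]≡m⊖n m n) ⟩
      ⟦ m ℤ.⊖ n ⟧ᶻ                        ≈⟨ ⊖-homo m n ⟩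
      m · 1# - n · 1#                     ≈⟨ +-congʳ (+-identityˡ _) ⟨
      0# + m · 1# - n · 1#                ≈⟨ +-congʳ (+-congʳ (-‿inverseʳ 1#)) ⟨
      1# - 1# + m · 1# - n · 1#           ≈⟨ +-congʳ (+-assoc _ _ _) ⟩
      1# + (- 1# + m · 1#) - n · 1#       ≈⟨ +-congʳ (+-congˡ (+-comm _ _)) ⟩
      1# + (m · 1# - 1#) - n · 1#         ≈⟨ +-congʳ (+-assoc _ _ _) ⟨
      1# + m · 1# - 1# - n · 1#           ≈⟨ +-assoc _ _ _ ⟩
      1# + m · 1# + (- 1# - n · 1#)       ≈⟨ +-congˡ (⁻¹-∙-comm 1# (n · 1#)) ⟩
      1# + m · 1# - (1# + n · 1#)         ≈⟨ +-cong (1+× m 1#) (-‿cong (1+× n 1#)) ⟨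
      suc m · 1# - suc n · 1#             ∎

    +-homo : ∀ i j → ⟦ i ℤ.+ j ⟧ᶻ ≈ ⟦ i ⟧ᶻ + ⟦ j ⟧ᶻ
    +-homo (+ m)    (+ n)    = ×-homo-+ 1# m n
    +-homo (+ m)    -[1+ n ] = ⊖-homo m (suc n)
    +-homo -[1+ m ] (+ n)    = trans (⊖-homo n (suc m)) (+-comm _ _)
    +-homo -[1+ m ] -[1+ n ] = begin
      - (suc (suc (m ℕ.+ n)) · 1#)     ≡⟨ ≡.cong (λ k → - (suc k · 1#)) (ℕₚ.+-suc m n) ⟨
      - ((suc m ℕ.+ suc n) · 1#)       ≈⟨ -‿cong (×-homo-+ 1# (suc m) (suc n)) ⟩
      - (suc m · 1# + suc n · 1#)      ≈⟨ ⁻¹-∙-comm _ _ ⟨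
      - (suc m · 1#) - suc n · 1#      ∎

    *-homo⁺ : ∀ m n → ⟦ + m ℤ.* + n ⟧ᶻ ≈ m · 1# * (n · 1#)
    *-homo⁺ m n = trans (reflexive (≡.cong ⟦_⟧ᶻ (≡.sym (ℤₚ.pos-* m n)))) (×1-homo-* m n)

    *-homo : ∀ i j → ⟦ i ℤ.* j ⟧ᶻ ≈ ⟦ i ⟧ᶻ * ⟦ j ⟧ᶻ
    *-homo (+ m)    (+ n)    = *-homo⁺ m n
    *-homo (+ m)    -[1+ n ] = begin
      ⟦ + m ℤ.* ℤ.- (+ suc n) ⟧ᶻ     ≡⟨ ≡.cong ⟦_⟧ᶻ (ℤₚ.neg-distribʳ-* (+ m) (+ suc n)) ⟨
      ⟦ ℤ.- (+ m ℤ.* + suc n) ⟧ᶻ     ≈⟨ -‿homo (+ m ℤ.* + suc n) ⟩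
      - ⟦ + m ℤ.* + suc n ⟧ᶻ         ≈⟨ -‿cong (*-homo⁺ m (suc n)) ⟩
      - (m · 1# * (suc n · 1#))      ≈⟨ -‿distribʳ-* _ _ ⟩
      m · 1# * - (suc n · 1#)        ∎
    *-homo -[1+ m ] (+ n)    = begin
      ⟦ ℤ.- (+ suc m) ℤ.* + n ⟧ᶻ     ≡⟨ ≡.cong ⟦_⟧ᶻ (ℤₚ.neg-distribˡ-* (+ suc m) (+ n)) ⟨
      ⟦ ℤ.- (+ suc m ℤ.* + n) ⟧ᶻ     ≈⟨ -‿homo (+ suc m ℤ.* + n) ⟩
      - ⟦ + suc m ℤ.* + n ⟧ᶻ         ≈⟨ -‿cong (*-homo⁺ (suc m) n) ⟩
      - (suc m · 1# * (n · 1#))      ≈⟨ -‿distribˡ-* _ _ ⟩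
      - (suc m · 1#) * (n · 1#)      ∎
    *-homo -[1+ m ] -[1+ n ] = begin
      (suc m ℕ.* suc n) · 1#                 ≈⟨ ×1-homo-* (suc m) (suc n) ⟩
      suc m · 1# * (suc n · 1#)              ≈⟨ -‿involutive _ ⟨
      - - (suc m · 1# * (suc n · 1#))        ≈⟨ -‿cong (-‿distribʳ-* _ _) ⟩
      - (suc m · 1# * - (suc n · 1#))        ≈⟨ -‿distribˡ-* _ _ ⟩
      - (suc m · 1#) * - (suc n · 1#)        ∎

    morphism : ℤ.+-*-rawRing -Raw-AlmostCommutative⟶ fromCommutativeRing R
    morphism = record
      { ⟦_⟧    = ⟦_⟧ᶻ
      ; +-homo = +-homo
      ; *-homo = *-homo
      ; -‿homo = -‿homo
      ; 0-homo = refl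
      ; 1-homo = refl
      }

    coeff≟ : ∀ i j → Maybe (⟦ i ⟧ᶻ ≈ ⟦ j ⟧ᶻ)
    coeff≟ i j = Maybe.map (λ i≡j → reflexive (≡.cong ⟦_⟧ᶻ i≡j)) (dec⇒weaklyDec ℤₚ._≟_ i j)

  open RingSolver ℤ.+-*-rawRing (fromCommutativeRing R) morphism coeff≟ public
    using (solve; _:=_; _:+_; _:*_; _:-_; :-_; con)

module PowerSeriesRing {c ℓ} (R : CommutativeRing c ℓ) where
  open CommutativeRing R
  open IntegerSolver R
  open SetoidReasoning setoid
  open PowerSeries rawRing using (Series; X^_; const)
  open RawRing (PowerSeries.rawRing rawRing) public using ()
    renaming (_≈_ to _≋_; _+_ to _⊞_; _*_ to _⊛_; -_ to ⊟_; 0# to 𝟘; 1# to 𝟙)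

  -- The sum defining a product unfolds to `f 0 * g (suc n) + ((f ∘ suc) ⊛ g) n`. The ring laws
  -- therefore go by induction on the degree, with `f` replaced by its shift.
  ⊛-cong : ∀ {f f′ g g′} → f ≋ f′ → g ≋ g′ → f ⊛ g ≋ f′ ⊛ g′
  ⊛-cong f≋ g≋ zero    = +-congʳ (*-cong (f≋ 0) (g≋ 0))
  ⊛-cong f≋ g≋ (suc n) = +-cong (*-cong (f≋ 0) (g≋ (suc n))) (⊛-cong (f≋ ∘ suc) g≋ n)

  0⊛ : ∀ f → 𝟘 ⊛ f ≋ 𝟘
  0⊛ f zero    = solve 1 (λ x → con (+ 0) :* x :+ con (+ 0) := con (+ 0)) refl (f 0)
  0⊛ f (suc n) = trans (+-cong (zeroˡ _) (0⊛ f n)) (+-identityˡ _)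

  scale-⊛ : ∀ a f g n → ((λ k → a * f k) ⊛ g) n ≈ a * (f ⊛ g) n
  scale-⊛ a f g zero    = solve 3 (λ a x y → a :* x :* y :+ con (+ 0) := a :* (x :* y :+ con (+ 0))) refl a (f 0) (g 0)
  scale-⊛ a f g (suc n) = begin
    a * f 0 * g (suc n) + ((λ k → a * f (suc k)) ⊛ g) n ≈⟨ +-congˡ (scale-⊛ a (f ∘ suc) g n) ⟩
    a * f 0 * g (suc n) + a * ((f ∘ suc) ⊛ g) n
      ≈⟨ solve 4 (λ a x y z → a :* x :* y :+ a :* z := a :* (x :* y :+ z)) refl a (f 0) (g (suc n)) (((f ∘ suc) ⊛ g) n) ⟩
    a * (f ⊛ g) (suc n) ∎

  ⊛-distribʳ : ∀ h f g → (f ⊞ g) ⊛ h ≋ (f ⊛ h) ⊞ (g ⊛ h)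
  ⊛-distribʳ h f g zero = solve 3 (λ h f g → (f :+ g) :* h :+ con (+ 0) := f :* h :+ con (+ 0) :+ (g :* h :+ con (+ 0))) refl (h 0) (f 0) (g 0)
  ⊛-distribʳ h f g (suc n) = begin
    (f 0 + g 0) * h (suc n) + (((f ⊞ g) ∘ suc) ⊛ h) n
      ≈⟨ +-congˡ (⊛-distribʳ h (f ∘ suc) (g ∘ suc) n) ⟩
    (f 0 + g 0) * h (suc n) + (((f ∘ suc) ⊛ h) n + ((g ∘ suc) ⊛ h) n)
      ≈⟨ solve 5 (λ h f g x y → (f :+ g) :* h :+ (x :+ y) := f :* h :+ x :+ (g :* h :+ y)) refl (h (suc n)) (f 0) (g 0) _ _ ⟩
    (f ⊛ h) (suc n) + (g ⊛ h) (suc n) ∎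

  -- The definition peels a coefficient off the left series; commutativity requires peeling one off
  -- the right series too.
  ⊛-sucʳ : ∀ f g n → (f ⊛ g) (suc n) ≈ (f ⊛ (g ∘ suc)) n + f (suc n) * g 0
  ⊛-sucʳ f g zero = solve 4 (λ a b c d → a :* b :+ (c :* d :+ con (+ 0)) := a :* b :+ con (+ 0) :+ c :* d) refl (f 0) (g 1) (f 1) (g 0)
  ⊛-sucʳ f g (suc n) = trans (+-congˡ (⊛-sucʳ (f ∘ suc) g n)) (sym (+-assoc _ _ _))

  ⊛-comm : ∀ f g → f ⊛ g ≋ g ⊛ f
  ⊛-comm f g zero    = +-congʳ (*-comm _ _)
  ⊛-comm f g (suc n) = begin
    f 0 * g (suc n) + ((f ∘ suc) ⊛ g) n ≈⟨ +-cong (*-comm _ _) (⊛-comm (f ∘ suc) g n) ⟩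
    g (suc n) * f 0 + (g ⊛ (f ∘ suc)) n ≈⟨ +-comm _ _ ⟩
    (g ⊛ (f ∘ suc)) n + g (suc n) * f 0 ≈⟨ ⊛-sucʳ g f n ⟨
    (g ⊛ f) (suc n) ∎

  ⊛-assoc : ∀ f g h → (f ⊛ g) ⊛ h ≋ f ⊛ (g ⊛ h)
  ⊛-assoc f g h zero = solve 3 (λ f g h → (f :* g :+ con (+ 0)) :* h :+ con (+ 0) := f :* (g :* h :+ con (+ 0)) :+ con (+ 0)) refl (f 0) (g 0) (h 0)
  ⊛-assoc f g h (suc n) = begin
    -- The shift of `f ⊛ g` is `f 0` times the shift of `g`, plus `(f ∘ suc) ⊛ g`.
    (f 0 * g 0 + 0#) * h (suc n) + (((λ k → f 0 * g (suc k)) ⊞ ((f ∘ suc) ⊛ g)) ⊛ h) n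
      ≈⟨ +-congˡ (⊛-distribʳ h (λ k → f 0 * g (suc k)) ((f ∘ suc) ⊛ g) n) ⟩
    (f 0 * g 0 + 0#) * h (suc n) + (((λ k → f 0 * g (suc k)) ⊛ h) n + (((f ∘ suc) ⊛ g) ⊛ h) n)
      ≈⟨ +-congˡ (+-cong (scale-⊛ (f 0) (g ∘ suc) h n) (⊛-assoc (f ∘ suc) g h n)) ⟩
    (f 0 * g 0 + 0#) * h (suc n) + (f 0 * ((g ∘ suc) ⊛ h) n + ((f ∘ suc) ⊛ (g ⊛ h)) n)
      ≈⟨ solve 5 (λ a b c x y → (a :* b :+ con (+ 0)) :* c :+ (a :* x :+ y) := a :* (b :* c :+ x) :+ y) refl (f 0) (g 0) (h (suc n)) _ _ ⟩
    f 0 * (g ⊛ h) (suc n) + ((f ∘ suc) ⊛ (g ⊛ h)) n ∎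

  1⊛ : ∀ f → 𝟙 ⊛ f ≋ f
  1⊛ f zero    = solve 1 (λ x → con (+ 1) :* x :+ con (+ 0) := x) refl (f 0)
  1⊛ f (suc n) = trans (+-cong (*-identityˡ _) (0⊛ f n)) (+-identityʳ _)

  series-isCommutativeRing : IsCommutativeRing _≋_ _⊞_ _⊛_ ⊟_ 𝟘 𝟙
  series-isCommutativeRing = record
    { isRing = record
      { +-isAbelianGroup = record
        { isGroup = record
          { isMonoid = record
            { isSemigroup = record
              { isMagma = record
                { isEquivalence = record
                  { refl  = λ _ → refl
                  ; sym   = λ f≋g n → sym (f≋g n)
                  ; trans = λ f≋g g≋h n → trans (f≋g n) (g≋h n)
                  }
                ; ∙-cong = λ f≋ g≋ n → +-cong (f≋ n) (g≋ n)
                }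
              ; assoc = λ f g h n → +-assoc (f n) (g n) (h n)
              }
            ; identity = (λ f n → +-identityˡ (f n)) , (λ f n → +-identityʳ (f n))
            }
          ; inverse = (λ f n → -‿inverseˡ (f n)) , (λ f n → -‿inverseʳ (f n))
          ; ⁻¹-cong = λ f≋g n → -‿cong (f≋g n)
          }
        ; comm = λ f g n → +-comm (f n) (g n)
        }
      ; *-cong     = ⊛-cong
      ; *-assoc    = ⊛-assoc
      ; *-identity = 1⊛ , λ f n → trans (⊛-comm f 𝟙 n) (1⊛ f n)
      ; distrib    = (λ h f g n → trans (⊛-comm h (f ⊞ g) n)
                        (trans (⊛-distribʳ h f g n) (+-cong (⊛-comm f h n) (⊛-comm g h n))))
                   , ⊛-distribʳ
      }
    ; *-comm = ⊛-comm
    }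

  seriesRing : CommutativeRing c ℓ
  seriesRing = record { isCommutativeRing = series-isCommutativeRing }

  X^-⊛-< : ∀ m f {n} → n < m → (X^ m ⊛ f) n ≈ 0#
  X^-⊛-< (suc m) f {zero}  _         = trans (+-congʳ (zeroˡ _)) (+-identityˡ _)
  X^-⊛-< (suc m) f {suc n} (s≤s n<m) = trans (+-cong (zeroˡ _) (X^-⊛-< m f n<m)) (+-identityˡ _)

  X^-⊛-+ : ∀ m f n → (X^ m ⊛ f) (m ℕ.+ n) ≈ f n
  X^-⊛-+ zero    f n = 1⊛ f n
  X^-⊛-+ (suc m) f n = trans (+-cong (zeroˡ _) (X^-⊛-+ m f n)) (+-identityˡ _)

  X^-homo : ∀ m n → X^ (m ℕ.+ n) ≋ X^ m ⊛ X^ n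
  X^-homo zero    n k       = sym (1⊛ (X^ n) k)
  X^-homo (suc m) n zero    = sym (X^-⊛-< (suc m) (X^ n) ℕ.z<s)
  X^-homo (suc m) n (suc k) = trans (X^-homo m n k) (sym (trans (+-congʳ (zeroˡ _)) (+-identityˡ _)))

  const-⊛ : ∀ a f n → (const a ⊛ f) n ≈ a * f n
  const-⊛ a f zero    = +-identityʳ _
  const-⊛ a f (suc n) = trans (+-congˡ (0⊛ f n)) (+-identityʳ _)

  const-1 : const 1# ≋ 𝟙
  const-1 zero    = refl
  const-1 (suc n) = refl

  -- Serves to bound the degree in q: vanishing beyond a fixed q-degree is closed under addition, so
  -- it passes from products of coefficients to the t-coefficients of a product.
  ⊛-preserves : ∀ {p} (P : Carrier → Set p) → P 0# → (∀ {a b} → P a → P b → P (a + b)) →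
                ∀ f g → (∀ i j → P (f i * g j)) → ∀ n → P ((f ⊛ g) n)
  ⊛-preserves P P0 P+ f g Pfg zero    = P+ (Pfg 0 0) P0
  ⊛-preserves P P0 P+ f g Pfg (suc n) = P+ (Pfg 0 (suc n)) (⊛-preserves P P0 P+ (f ∘ suc) g (Pfg ∘ suc) n)

  ⊛-vanishes : ∀ M N f g → (∀ {n} → M ≤ n → f n ≈ 0#) → (∀ {n} → N ≤ n → g n ≈ 0#) →
               ∀ {n} → M ℕ.+ N ≤ n → (f ⊛ g) n ≈ 0#
  ⊛-vanishes zero    N f g f≈0 g≈0 {n} _ = trans (⊛-cong {f} {𝟘} {g} {g} (λ k → f≈0 z≤n) (λ _ → refl) n) (0⊛ g n)
  ⊛-vanishes (suc M) N f g f≈0 g≈0 {suc n} (s≤s M+N≤n) = begin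
    f 0 * g (suc n) + ((f ∘ suc) ⊛ g) n
      ≈⟨ +-cong (*-congˡ (g≈0 (ℕₚ.≤-trans (ℕₚ.m≤n+m N M) (ℕₚ.m≤n⇒m≤1+n M+N≤n))))
                (⊛-vanishes M N (f ∘ suc) g (f≈0 ∘ s≤s) g≈0 M+N≤n) ⟩
    f 0 * 0# + 0#                       ≈⟨ trans (+-identityʳ _) (zeroʳ _) ⟩
    0#                                  ∎

-- Gaussian binomials

module Products {c ℓ} (R : CommutativeRing c ℓ) where
  open CommutativeRing R
  open import Algebra.Definitions.RawSemiring (RawRing.rawSemiring rawRing) using (product)

  prod : (ℕ → Carrier) → ℕ → Carrier
  prod f n = product {n} (f ∘ toℕ)

  prod-cong : ∀ {f g} → (∀ n → f n ≈ g n) → ∀ n → prod f n ≈ prod g n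
  prod-cong f≈g zero    = refl
  prod-cong f≈g (suc n) = *-cong (f≈g 0) (prod-cong (f≈g ∘ suc) n)

  prod-suc : ∀ f n → prod f (suc n) ≈ prod f n * f n
  prod-suc f zero    = *-comm _ _
  prod-suc f (suc n) = trans (*-congˡ (prod-suc (f ∘ suc) n)) (sym (*-assoc _ _ _))

  prod-* : ∀ f g n → prod (λ i → f i * g i) n ≈ prod f n * prod g n
  prod-* f g n = CommutativeMonoidSum.∑-distrib-+ *-commutativeMonoid {n} (f ∘ toℕ) (g ∘ toℕ)

if-≤ᵇ : ∀ {a} {A : Set a} {k n} (x y : A) → k ≤ n → (if k ≤ᵇ n then x else y) ≡ x
if-≤ᵇ {k = k} {n} x y k≤n with k ≤ᵇ n | ℕₚ.≤⇒≤ᵇ k≤n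
... | true | _ = ≡.refl

if-≰ᵇ : ∀ {a} {A : Set a} {k n} (x y : A) → n < k → (if k ≤ᵇ n then x else y) ≡ y
if-≰ᵇ {k = k} {n} x y n<k with k ≤ᵇ n in eq
... | false = ≡.refl
... | true with () ← ℕₚ.<-irrefl ≡.refl (ℕₚ.<-≤-trans n<k (ℕₚ.≤ᵇ⇒≤ k n (≡.subst Bool.T (≡.sym eq) _)))

-- Isolates what the binomial identities use of q, so that they can be proved in an abstract ring,
-- where terms do not unfold into coefficient functions.
record QPowers {c ℓ} (R : CommutativeRing c ℓ) : Set (c ⊔ ℓ) where
  open CommutativeRing R
  field
    Q           : ℕ → Carrier
    Q-0         : Q 0 ≈ 1#
    Q-+         : ∀ m n → Q (m ℕ.+ n) ≈ Q m * Q n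
    inv         : ℕ → Carrier
    inv-inverse : ∀ v → (1# - Q (suc v)) * inv (suc v) ≈ 1#

module GaussianBinomials {c ℓ} {R : CommutativeRing c ℓ} (qPowers : QPowers R) where
  open CommutativeRing R
  open QPowers qPowers
  open Products R
  open IntegerSolver R
  open SetoidReasoning setoid

  private
    factor : ℕ → ℕ → Carrier
    factor m i = (1# - Q (m ℕ.+ suc i)) * inv (suc i)

    num : ℕ → ℕ → Carrier
    num m = prod (λ i → 1# - Q (m ℕ.+ suc i))

    den : ℕ → Carrier
    den = prod (inv ∘ suc)

    num-sucˡ : ∀ m k → num m (suc k) ≈ (1# - Q (suc m)) * num (suc m) k
    num-sucˡ m k = *-cong (reflexive (≡.cong (λ j → 1# - Q j) (ℕₚ.+-comm m 1)))
      (prod-cong (λ i → reflexive (≡.cong (λ j → 1# - Q j) (ℕₚ.+-suc m (suc i)))) k)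

  binom : ℕ → ℕ → Carrier
  binom N k = if k ≤ᵇ N then prod (factor (N ∸ k)) k else 0#

  binom-+ : ∀ m k → binom (m ℕ.+ k) k ≈ prod (factor m) k
  binom-+ m k = reflexive (≡.trans (if-≤ᵇ {k = k} {m ℕ.+ k} _ 0# (ℕₚ.m≤n+m k m)) (≡.cong (λ j → prod (factor j) k) (ℕₚ.m+n∸n≡m m k)))

  binom-< : ∀ {N k} → N < k → binom N k ≈ 0#
  binom-< {N} {k} N<k = reflexive (if-≰ᵇ {k = k} {N} _ 0# N<k)

  binom-0 : ∀ N → binom N 0 ≈ 1#
  binom-0 N = refl

  private
    binom-suc-suc : ∀ m k → binom (suc (m ℕ.+ k)) (suc k) ≈ num m (suc k) * den (suc k)
    binom-suc-suc m k = begin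
      binom (suc (m ℕ.+ k)) (suc k)   ≡⟨ ≡.cong (λ N → binom N (suc k)) (≡.sym (ℕₚ.+-suc m k)) ⟩
      binom (m ℕ.+ suc k) (suc k)     ≈⟨ binom-+ m (suc k) ⟩
      prod (factor m) (suc k)         ≈⟨ prod-* (λ i → 1# - Q (m ℕ.+ suc i)) (inv ∘ suc) (suc k) ⟩
      num m (suc k) * den (suc k)     ∎

    cancel-inv : ∀ k n → n * den (suc k) * (1# - Q (suc k)) ≈ n * den k
    cancel-inv k n = begin
      n * den (suc k) * (1# - Q (suc k))               ≈⟨ *-congʳ (*-congˡ (prod-suc (inv ∘ suc) k)) ⟩
      n * (den k * inv (suc k)) * (1# - Q (suc k))     ≈⟨ solve 4 (λ n d i q → n :* (d :* i) :* q := n :* d :* (q :* i)) refl n (den k) _ _ ⟩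
      n * den k * ((1# - Q (suc k)) * inv (suc k))     ≈⟨ *-congˡ (inv-inverse k) ⟩
      n * den k * 1#                                   ≈⟨ *-identityʳ _ ⟩
      n * den k                                        ∎

    -- Comes from 1 - q^(m+k+1) = (1 - q^m) + q^m (1 - q^(k+1)); the two parts become the two terms
    -- of the q-Pascal rule.
    num-difference : ∀ m k → num m (suc k) ≈ (1# - Q m) * num m k + Q m * (num m k * (1# - Q (suc k)))
    num-difference m k = begin
      num m (suc k)                             ≈⟨ prod-suc (λ i → 1# - Q (m ℕ.+ suc i)) k ⟩
      num m k * (1# - Q (m ℕ.+ suc k))          ≈⟨ *-congˡ (+-congˡ (-‿cong (Q-+ m (suc k)))) ⟩
      num m k * (1# - Q m * Q (suc k))          ≈⟨ solve 3 (λ n a b → n :* (con (+ 1) :- a :* b) := (con (+ 1) :- a) :* n :+ a :* (n :* (con (+ 1) :- b))) refl (num m k) (Q m) (Q (suc k)) ⟩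
      (1# - Q m) * num m k + Q m * (num m k * (1# - Q (suc k))) ∎

    binom-sucʳ : ∀ m k → binom (m ℕ.+ k) (suc k) ≈ (1# - Q m) * num m k * den (suc k)
    -- The factor 1 - q⁰ = 0 on the right matches the vanishing binomial on the left.
    binom-sucʳ zero k = begin
      binom k (suc k)                        ≈⟨ binom-< {k} ℕₚ.≤-refl ⟩
      0#                                     ≈⟨ solve 2 (λ n d → con (+ 0) := (con (+ 1) :- con (+ 1)) :* n :* d) refl (num 0 k) (den (suc k)) ⟩
      (1# - 1#) * num 0 k * den (suc k)      ≈⟨ *-congʳ (*-congʳ (+-congˡ (-‿cong Q-0))) ⟨
      (1# - Q 0) * num 0 k * den (suc k)     ∎
    binom-sucʳ (suc m) k = trans (binom-suc-suc m k) (*-congʳ (num-sucˡ m k))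

    pascal′ : ∀ m k → binom (suc (m ℕ.+ k)) (suc k) ≈ binom (m ℕ.+ k) (suc k) + Q m * binom (m ℕ.+ k) k
    pascal′ m k = begin
      binom (suc (m ℕ.+ k)) (suc k)              ≈⟨ binom-suc-suc m k ⟩
      num m (suc k) * den (suc k)                ≈⟨ *-congʳ (num-difference m k) ⟩
      ((1# - Q m) * num m k + Q m * (num m k * (1# - Q (suc k)))) * den (suc k)
        ≈⟨ solve 5 (λ x q n y d → (x :* n :+ q :* (n :* y)) :* d := x :* n :* d :+ q :* (n :* d :* y)) refl _ _ _ _ _ ⟩
      (1# - Q m) * num m k * den (suc k) + Q m * (num m k * den (suc k) * (1# - Q (suc k)))
        ≈⟨ +-cong (sym (binom-sucʳ m k)) (*-congˡ (begin
             num m k * den (suc k) * (1# - Q (suc k))  ≈⟨ cancel-inv k (num m k) ⟩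
             num m k * den k                           ≈⟨ prod-* (λ i → 1# - Q (m ℕ.+ suc i)) (inv ∘ suc) k ⟨
             prod (factor m) k                         ≈⟨ binom-+ m k ⟨
             binom (m ℕ.+ k) k                         ∎)) ⟩
      binom (m ℕ.+ k) (suc k) + Q m * binom (m ℕ.+ k) k ∎

  -- Multiplying the q-Pascal rule by qᵏ replaces the exponent N - k by N, so
  -- that the rule holds without assuming k ≤ N.
  pascal : ∀ N k → Q k * binom (suc N) (suc k) ≈ Q k * binom N (suc k) + Q N * binom N k
  pascal N k with ℕₚ.≤-<-connex k N
  ... | inj₂ N<k = begin
    Q k * binom (suc N) (suc k)                  ≈⟨ *-congˡ (binom-< (s≤s N<k)) ⟩
    Q k * 0#                                     ≈⟨ solve 2 (λ x y → x :* con (+ 0) := x :* con (+ 0) :+ y :* con (+ 0)) refl (Q k) (Q N) ⟩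
    Q k * 0# + Q N * 0#                          ≈⟨ +-cong (*-congˡ (binom-< (ℕₚ.m≤n⇒m≤1+n N<k))) (*-congˡ (binom-< N<k)) ⟨
    Q k * binom N (suc k) + Q N * binom N k      ∎
  ... | inj₁ k≤N rewrite ≡.sym (ℕₚ.m∸n+n≡m k≤N) = begin
    Q k * binom (suc N′) (suc k)                                ≈⟨ *-congˡ (pascal′ (N ∸ k) k) ⟩
    Q k * (binom N′ (suc k) + Q (N ∸ k) * binom N′ k)           ≈⟨ solve 4 (λ x b m c → x :* (b :+ m :* c) := x :* b :+ m :* x :* c) refl _ _ _ _ ⟩
    Q k * binom N′ (suc k) + Q (N ∸ k) * Q k * binom N′ k       ≈⟨ +-congˡ (*-congʳ (Q-+ (N ∸ k) k)) ⟨
    Q k * binom N′ (suc k) + Q N′ * binom N′ k                  ∎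
    where N′ = N ∸ k ℕ.+ k

  binomᶻ : ℤ → ℕ → Carrier
  binomᶻ (+ N)    k = binom N k
  binomᶻ -[1+ N ] k = 0#

  -- The Gaussian binomial of N - e over k. The difference is taken in ℤ because N < e has to give 0
  -- even for k = 0, where truncated subtraction would give 1.
  binom⊖ : ℕ → ℕ → ℕ → Carrier
  binom⊖ N e k = binomᶻ (N ℤ.⊖ e) k

  binom⊖-≤ : ∀ e n k → binom⊖ (e ℕ.+ n) e k ≈ binom n k
  binom⊖-≤ e n k = reflexive (≡.cong (λ x → binomᶻ x k)
    (≡.trans (ℤₚ.⊖-≥ (ℕₚ.m≤m+n e n)) (≡.cong +_ (ℕₚ.m+n∸m≡n e n))))

  binomᶻ-neg : ∀ {n} k → 0 < n → binomᶻ (ℤ.- (+ n)) k ≈ 0#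
  binomᶻ-neg {suc n} k _ = refl

  binom⊖-0 : ∀ N e k → N < e ℕ.+ k → binom⊖ N e k ≈ 0#
  binom⊖-0 N e k N<e+k with ℕₚ.≤-<-connex e N
  ... | inj₂ N<e = trans (reflexive (≡.cong (λ x → binomᶻ x k) (ℤₚ.⊖-< N<e))) (binomᶻ-neg k (ℕₚ.m<n⇒0<n∸m N<e))
  ... | inj₁ e≤N with n , ≡.refl ← ℕₚ.m≤n⇒∃[o]m+o≡n e≤N =
    trans (binom⊖-≤ e n k) (binom-< (ℕₚ.+-cancelˡ-< e n k N<e+k))

  -- The additional multiplier q^e turns the exponent (N - e) - k into N, which makes sense for N <
  -- e as well.
  pascal-⊖ : ∀ N e k → Q e * (Q k * binom⊖ (suc N) e (suc k)) ≈ Q e * (Q k * binom⊖ N e (suc k)) + Q N * binom⊖ N e k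
  pascal-⊖ N e k with ℕₚ.≤-<-connex e N
  ... | inj₂ N<e = begin
    Q e * (Q k * binom⊖ (suc N) e (suc k))   ≈⟨ *-congˡ (*-congˡ (binom⊖-0 (suc N) e (suc k) (ℕₚ.≤-<-trans N<e (ℕₚ.m<m+n e ℕ.z<s)))) ⟩
    Q e * (Q k * 0#)                         ≈⟨ solve 3 (λ x y z → x :* (y :* con (+ 0)) := x :* (y :* con (+ 0)) :+ z :* con (+ 0)) refl (Q e) (Q k) (Q N) ⟩
    Q e * (Q k * 0#) + Q N * 0#              ≈⟨ +-cong (*-congˡ (*-congˡ (binom⊖-0 N e (suc k) (ℕₚ.m≤n⇒m≤n+o _ N<e)))) (*-congˡ (binom⊖-0 N e k (ℕₚ.m≤n⇒m≤n+o _ N<e))) ⟨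
    Q e * (Q k * binom⊖ N e (suc k)) + Q N * binom⊖ N e k ∎
  ... | inj₁ e≤N with n , ≡.refl ← ℕₚ.m≤n⇒∃[o]m+o≡n e≤N = begin
    Q e * (Q k * binom⊖ (suc (e ℕ.+ n)) e (suc k))  ≈⟨ *-congˡ (*-congˡ (trans (reflexive (≡.cong (λ N → binom⊖ N e (suc k)) (≡.sym (ℕₚ.+-suc e n)))) (binom⊖-≤ e (suc n) (suc k)))) ⟩
    Q e * (Q k * binom (suc n) (suc k))             ≈⟨ *-congˡ (pascal n k) ⟩
    Q e * (Q k * binom n (suc k) + Q n * binom n k) ≈⟨ solve 4 (λ e b n c → e :* (b :+ n :* c) := e :* b :+ e :* n :* c) refl _ _ _ _ ⟩
    Q e * (Q k * binom n (suc k)) + Q e * Q n * binom n k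
      ≈⟨ +-cong (*-congˡ (*-congˡ (binom⊖-≤ e n (suc k)))) (*-cong (Q-+ e n) (binom⊖-≤ e n k)) ⟨
    Q e * (Q k * binom⊖ (e ℕ.+ n) e (suc k)) + Q (e ℕ.+ n) * binom⊖ (e ℕ.+ n) e k ∎

  -- The binomial of N - 1 over ν - 1. At N = suc y and ν = suc μ it computes to `binom y μ`, which
  -- is why later lemmas take a + e in the form suc y.
  binom⊖1-pred : ℕ → ℕ → Carrier
  binom⊖1-pred N zero    = 0#
  binom⊖1-pred N (suc μ) = binom⊖ N 1 μ

  term₁ : (a b ν : ℕ) → Carrier
  term₁ a b ν = Q (ν ℕ.* ν) * (binom a ν * binom b ν)

  -- Here z stands for a + e; as a separate argument it can be given as a successor.
  term₂ : (z b e ν : ℕ) → Carrier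
  term₂ z b e ν = Q (ν ℕ.* ν) * (Q e * (binom⊖ (suc b) e (suc ν) * binom⊖1-pred z ν))

  φ : (a b e ν : ℕ) → Carrier
  φ a b e ν = Q (ν ℕ.* ν) * (binom a ν * binom b ν - Q e * (binom⊖ (suc b) e (suc ν) * binom⊖1-pred (a ℕ.+ e) ν))

  φ-terms : ∀ a b e ν → φ a b e ν ≈ term₁ a b ν - term₂ (a ℕ.+ e) b e ν
  φ-terms a b e ν = solve 3 (λ q x y → q :* (x :- y) := q :* x :- q :* y) refl _ _ _

  φ-0 : ∀ a b e → φ a b e 0 ≈ 1#
  φ-0 a b e = trans (*-cong Q-0 (+-cong (*-cong (binom-0 a) (binom-0 b)) refl))
    (solve 2 (λ x y → con (+ 1) :* (con (+ 1) :* con (+ 1) :- x :* (y :* con (+ 0))) := con (+ 1)) refl (Q e) (binom⊖ (suc b) e 1))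

  φ-suc-0 : ∀ a b e μ → binom a (suc μ) * binom b (suc μ) ≈ 0# → binom⊖ (suc b) e (suc (suc μ)) ≈ 0# → φ a b e (suc μ) ≈ 0#
  φ-suc-0 a b e μ αβ≈0 γ≈0 = trans (*-congˡ (+-cong αβ≈0 (-‿cong (*-congˡ (*-congʳ γ≈0)))))
    (solve 3 (λ q e g → q :* (con (+ 0) :- e :* (con (+ 0) :* g)) := con (+ 0)) refl _ _ _)

  -- With ν = μ + 1, the first product vanishes because ν exceeds a = 0, the second because b - e +
  -- 1 ≤ 1 < ν + 1.
  φ-row-0 : ∀ b e μ → b ≤ e → φ 0 b e (suc μ) ≈ 0#
  φ-row-0 b e μ b≤e = φ-suc-0 0 b e μ (trans (*-congʳ (binom-< {0} {suc μ} ℕ.z<s)) (zeroˡ _))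
    (binom⊖-0 (suc b) e (suc (suc μ)) (ℕₚ.≤-trans (ℕₚ.+-monoʳ-≤ 2 b≤e) (ℕₚ.≤-trans (ℕₚ.≤-reflexive (ℕₚ.+-comm 2 e)) (ℕₚ.+-monoʳ-≤ e (ℕₚ.m≤m+n 2 μ)))))

  φ-col-0 : ∀ a e μ → φ a 0 e (suc μ) ≈ 0#
  φ-col-0 a e μ = φ-suc-0 a 0 e μ (trans (*-congˡ (binom-< {0} {suc μ} ℕ.z<s)) (zeroʳ _))
    (binom⊖-0 1 e (suc (suc μ)) (ℕₚ.≤-trans (ℕₚ.m≤m+n 2 μ) (ℕₚ.m≤n+m (2 ℕ.+ μ) e)))

  private
    Q-square : ∀ μ → Q (suc μ ℕ.* suc μ) ≈ Q (μ ℕ.* μ) * (Q μ * Q (suc μ))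
    Q-square μ = begin
      Q (suc μ ℕ.* suc μ)            ≡⟨ ≡.cong Q (+-*-Solver.solve 1 (λ μ → (con′ 1 +′ μ) *′ (con′ 1 +′ μ) =′ μ *′ μ +′ (μ +′ (con′ 1 +′ μ))) ≡.refl μ) ⟩
      Q (μ ℕ.* μ ℕ.+ (μ ℕ.+ suc μ))  ≈⟨ Q-+ (μ ℕ.* μ) _ ⟩
      Q (μ ℕ.* μ) * Q (μ ℕ.+ suc μ)  ≈⟨ *-congˡ (Q-+ μ (suc μ)) ⟩
      Q (μ ℕ.* μ) * (Q μ * Q (suc μ)) ∎
      where open +-*-Solver using () renaming (con to con′; _:+_ to _+′_; _:*_ to _*′_; _:=_ to _=′_)

    Q-square₁ : ∀ μ → Q (suc μ ℕ.* suc μ) ≈ Q (μ ℕ.* μ) * (Q μ * (Q 1 * Q μ))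
    Q-square₁ μ = trans (Q-square μ) (*-congˡ (*-congˡ (Q-+ 1 μ)))

    -- If each factor depends on one of two variables, the mixed second difference of the product is
    -- the product of the first differences u and v.
    bilinear : ∀ c {x₁ x₀ u y₁ y₀ v} → x₁ ≈ x₀ + u → y₁ ≈ y₀ + v →
               c * (x₁ * y₁) + c * (x₀ * y₀) ≈ c * (x₀ * y₁) + c * (x₁ * y₀) + c * (u * v)
    bilinear c {x₁} {x₀} {u} {y₁} {y₀} {v} x₁≈ y₁≈ = begin
      c * (x₁ * y₁) + c * (x₀ * y₀)              ≈⟨ +-congʳ (*-congˡ (*-cong x₁≈ y₁≈)) ⟩
      c * ((x₀ + u) * (y₀ + v)) + c * (x₀ * y₀)
        ≈⟨ solve 5 (λ c x u y v → c :* ((x :+ u) :* (y :+ v)) :+ c :* (x :* y)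
             := c :* (x :* (y :+ v)) :+ c :* ((x :+ u) :* y) :+ c :* (u :* v)) refl c x₀ u y₀ v ⟩
      c * (x₀ * (y₀ + v)) + c * ((x₀ + u) * y₀) + c * (u * v)
        ≈⟨ +-congʳ (+-cong (*-congˡ (*-congˡ y₁≈)) (*-congˡ (*-congʳ x₁≈))) ⟨
      c * (x₀ * y₁) + c * (x₁ * y₀) + c * (u * v) ∎

    -- Splits ν² = μ² + 1 + μ + μ for ν = μ + 1, so that each binomial receives the q^μ that
    -- `pascal` asks for.
    term₁-suc : ∀ a b μ → term₁ a b (suc μ) ≈ Q (μ ℕ.* μ) * Q 1 * (Q μ * binom a (suc μ) * (Q μ * binom b (suc μ)))
    term₁-suc a b μ = trans (*-congʳ (Q-square₁ μ))
      (solve 5 (λ s m i x y → s :* (m :* (i :* m)) :* (x :* y) := s :* i :* (m :* x :* (m :* y))) refl _ _ _ _ _)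

    term₁-mixed : ∀ a b μ → term₁ (suc a) (suc b) (suc μ) + term₁ a b (suc μ)
      ≈ term₁ a (suc b) (suc μ) + term₁ (suc a) b (suc μ) + Q (suc (a ℕ.+ b)) * term₁ a b μ
    term₁-mixed a b μ = begin
      term₁ (suc a) (suc b) (suc μ) + term₁ a b (suc μ)
        ≈⟨ +-cong (term₁-suc (suc a) (suc b) μ) (term₁-suc a b μ) ⟩
      w * (_ * _) + w * (_ * _)                     ≈⟨ bilinear w (pascal a μ) (pascal b μ) ⟩
      w * (_ * _) + w * (_ * _) + w * (Q a * binom a μ * (Q b * binom b μ))
        ≈⟨ +-cong (+-cong (term₁-suc a (suc b) μ) (term₁-suc (suc a) b μ)) (begin
             Q (suc (a ℕ.+ b)) * term₁ a b μ              ≈⟨ *-congʳ (trans (Q-+ 1 (a ℕ.+ b)) (*-congˡ (Q-+ a b))) ⟩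
             Q 1 * (Q a * Q b) * term₁ a b μ
               ≈⟨ solve 6 (λ i a b s x y → i :* (a :* b) :* (s :* (x :* y)) := s :* i :* (a :* x :* (b :* y))) refl _ _ _ _ _ _ ⟩
             w * (Q a * binom a μ * (Q b * binom b μ))    ∎) ⟨
      term₁ a (suc b) (suc μ) + term₁ (suc a) b (suc μ) + Q (suc (a ℕ.+ b)) * term₁ a b μ ∎
      where w = Q (μ ℕ.* μ) * Q 1

    -- Splits ν² = μ² + 1 + κ + ν: the powers q^ν and q^κ go to the binomials with lower indices ν +
    -- 1 and κ + 1, as the two Pascal rules ask.
    term₂-suc : ∀ y b e κ → let μ = suc κ; ν = suc μ in
      term₂ (suc y) b e ν ≈ Q (μ ℕ.* μ) * Q 1 * (Q e * (Q ν * binom⊖ (suc b) e (suc ν)) * (Q κ * binom y μ))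
    term₂-suc y b e κ = trans (*-congʳ (trans (Q-square (suc κ)) (*-congˡ (*-congʳ (Q-+ 1 κ)))))
      (solve 7 (λ s i k n e x y → s :* (i :* k :* n) :* (e :* (x :* y)) := s :* i :* (e :* (n :* x) :* (k :* y))) refl _ _ _ _ _ _ _)

    term₂-mixed : ∀ a b e μ y → a ℕ.+ e ≡ suc y →
      term₂ (suc (suc y)) (suc b) e (suc μ) + term₂ (suc y) b e (suc μ)
      ≈ term₂ (suc y) (suc b) e (suc μ) + term₂ (suc (suc y)) b e (suc μ) + Q (suc (a ℕ.+ b)) * term₂ (suc y) b e μ
    -- For ν = 1 the second binomial has lower index 0 and does not change with a, so the mixed
    -- difference is zero; so is the term at ν = 0.
    term₂-mixed a b e zero y a+e≡ =
      solve 7 (λ s e x y q z w → s :* (e :* (x :* con (+ 1))) :+ s :* (e :* (y :* con (+ 1)))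
        := s :* (e :* (x :* con (+ 1))) :+ s :* (e :* (y :* con (+ 1))) :+ q :* (z :* (e :* (w :* con (+ 0))))) refl _ _ _ _ _ _ _
    term₂-mixed a b e (suc κ) y a+e≡ = begin
      term₂ (suc (suc y)) (suc b) e ν + term₂ (suc y) b e ν
        ≈⟨ +-cong (term₂-suc (suc y) (suc b) e κ) (term₂-suc y b e κ) ⟩
      -- The first factor varies with b and the second with a, so the two middle terms come out in
      -- the opposite order.
      w * (_ * _) + w * (_ * _)                     ≈⟨ trans (bilinear w (pascal-⊖ (suc b) e ν) (pascal y κ)) (+-congʳ (+-comm _ _)) ⟩
      w * (_ * _) + w * (_ * _) + w * (Q (suc b) * binom⊖ (suc b) e ν * (Q y * binom y κ))
        ≈⟨ +-cong (+-cong (term₂-suc y (suc b) e κ) (term₂-suc (suc y) b e κ)) (begin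
             Q (suc (a ℕ.+ b)) * term₂ (suc y) b e μ
               ≈⟨ solve 5 (λ q s e x y → q :* (s :* (e :* (x :* y))) := q :* e :* (s :* (x :* y))) refl _ _ _ _ _ ⟩
             Q (suc (a ℕ.+ b)) * Q e * (Q (μ ℕ.* μ) * (binom⊖ (suc b) e ν * binom y κ))
               ≈⟨ *-congʳ exponents ⟩
             Q 1 * (Q (suc b) * Q y) * (Q (μ ℕ.* μ) * (binom⊖ (suc b) e ν * binom y κ))
               ≈⟨ solve 6 (λ i b y s u v → i :* (b :* y) :* (s :* (u :* v)) := s :* i :* (b :* u :* (y :* v))) refl _ _ _ _ _ _ ⟩
             w * (Q (suc b) * binom⊖ (suc b) e ν * (Q y * binom y κ)) ∎) ⟨
      term₂ (suc y) (suc b) e ν + term₂ (suc (suc y)) b e ν + Q (suc (a ℕ.+ b)) * term₂ (suc y) b e μ ∎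
      where
      μ = suc κ
      ν = suc μ
      w = Q (μ ℕ.* μ) * Q 1
      exponents : Q (suc (a ℕ.+ b)) * Q e ≈ Q 1 * (Q (suc b) * Q y)
      exponents = begin
        Q (suc (a ℕ.+ b)) * Q e      ≈⟨ Q-+ (suc (a ℕ.+ b)) e ⟨
        Q (suc (a ℕ.+ b ℕ.+ e))      ≡⟨ ≡.cong (λ n → Q (suc n)) (≡.trans (≡.cong (ℕ._+ e) (ℕₚ.+-comm a b)) (≡.trans (ℕₚ.+-assoc b a e) (≡.trans (≡.cong (b ℕ.+_) a+e≡) (ℕₚ.+-suc b y)))) ⟩
        Q (1 ℕ.+ (suc b ℕ.+ y))      ≈⟨ trans (Q-+ 1 (suc b ℕ.+ y)) (*-congˡ (Q-+ (suc b) y)) ⟩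
        Q 1 * (Q (suc b) * Q y)      ∎

  φ-mixed : ∀ a b e y μ → a ℕ.+ e ≡ suc y →
    φ (suc a) (suc b) e (suc μ) + φ a b e (suc μ)
    ≈ φ a (suc b) e (suc μ) + φ (suc a) b e (suc μ) + Q (suc (a ℕ.+ b)) * φ a b e μ
  φ-mixed a b e y μ a+e≡ = begin
    φ (suc a) (suc b) e (suc μ) + φ a b e (suc μ)
      ≈⟨ +-cong (φ≈ (suc a) (suc b) (suc μ) (≡.cong suc a+e≡)) (φ≈ a b (suc μ) a+e≡) ⟩
    t₁₁ - s₁₁ + (t₀₀ - s₀₀)          ≈⟨ solve 4 (λ a b c d → a :- b :+ (c :- d) := a :+ c :- (b :+ d)) refl t₁₁ s₁₁ t₀₀ s₀₀ ⟩
    t₁₁ + t₀₀ - (s₁₁ + s₀₀)          ≈⟨ +-cong (term₁-mixed a b μ) (-‿cong (term₂-mixed a b e μ y a+e≡)) ⟩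
    t₀₁ + t₁₀ + q * τ - (s₀₁ + s₁₀ + q * s)
      ≈⟨ solve 7 (λ a b c d q x y → a :+ b :+ q :* x :- (c :+ d :+ q :* y) := a :- c :+ (b :- d) :+ q :* (x :- y)) refl t₀₁ t₁₀ s₀₁ s₁₀ q τ s ⟩
    t₀₁ - s₀₁ + (t₁₀ - s₁₀) + q * (τ - s)
      ≈⟨ +-cong (+-cong (φ≈ a (suc b) (suc μ) a+e≡) (φ≈ (suc a) b (suc μ) (≡.cong suc a+e≡))) (*-congˡ (φ≈ a b μ a+e≡)) ⟨
    φ a (suc b) e (suc μ) + φ (suc a) b e (suc μ) + q * φ a b e μ ∎
    where
    φ≈ : ∀ a b ν {z} → a ℕ.+ e ≡ z → φ a b e ν ≈ term₁ a b ν - term₂ z b e ν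
    φ≈ a b ν ≡.refl = φ-terms a b e ν
    q   = Q (suc (a ℕ.+ b))
    t₁₁ = term₁ (suc a) (suc b) (suc μ)
    t₁₀ = term₁ (suc a) b (suc μ)
    t₀₁ = term₁ a (suc b) (suc μ)
    t₀₀ = term₁ a b (suc μ)
    τ   = term₁ a b μ
    s₁₁ = term₂ (suc (suc y)) (suc b) e (suc μ)
    s₁₀ = term₂ (suc (suc y)) b e (suc μ)
    s₀₁ = term₂ (suc y) (suc b) e (suc μ)
    s₀₀ = term₂ (suc y) b e (suc μ)
    s   = term₂ (suc y) b e μ

  -- Both first differences in b are the same multiple of `binom a ν * binom y μ`: in the second
  -- product Pascal produces the upper index y + 1 - e, and this is a.
  φ-boundary : ∀ a e y μ → a ℕ.+ e ≡ suc y → φ a (suc y) e (suc μ) ≈ φ a y e (suc μ)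
  φ-boundary a e y μ a+e≡ = begin
    φ a (suc y) e ν                                          ≈⟨ expand (suc y) ⟩
    s * (α * (Q μ * binom (suc y) ν)) - s′ * (Q e * (Q ν * binom⊖ (suc (suc y)) e (suc ν)) * δ)
      ≈⟨ +-cong (*-congˡ (*-congˡ (pascal y μ))) (-‿cong (*-congˡ (*-congʳ (pascal-⊖ (suc y) e ν)))) ⟩
    s * (α * (β + Q y * binom y μ)) - s′ * ((γ + Q (suc y) * binom⊖ (suc y) e ν) * δ)
      ≈⟨ +-congˡ (-‿cong (*-congˡ (*-congʳ (+-congˡ (*-cong (Q-+ 1 y) binom⊖≈))))) ⟩
    s * (α * (β + Q y * binom y μ)) - s′ * ((γ + Q 1 * Q y * α) * δ)
      ≈⟨ +-cong (*-congˡ (*-congˡ (+-congˡ (*-congˡ δ≈)))) refl ⟩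
    s * (α * (β + Q y * δ)) - s′ * ((γ + Q 1 * Q y * α) * δ)
      ≈⟨ solve 7 (λ s i a b y d g → s :* i :* (a :* (b :+ y :* d)) :- s :* ((g :+ i :* y :* a) :* d)
           := s :* i :* (a :* b) :- s :* (g :* d)) refl s′ (Q 1) α β (Q y) δ γ ⟩
    s * (α * β) - s′ * (γ * δ)                               ≈⟨ expand y ⟨
    φ a y e ν                                                ∎
    where
    ν  = suc μ
    s′ = Q (μ ℕ.* μ) * Q μ
    s  = s′ * Q 1
    α  = binom a ν
    β  = Q μ * binom y ν
    γ  = Q e * (Q ν * binom⊖ (suc y) e (suc ν))
    δ  = binom⊖1-pred (a ℕ.+ e) ν
    δ≈ : binom y μ ≈ δ
    δ≈ = reflexive (≡.cong (λ z → binom⊖1-pred z ν) (≡.sym a+e≡))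
    binom⊖≈ : binom⊖ (suc y) e ν ≈ α
    binom⊖≈ = trans (reflexive (≡.cong (λ z → binom⊖ z e ν) (≡.trans (≡.sym a+e≡) (ℕₚ.+-comm a e)))) (binom⊖-≤ e a ν)
    expand : ∀ b → φ a b e ν ≈ s * (α * (Q μ * binom b ν)) - s′ * (Q e * (Q ν * binom⊖ (suc b) e (suc ν)) * δ)
    expand b = begin
      φ a b e ν                                      ≈⟨ φ-terms a b e ν ⟩
      term₁ a b ν - term₂ (a ℕ.+ e) b e ν            ≈⟨ +-cong (*-congʳ (Q-square₁ μ)) (-‿cong (*-congʳ (Q-square μ))) ⟩
      Q (μ ℕ.* μ) * (Q μ * (Q 1 * Q μ)) * (α * binom b ν) - Q (μ ℕ.* μ) * (Q μ * Q ν) * (Q e * (binom⊖ (suc b) e (suc ν) * δ))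
        ≈⟨ solve 9 (λ s m i a b n e c d → s :* (m :* (i :* m)) :* (a :* b) :- s :* (m :* n) :* (e :* (c :* d))
             := s :* m :* i :* (a :* (m :* b)) :- s :* m :* (e :* (n :* c) :* d)) refl _ _ _ _ _ _ _ _ _ ⟩
      s * (α * (Q μ * binom b ν)) - s′ * (Q e * (Q ν * binom⊖ (suc b) e (suc ν)) * δ) ∎

-- The recursion for Φ and Ψ

-- The weight `w n` stands for qⁿ t. As a parameter it lets one record cover both Φ(t) and Φ(qt),
-- whose weights are shifted by one.
record ΦRecursion {c ℓ} (S : CommutativeRing c ℓ) (w : ℕ → CommutativeRing.Carrier S)
                  (Φ : (a b e : ℕ) → CommutativeRing.Carrier S) : Set ℓ where
  open CommutativeRing S
  field
    row-0    : ∀ {b e} → b ≤ e → Φ 0 b e ≈ 1#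
    col-0    : ∀ a e → Φ a 0 e ≈ 1#
    boundary : ∀ {a e y} → a ℕ.+ e ≡ suc y → Φ a (suc y) e ≈ Φ a y e
    interior : ∀ {a e y} b → a ℕ.+ e ≡ suc y →
               Φ (suc a) (suc b) e ≈ Φ a (suc b) e + Φ (suc a) b e - (1# - w (suc (a ℕ.+ b))) * Φ a b e

  interior-< : ∀ {a b e} → b < a ℕ.+ e →
    Φ (suc a) (suc b) e ≈ Φ a (suc b) e + Φ (suc a) b e - (1# - w (suc (a ℕ.+ b))) * Φ a b e
  interior-< {b = b} b< with _ , eq ← ℕₚ.m≤n⇒∃[o]m+o≡n b< = interior b (≡.sym eq)

module ΨSums {c ℓ} (S : CommutativeRing c ℓ) {w : ℕ → CommutativeRing.Carrier S}
  {Φ Φ⁺ : (a b e : ℕ) → CommutativeRing.Carrier S}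
  (Φ-rec : ΦRecursion S w Φ) (Φ⁺-rec : ΦRecursion S (w ∘ suc) Φ⁺) where

  open CommutativeRing S
  open IntegerSolver S
  open SetoidReasoning setoid
  open SemiringSum semiring using (sum; sum-cong-≋)
  private
    module F  = ΦRecursion Φ-rec
    module F⁺ = ΦRecursion Φ⁺-rec
    x = w 0

  Ψ′ : (a b e : ℕ) → Carrier
  Ψ′ zero    b e = 1#
  Ψ′ (suc a) b e = Φ (suc a) b e + (w 0 - 1#) * Φ⁺ a b (suc e)

  -- The factor t - 1 turns the value 1 of Φ into t. That the result is the same for all a lets the
  -- ends of two sums cancel in `T-interior`.
  Ψ′-col-0 : ∀ a e → Ψ′ (suc a) 0 e ≈ w 0
  Ψ′-col-0 a e = trans (+-cong (F.col-0 (suc a) e) (*-congˡ (F⁺.col-0 a (suc e))))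
    (solve 1 (λ x → con (+ 1) :+ (x :- con (+ 1)) :* con (+ 1) := x) refl x)

  Ψ′-boundary : ∀ a {e y} → a ℕ.+ e ≡ suc y → Ψ′ a (suc y) e ≈ Ψ′ a y e
  Ψ′-boundary zero    eq = refl
  Ψ′-boundary (suc a) eq = +-cong (F.boundary eq) (*-congˡ (F⁺.boundary (≡.trans (ℕₚ.+-suc a _) eq)))

  -- Going from Φ(a + 1, b, e) to Φ⁺(a, b, e + 1) preserves the boundary, since the first and third
  -- arguments have the same sum, and the shifted weights of Φ⁺ make up for the smaller a. Both obey
  -- one linear recursion, hence so does their combination.
  Ψ′-interior : ∀ a {b e} → suc b ≤ a ℕ.+ e →
    Ψ′ (suc a) (suc b) e ≈ Ψ′ a (suc b) e + Ψ′ (suc a) b e - (1# - w (suc (a ℕ.+ b))) * Ψ′ a b e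
  -- The left neighbours are now the constant 1 of Ψ; the hypothesis keeps b + 1 in the range where
  -- Φ(0, b + 1, ·) is 1 too.
  Ψ′-interior zero {b} {suc e} b<e = begin
    Φ 1 (suc b) (suc e) + (x - 1#) * Φ⁺ 0 (suc b) (suc (suc e))
      ≈⟨ +-cong (F.interior b ≡.refl) (*-congˡ (F⁺.row-0 (ℕₚ.m≤n⇒m≤1+n b<e))) ⟩
    Φ 0 (suc b) (suc e) + Φ 1 b (suc e) - (1# - w (suc b)) * Φ 0 b (suc e) + (x - 1#) * 1#
      ≈⟨ +-congʳ (+-cong (+-congʳ (F.row-0 b<e)) (-‿cong (*-congˡ (F.row-0 (ℕₚ.<⇒≤ b<e))))) ⟩
    1# + Φ 1 b (suc e) - (1# - w (suc b)) * 1# + (x - 1#) * 1#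
      ≈⟨ solve 3 (λ f w x → con (+ 1) :+ f :- (con (+ 1) :- w) :* con (+ 1) :+ (x :- con (+ 1)) :* con (+ 1)
           := con (+ 1) :+ (f :+ (x :- con (+ 1)) :* con (+ 1)) :- (con (+ 1) :- w) :* con (+ 1)) refl _ _ _ ⟩
    1# + (Φ 1 b (suc e) + (x - 1#) * 1#) - (1# - w (suc b)) * 1#
      ≈⟨ +-congʳ (+-congˡ (+-congˡ (*-congˡ (F⁺.row-0 (ℕₚ.≤-trans (ℕₚ.<⇒≤ b<e) (ℕₚ.n≤1+n _)))))) ⟨
    1# + (Φ 1 b (suc e) + (x - 1#) * Φ⁺ 0 b (suc (suc e))) - (1# - w (suc b)) * 1# ∎
  Ψ′-interior (suc a) {b} {e} _ = begin
    Φ (2 ℕ.+ a) (suc b) e + (x - 1#) * Φ⁺ (suc a) (suc b) (suc e)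
      ≈⟨ +-cong (F.interior b ≡.refl) (*-congˡ (F⁺.interior b (ℕₚ.+-suc a e))) ⟩
    Φ (suc a) (suc b) e + Φ (2 ℕ.+ a) b e - ω * Φ (suc a) b e
      + (x - 1#) * (Φ⁺ a (suc b) (suc e) + Φ⁺ (suc a) b (suc e) - ω * Φ⁺ a b (suc e))
      ≈⟨ solve 8 (λ f g h y o f⁺ g⁺ h⁺ → f :+ g :- o :* h :+ y :* (f⁺ :+ g⁺ :- o :* h⁺)
           := f :+ y :* f⁺ :+ (g :+ y :* g⁺) :- o :* (h :+ y :* h⁺)) refl _ _ _ _ _ _ _ _ ⟩
    Ψ′ (suc a) (suc b) e + Ψ′ (2 ℕ.+ a) b e - ω * Ψ′ (suc a) b e ∎
    where ω = 1# - w (2 ℕ.+ (a ℕ.+ b))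

  -- T δ p u v is the sum over 0 ≤ i ≤ min(u, v) of Ψ(p + i, v - i, δ + 2(u - i)).
  T : (δ p u v : ℕ) → Carrier
  T δ p zero    v       = Ψ′ p v δ
  T δ p (suc u) zero    = Ψ′ p 0 (δ ℕ.+ 2 ℕ.* suc u)
  T δ p (suc u) (suc v) = Ψ′ p (suc v) (δ ℕ.+ 2 ℕ.* suc u) + T δ (suc p) u v

  T-col-0 : ∀ δ p u → T δ (suc p) u 0 ≈ w 0
  T-col-0 δ p zero    = Ψ′-col-0 p δ
  T-col-0 δ p (suc u) = Ψ′-col-0 p (δ ℕ.+ 2 ℕ.* suc u)

  private
    -- Dropping the first summand of `T` raises p and lowers u and v by one; the bound p + δ + 2u
    -- then falls by one, just as v does.
    shift : ∀ p δ u → p ℕ.+ (δ ℕ.+ 2 ℕ.* suc u) ≡ suc (suc p ℕ.+ (δ ℕ.+ 2 ℕ.* u))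
    shift = solve′ 3 (λ p d u → p +′ (d +′ con′ 2 *′ (con′ 1 +′ u)) =′ con′ 1 +′ (con′ 1 +′ p +′ (d +′ con′ 2 *′ u))) ≡.refl
      where open +-*-Solver using () renaming (solve to solve′; con to con′; _:+_ to _+′_; _:*_ to _*′_; _:=_ to _=′_)

  T-boundary : ∀ δ p u v → p ℕ.+ (δ ℕ.+ 2 ℕ.* u) ≡ suc v → T δ p u (suc v) ≈ T δ p u v
  T-boundary δ p zero    v eq = Ψ′-boundary p (≡.trans (≡.cong (p ℕ.+_) (≡.sym (ℕₚ.+-identityʳ δ))) eq)
  T-boundary δ p (suc u) zero eq with () ← ≡.trans (≡.sym eq) (shift p δ u)
  T-boundary δ p (suc u) (suc v) eq = +-cong (Ψ′-boundary p eq)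
    (T-boundary δ (suc p) u v (ℕₚ.suc-injective (≡.trans (≡.sym (shift p δ u)) eq)))

  -- Along the sum, the first two arguments of Ψ have the constant total p + v, so all summands
  -- share one weight and their recursions can be added.
  T-interior : ∀ δ p u v → suc v ≤ p ℕ.+ (δ ℕ.+ 2 ℕ.* u) →
    T δ (suc p) u (suc v) ≈ T δ p u (suc v) + T δ (suc p) u v - (1# - w (suc (p ℕ.+ v))) * T δ p u v
  T-interior δ p zero v v< = Ψ′-interior p (≡.subst (suc v ≤_) (≡.cong (p ℕ.+_) (ℕₚ.+-identityʳ δ)) v<)
  T-interior δ p (suc u) zero v< = begin
    -- For v = 1 the sums at p + 1 and at p each have one summand more than for v = 0. Both extra
    -- summands equal t and cancel.
    Ψ′ (suc p) 1 e + T δ (suc (suc p)) u 0   ≈⟨ +-cong (Ψ′-interior p v<) (T-col-0 δ (suc p) u) ⟩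
    Ψ′ p 1 e + Ψ′ (suc p) 0 e - ω * Ψ′ p 0 e + x
      ≈⟨ solve 4 (λ a b c x → a :+ b :- c :+ x := a :+ x :+ b :- c) refl _ _ _ _ ⟩
    Ψ′ p 1 e + x + Ψ′ (suc p) 0 e - ω * Ψ′ p 0 e
      ≈⟨ +-congʳ (+-congʳ (+-congˡ (T-col-0 δ p u))) ⟨
    Ψ′ p 1 e + T δ (suc p) u 0 + Ψ′ (suc p) 0 e - ω * Ψ′ p 0 e ∎
    where
    e = δ ℕ.+ 2 ℕ.* suc u
    ω = 1# - w (suc (p ℕ.+ 0))
  T-interior δ p (suc u) (suc v) v< = begin
    Ψ′ (suc p) (2 ℕ.+ v) e + T δ (2 ℕ.+ p) u (suc v)
      ≈⟨ +-cong (Ψ′-interior p v<) (T-interior δ (suc p) u v (ℕₚ.≤-pred (≡.subst (2 ℕ.+ v ≤_) (shift p δ u) v<))) ⟩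
    Ψ′ p (2 ℕ.+ v) e + Ψ′ (suc p) (suc v) e - ω (suc (p ℕ.+ suc v)) * Ψ′ p (suc v) e
      + (T δ (suc p) u (suc v) + T δ (2 ℕ.+ p) u v - ω (2 ℕ.+ (p ℕ.+ v)) * T δ (suc p) u v)
      ≈⟨ +-congʳ (+-congˡ (-‿cong (*-congʳ ω≈))) ⟩
    Ψ′ p (2 ℕ.+ v) e + Ψ′ (suc p) (suc v) e - ω (2 ℕ.+ (p ℕ.+ v)) * Ψ′ p (suc v) e
      + (T δ (suc p) u (suc v) + T δ (2 ℕ.+ p) u v - ω (2 ℕ.+ (p ℕ.+ v)) * T δ (suc p) u v)
      ≈⟨ solve 7 (λ a b c d f g o → a :+ b :- o :* c :+ (d :+ f :- o :* g)
           := a :+ d :+ (b :+ f) :- o :* (c :+ g)) refl _ _ _ _ _ _ _ ⟩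
    T δ p (suc u) (2 ℕ.+ v) + T δ (suc p) (suc u) (suc v) - ω (2 ℕ.+ (p ℕ.+ v)) * T δ p (suc u) (suc v)
      ≈⟨ +-congˡ (-‿cong (*-congʳ ω≈)) ⟨
    T δ p (suc u) (2 ℕ.+ v) + T δ (suc p) (suc u) (suc v) - ω (suc (p ℕ.+ suc v)) * T δ p (suc u) (suc v) ∎
    where
    e = δ ℕ.+ 2 ℕ.* suc u
    ω = λ n → 1# - w n
    ω≈ : ω (suc (p ℕ.+ suc v)) ≈ ω (2 ℕ.+ (p ℕ.+ v))
    ω≈ = reflexive (≡.cong (ω ∘ suc) (ℕₚ.+-suc p v))

  T-preserves : ∀ {p} (P : Carrier → Set p) → (∀ {f g} → P f → P g → P (f + g)) →
                (∀ a {b e} → b ≤ a ℕ.+ e → P (Ψ′ a b e)) → ∀ δ p u v → v ≤ p ℕ.+ (δ ℕ.+ 2 ℕ.* u) → P (T δ p u v)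
  T-preserves P P+ PΨ δ p zero    v       v≤ = PΨ p (≡.subst (v ≤_) (≡.cong (p ℕ.+_) (ℕₚ.+-identityʳ δ)) v≤)
  T-preserves P P+ PΨ δ p (suc u) zero    v≤ = PΨ p v≤
  T-preserves P P+ PΨ δ p (suc u) (suc v) v≤ = P+ (PΨ p v≤)
    (T-preserves P P+ PΨ δ (suc p) u v (ℕₚ.≤-pred (≡.subst (suc v ≤_) (shift p δ u) v≤)))

  T-sum : ∀ {θ} → IsRingHomomorphism rawRing rawRing θ → ∀ δ p u v →
    sum {suc (u ⊓ v)} (λ i → θ (Ψ′ (p ℕ.+ toℕ i) (v ∸ toℕ i) (δ ℕ.+ 2 ℕ.* (u ∸ toℕ i)))) ≈ θ (T δ p u v)
  T-sum {θ} θ-hom δ = go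
    where
    open IsRingHomomorphism θ-hom
    term : (p u v i : ℕ) → Carrier
    term p u v i = θ (Ψ′ (p ℕ.+ i) (v ∸ i) (δ ℕ.+ 2 ℕ.* (u ∸ i)))
    go : ∀ p u v → sum {suc (u ⊓ v)} (λ i → term p u v (toℕ i)) ≈ θ (T δ p u v)
    go p zero v = trans (+-identityʳ _) (reflexive (≡.cong₂ (λ p e → θ (Ψ′ p v e)) (ℕₚ.+-identityʳ p) (ℕₚ.+-identityʳ δ)))
    go p (suc u) zero = trans (+-identityʳ _) (reflexive (≡.cong (λ p → θ (Ψ′ p 0 _)) (ℕₚ.+-identityʳ p)))
    go p (suc u) (suc v) = sym (trans (+-homo _ _) (+-cong
      (reflexive (≡.cong (λ p → θ (Ψ′ p (suc v) _)) (≡.sym (ℕₚ.+-identityʳ p))))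
      (trans (sym (go (suc p) u v)) (sum-cong-≋ {suc (u ⊓ v)} λ i →
        reflexive (≡.cong (λ p → θ (Ψ′ p (v ∸ toℕ i) (δ ℕ.+ 2 ℕ.* (u ∸ toℕ i)))) (≡.sym (ℕₚ.+-suc p (toℕ i))))))))

  -- The numerator of [0̂, (j, j + v - 1)] for j = r - u and δ = s - 2r; v = 0 stands for [0̂, 0̂].
  N : (δ u v : ℕ) → Carrier
  N δ u zero    = 1#
  N δ u (suc v) = T δ 0 u v

  N-row-0 : ∀ δ v → N δ 0 v ≈ 1#
  N-row-0 δ zero    = refl
  N-row-0 δ (suc v) = refl

  N-col-1 : ∀ δ u → N δ u 1 ≈ 1#
  N-col-1 δ zero    = refl
  N-col-1 δ (suc u) = refl

  N-boundary : ∀ δ u v → δ ℕ.+ 2 ℕ.* u ≡ suc v → N δ u (2 ℕ.+ v) ≈ N δ u (suc v)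
  N-boundary δ u v eq = T-boundary δ 0 u v eq

  -- Raising u prepends the summand Ψ(0, ·, ·) = 1 and moves the rest from p = 0 to p = 1: a step in
  -- u for `N` is a step in p for `T`.
  N-interior : ∀ δ u v → v ≤ δ ℕ.+ 2 ℕ.* u →
    N δ (suc u) (2 ℕ.+ v) ≈ N δ u (suc v) + N δ (suc u) (suc v) - (1# - w v) * N δ u v
  N-interior δ u zero v≤ = begin
    1# + T δ 1 u 0               ≈⟨ +-congˡ (T-col-0 δ 0 u) ⟩
    1# + x                       ≈⟨ solve 1 (λ x → con (+ 1) :+ x := con (+ 1) :+ con (+ 1) :- (con (+ 1) :- x) :* con (+ 1)) refl x ⟩
    1# + 1# - (1# - x) * 1#      ≈⟨ +-congʳ (+-congʳ (N-col-1 δ u)) ⟨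
    N δ u 1 + 1# - (1# - x) * 1# ∎
  N-interior δ u (suc v) v< = begin
    1# + T δ 1 u (suc v)         ≈⟨ +-congˡ (T-interior δ 0 u v v<) ⟩
    1# + (T δ 0 u (suc v) + T δ 1 u v - (1# - w (suc v)) * T δ 0 u v)
      ≈⟨ solve 3 (λ a b c → con (+ 1) :+ (a :+ b :- c) := a :+ (con (+ 1) :+ b) :- c) refl _ _ _ ⟩
    T δ 0 u (suc v) + (1# + T δ 1 u v) - (1# - w (suc v)) * T δ 0 u v ∎

  N-sum : ∀ {θ} → IsRingHomomorphism rawRing rawRing θ →
    (Ψ : (a b e : ℕ) → Carrier) → (∀ a b e → Ψ a b e ≈ θ (Ψ′ a b e)) →
    ∀ {r s j d} δ u v → j ℕ.+ u ≡ r → j ℕ.+ v ≡ d → δ ℕ.+ 2 ℕ.* r ≡ s →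
    sum {suc (r ⊓ d) ∸ j} (λ i → let k = j ℕ.+ toℕ i in Ψ (k ∸ j) (d ∸ k) (s ∸ 2 ℕ.* k)) ≈ θ (N δ u (suc v))
  N-sum {θ} θ-hom Ψ Ψ≈ {j = j} δ u v ≡.refl ≡.refl ≡.refl = begin
    sumTo (suc ((j ℕ.+ u) ⊓ (j ℕ.+ v)) ∸ j)  ≡⟨ ≡.cong sumTo count ⟩
    sumTo (suc (u ⊓ v))
      ≈⟨ sum-cong-≋ {suc (u ⊓ v)} (λ i → term≈ (toℕ i) (ℕₚ.≤-trans (ℕₚ.≤-pred (toℕ<n i)) (ℕₚ.m⊓n≤m u v))) ⟩
    sum {suc (u ⊓ v)} (λ i → θ (Ψ′ (toℕ i) (v ∸ toℕ i) (δ ℕ.+ 2 ℕ.* (u ∸ toℕ i))))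
      ≈⟨ T-sum θ-hom δ 0 u v ⟩
    θ (T δ 0 u v)                            ∎
    where
    term : ℕ → Carrier
    term i = Ψ (j ℕ.+ i ∸ j) (j ℕ.+ v ∸ (j ℕ.+ i)) (δ ℕ.+ 2 ℕ.* (j ℕ.+ u) ∸ 2 ℕ.* (j ℕ.+ i))

    sumTo : ℕ → Carrier
    sumTo n = sum {n} (λ i → term (toℕ i))

    count : suc ((j ℕ.+ u) ⊓ (j ℕ.+ v)) ∸ j ≡ suc (u ⊓ v)
    count = ≡.trans (≡.cong (λ n → suc n ∸ j) (≡.sym (ℕₚ.+-distribˡ-⊓ j u v)))
      (≡.trans (≡.cong (_∸ j) (≡.sym (ℕₚ.+-suc j (u ⊓ v)))) (ℕₚ.m+n∸m≡n j (suc (u ⊓ v))))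

    excess : ∀ {i} → i ≤ u → δ ℕ.+ 2 ℕ.* (j ℕ.+ u) ∸ 2 ℕ.* (j ℕ.+ i) ≡ δ ℕ.+ 2 ℕ.* (u ∸ i)
    excess {i} i≤u = ≡.trans (≡.cong (_∸ 2 ℕ.* (j ℕ.+ i)) (≡.trans
        (≡.cong (λ u → δ ℕ.+ 2 ℕ.* (j ℕ.+ u)) (≡.sym (ℕₚ.m∸n+n≡m i≤u)))
        (solve′ 4 (λ δ j i o → δ +′ con′ 2 *′ (j +′ (o +′ i)) =′ δ +′ con′ 2 *′ o +′ con′ 2 *′ (j +′ i)) ≡.refl δ j i (u ∸ i))))
      (ℕₚ.m+n∸n≡m (δ ℕ.+ 2 ℕ.* (u ∸ i)) (2 ℕ.* (j ℕ.+ i)))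
      where open +-*-Solver using () renaming (solve to solve′; con to con′; _:+_ to _+′_; _:*_ to _*′_; _:=_ to _=′_)

    term≈ : ∀ i → i ≤ u → term i ≈ θ (Ψ′ i (v ∸ i) (δ ℕ.+ 2 ℕ.* (u ∸ i)))
    term≈ i i≤u rewrite ℕₚ.m+n∸m≡n j i | ℕₚ.[m+n]∸[m+o]≡n∸o j v i | excess i≤u = Ψ≈ i (v ∸ i) (δ ℕ.+ 2 ℕ.* (u ∸ i))

module _ {c ℓ} (S : CommutativeRing c ℓ) where
  open CommutativeRing S

  ΦRecursion-map : ∀ {θ w w′ Φ} → IsRingHomomorphism rawRing rawRing θ → (∀ n → θ (w n) ≈ w′ n) →
                   ΦRecursion S w Φ → ΦRecursion S w′ (λ a b e → θ (Φ a b e))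
  ΦRecursion-map {θ} {w} {w′} {Φ} θ-hom θw≈w′ rec = record
    { row-0    = λ b≤e → trans (⟦⟧-cong (row-0 b≤e)) 1#-homo
    ; col-0    = λ a e → trans (⟦⟧-cong (col-0 a e)) 1#-homo
    ; boundary = λ eq → ⟦⟧-cong (boundary eq)
    ; interior = λ b eq → trans (⟦⟧-cong (interior b eq))
        (θ-homo-recursion _ _ _ _)
    }
    where
    open ΦRecursion rec
    open IsRingHomomorphism θ-hom
    θ-homo-recursion : ∀ f g n h → θ (f + g - (1# - w n) * h) ≈ θ f + θ g - (1# - w′ n) * θ h
    θ-homo-recursion f g n h = trans (+-homo _ _) (+-cong (+-homo f g) (trans (-‿homo _) (-‿cong (trans (*-homo _ h)
      (*-congʳ (trans (+-homo _ _) (+-cong 1#-homo (trans (-‿homo _) (-‿cong (θw≈w′ n))))))))))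

  ΦRecursion-resp : ∀ {w Φ Φ′} → (∀ a b e → Φ a b e ≈ Φ′ a b e) → ΦRecursion S w Φ → ΦRecursion S w Φ′
  ΦRecursion-resp Φ≈Φ′ rec = record
    { row-0    = λ b≤e → trans (sym (Φ≈Φ′ _ _ _)) (row-0 b≤e)
    ; col-0    = λ a e → trans (sym (Φ≈Φ′ _ _ _)) (col-0 a e)
    ; boundary = λ eq → trans (sym (Φ≈Φ′ _ _ _)) (trans (boundary eq) (Φ≈Φ′ _ _ _))
    ; interior = λ b eq → trans (sym (Φ≈Φ′ _ _ _)) (trans (interior b eq)
        (+-cong (+-cong (Φ≈Φ′ _ _ _) (Φ≈Φ′ _ _ _)) (-‿cong (*-congˡ (Φ≈Φ′ _ _ _)))))
    }
    where open ΦRecursion rec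

module BivariateΦ {c ℓ} {R : CommutativeRing c ℓ} (qPowers : QPowers R) where
  open CommutativeRing R
  open QPowers qPowers
  open IntegerSolver R
  open GaussianBinomials qPowers using (φ; φ-0; φ-row-0; φ-col-0; φ-boundary; φ-mixed)
  open PowerSeriesRing R
  open PowerSeries rawRing using (Series; X^_; const)
  open SetoidReasoning setoid
  private
    module S = CommutativeRing seriesRing
    module Solver = IntegerSolver seriesRing

  weight : ℕ → Series
  weight n = const (Q n) ⊛ X^ 1

  weight-⊛-0 : ∀ n f → (weight n ⊛ f) 0 ≈ 0#
  weight-⊛-0 n f = trans (⊛-assoc (const (Q n)) (X^ 1) f 0)
    (trans (const-⊛ (Q n) (X^ 1 ⊛ f) 0) (trans (*-congˡ (X^-⊛-< 1 f ℕ.z<s)) (zeroʳ _)))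

  weight-⊛-suc : ∀ n f ν → (weight n ⊛ f) (suc ν) ≈ Q n * f ν
  weight-⊛-suc n f ν = trans (⊛-assoc (const (Q n)) (X^ 1) f (suc ν))
    (trans (const-⊛ (Q n) (X^ 1 ⊛ f) (suc ν)) (*-congˡ (X^-⊛-+ 1 f ν)))

  Φ-recursion : ΦRecursion seriesRing weight φ
  Φ-recursion = record
    { row-0    = λ { {b} {e} b≤e zero → φ-0 0 b e ; {b} {e} b≤e (suc μ) → φ-row-0 b e μ b≤e }
    ; col-0    = λ { a e zero → φ-0 a 0 e ; a e (suc μ) → φ-col-0 a e μ }
    ; boundary = λ { {a} {e} {y} eq zero → trans (φ-0 a (suc y) e) (sym (φ-0 a y e))
                   ; {a} {e} {y} eq (suc μ) → φ-boundary a e y μ eq }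
    ; interior = λ {a} {e} {y} b eq → S.trans {φ (suc a) (suc b) e}
        {φ a (suc b) e ⊞ φ (suc a) b e ⊞ (⊟ φ a b e ⊞ weight (suc (a ℕ.+ b)) ⊛ φ a b e)}
        (coefficient a b e y eq)
        (Solver.solve 4 (λ f g w h → f Solver.:+ g Solver.:+ (Solver.:- h Solver.:+ w Solver.:* h)
            Solver.:= f Solver.:+ g Solver.:- (Solver.con (+ 1) Solver.:- w) Solver.:* h)
          S.refl (φ a (suc b) e) (φ (suc a) b e) (weight (suc (a ℕ.+ b))) (φ a b e))
    }
    where
    coefficient : ∀ a b e y → a ℕ.+ e ≡ suc y → ∀ ν → φ (suc a) (suc b) e ν
      ≈ φ a (suc b) e ν + φ (suc a) b e ν + (- φ a b e ν + (weight (suc (a ℕ.+ b)) ⊛ φ a b e) ν)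
    coefficient a b e y eq zero = trans (φ-0 (suc a) (suc b) e) (sym (trans
      (+-cong (+-cong (φ-0 a (suc b) e) (φ-0 (suc a) b e)) (+-cong (-‿cong (φ-0 a b e)) (weight-⊛-0 (suc (a ℕ.+ b)) (φ a b e))))
      (solve 0 (con (+ 1) :+ con (+ 1) :+ (:- con (+ 1) :+ con (+ 0)) := con (+ 1)) refl)))
    coefficient a b e y eq (suc μ) = begin
      f₁₁                           ≈⟨ solve 2 (λ f h → f := f :+ h :+ :- h) refl f₁₁ f₀₀ ⟩
      f₁₁ + f₀₀ + - f₀₀             ≈⟨ +-congʳ (φ-mixed a b e y μ eq) ⟩
      f₀₁ + f₁₀ + q * f + - f₀₀     ≈⟨ solve 4 (λ a b c d → a :+ b :+ c :+ :- d := a :+ b :+ (:- d :+ c)) refl f₀₁ f₁₀ (q * f) f₀₀ ⟩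
      f₀₁ + f₁₀ + (- f₀₀ + q * f)   ≈⟨ +-congˡ (+-congˡ (weight-⊛-suc (suc (a ℕ.+ b)) (φ a b e) μ)) ⟨
      f₀₁ + f₁₀ + (- f₀₀ + (weight (suc (a ℕ.+ b)) ⊛ φ a b e) (suc μ)) ∎
      where
      q   = Q (suc (a ℕ.+ b))
      f   = φ a b e μ
      f₁₁ = φ (suc a) (suc b) e (suc μ)
      f₁₀ = φ (suc a) b e (suc μ)
      f₀₁ = φ a (suc b) e (suc μ)
      f₀₀ = φ a b e (suc μ)

  dilate : Series → Series
  dilate f n = Q n * f n

  private
    -- The offset m carries the induction, since shifting the left series turns q^k into q^(k+1).
    dilate-⊛ : ∀ m f g n → ((λ k → Q (m ℕ.+ k) * f k) ⊛ dilate g) n ≈ Q (m ℕ.+ n) * (f ⊛ g) n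
    dilate-⊛ m f g zero = trans (+-congʳ (*-congˡ (*-congʳ Q-0)))
      (solve 3 (λ q f g → q :* f :* (con (+ 1) :* g) :+ con (+ 0) := q :* (f :* g :+ con (+ 0))) refl _ _ _)
    dilate-⊛ m f g (suc n) = begin
      Q (m ℕ.+ 0) * f 0 * (Q (suc n) * g (suc n)) + ((λ k → Q (m ℕ.+ suc k) * f (suc k)) ⊛ dilate g) n
        ≈⟨ +-cong (*-congʳ (*-congʳ (reflexive (≡.cong Q (ℕₚ.+-identityʳ m)))))
                  (⊛-cong {λ k → Q (m ℕ.+ suc k) * f (suc k)} {λ k → Q (suc m ℕ.+ k) * f (suc k)} {dilate g} {dilate g}
                     (λ k → *-congʳ (reflexive (≡.cong Q (ℕₚ.+-suc m k)))) (λ _ → refl) n) ⟩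
      Q m * f 0 * (Q (suc n) * g (suc n)) + ((λ k → Q (suc m ℕ.+ k) * f (suc k)) ⊛ dilate g) n
        ≈⟨ +-cong (solve 4 (λ a b c d → a :* b :* (c :* d) := a :* c :* (b :* d)) refl _ _ _ _) (dilate-⊛ (suc m) (f ∘ suc) g n) ⟩
      Q m * Q (suc n) * (f 0 * g (suc n)) + Q (suc m ℕ.+ n) * ((f ∘ suc) ⊛ g) n
        ≈⟨ +-cong (*-congʳ (sym (Q-+ m (suc n)))) (*-congʳ (reflexive (≡.cong Q (≡.sym (ℕₚ.+-suc m n))))) ⟩
      Q (m ℕ.+ suc n) * (f 0 * g (suc n)) + Q (m ℕ.+ suc n) * ((f ∘ suc) ⊛ g) n
        ≈⟨ distribˡ _ _ _ ⟨
      Q (m ℕ.+ suc n) * (f ⊛ g) (suc n) ∎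

  dilate-isRingHomomorphism : IsRingHomomorphism S.rawRing S.rawRing dilate
  dilate-isRingHomomorphism = record
    { isSemiringHomomorphism = record
      { isNearSemiringHomomorphism = record
        { +-isMonoidHomomorphism = record
          { isMagmaHomomorphism = record
            { isRelHomomorphism = record { cong = λ f≋g n → *-congˡ (f≋g n) }
            ; homo = λ f g n → distribˡ _ _ _
            }
          ; ε-homo = λ n → zeroʳ _
          }
        ; *-homo = λ f g n → sym (dilate-⊛ 0 f g n)
        }
      ; 1#-homo = λ { zero → trans (*-identityʳ _) Q-0 ; (suc n) → zeroʳ _ }
      }
    ; -‿homo = λ f n → solve 2 (λ q x → q :* :- x := :- (q :* x)) refl _ _
    }

  dilate-weight : ∀ n → dilate (weight n) ≋ weight (suc n)
  dilate-weight n ν = begin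
    Q ν * weight n ν            ≈⟨ *-congˡ (const-⊛ (Q n) (X^ 1) ν) ⟩
    Q ν * (Q n * (X^ 1) ν)      ≈⟨ *-assoc _ _ _ ⟨
    Q ν * Q n * (X^ 1) ν        ≈⟨ coefficient ν ⟩
    Q (suc n) * (X^ 1) ν        ≈⟨ const-⊛ (Q (suc n)) (X^ 1) ν ⟨
    weight (suc n) ν            ∎
    where
    coefficient : ∀ ν → Q ν * Q n * (X^ 1) ν ≈ Q (suc n) * (X^ 1) ν
    coefficient zero          = trans (zeroʳ _) (sym (zeroʳ _))
    coefficient (suc zero)    = *-congʳ (sym (Q-+ 1 n))
    coefficient (suc (suc ν)) = trans (zeroʳ _) (sym (zeroʳ _))

-- Integer power series in q and t

ℤ⟦q⟧-commutativeRing : CommutativeRing 0ℓ 0ℓ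
ℤ⟦q⟧-commutativeRing = PowerSeriesRing.seriesRing ℤₚ.+-*-commutativeRing

ℤ⟦q,t⟧-commutativeRing : CommutativeRing 0ℓ 0ℓ
ℤ⟦q,t⟧-commutativeRing = PowerSeriesRing.seriesRing ℤ⟦q⟧-commutativeRing

private
  module ℤ-Series = PowerSeriesRing ℤₚ.+-*-commutativeRing
  module ℤ⟦q⟧-Series = PowerSeriesRing ℤ⟦q⟧-commutativeRing

  1/[1-q^]-true : ∀ {v n} → v ∣ n → 1/[1-q^ v ] n ≡ 1ℤ
  1/[1-q^]-true {v} {n} v∣n = ≡.cong (λ b → if b then 1ℤ else 0ℤ) (dec-true (v ∣? n) v∣n)

  1/[1-q^]-false : ∀ {v n} → ¬ v ∣ n → 1/[1-q^ v ] n ≡ 0ℤ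
  1/[1-q^]-false {v} {n} v∤n = ≡.cong (λ b → if b then 1ℤ else 0ℤ) (dec-false (v ∣? n) v∤n)

  1/[1-q^]-periodic : ∀ v n → 1/[1-q^ v ] (v ℕ.+ n) ≡ 1/[1-q^ v ] n
  1/[1-q^]-periodic v n with v ∣? n
  ... | yes v∣n = 1/[1-q^]-true (∣.∣m∣n⇒∣m+n ∣.∣-refl v∣n)
  ... | no  v∤n = 1/[1-q^]-false (v∤n ∘ λ v∣v+n → ∣.∣m+n∣m⇒∣n v∣v+n ∣.∣-refl)

-- The coefficients have period v + 1, so subtracting the shift by v + 1 leaves the degrees 0 to v,
-- where only the constant coefficient is nonzero.
1/[1-q^]-inverse : ∀ v → (ℤ⟦q⟧.1# ℤ⟦q⟧.- q^ (suc v)) ℤ⟦q⟧.* 1/[1-q^ suc v ] ℤ⟦q⟧.≈ ℤ⟦q⟧.1#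
1/[1-q^]-inverse v n = ≡.trans
  (solve 2 (λ g x → (con (+ 1) :- x) :* g := g :- x :* g) (λ _ → ≡.refl) g (q^ (suc v)) n)
  (coefficient (ℕₚ.≤-<-connex (suc v) n))
  where
  open IntegerSolver ℤ⟦q⟧-commutativeRing
  g = 1/[1-q^ suc v ]
  coefficient : suc v ≤ n ⊎ n < suc v → g n ℤ.- (q^ (suc v) ℤ⟦q⟧.* g) n ≡ (q^ 0) n
  coefficient (inj₁ v<n) with k , ≡.refl ← ℕₚ.m≤n⇒∃[o]m+o≡n v<n =
    ≡.trans (≡.cong₂ ℤ._-_ (1/[1-q^]-periodic (suc v) k) (ℤ-Series.X^-⊛-+ (suc v) g k)) (ℤₚ.+-inverseʳ (g k))
  coefficient (inj₂ n<v) = ≡.trans (≡.cong (λ x → g n ℤ.- x) (ℤ-Series.X^-⊛-< (suc v) g n<v))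
    (≡.trans (ℤₚ.+-identityʳ (g n)) (initial n n<v))
    where
    initial : ∀ n → n < suc v → g n ≡ (q^ 0) n
    initial zero    _   = 1/[1-q^]-true (∣._∣0 (suc v))
    initial (suc n) n<v = 1/[1-q^]-false λ v∣n → ℕₚ.<⇒≱ n<v (∣.∣⇒≤ v∣n)

q-powers : QPowers ℤ⟦q⟧-commutativeRing
q-powers = record
  { Q           = q^_
  ; Q-0         = λ _ → ≡.refl
  ; Q-+         = ℤ-Series.X^-homo
  ; inv         = 1/[1-q^_]
  ; inv-inverse = 1/[1-q^]-inverse
  }

open GaussianBinomials q-powers using (binomᶻ; binom⊖1-pred; φ)

private
  gauss-binomᶻ : ∀ x k → gauss x (+ k) ≡ binomᶻ x k
  gauss-binomᶻ (+ N)    k = ≡.refl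
  gauss-binomᶻ -[1+ N ] k = ≡.refl

  gauss-pred : ∀ N ν → gauss (+ N ℤ.- 1ℤ) (+ ν ℤ.- 1ℤ) ≡ binom⊖1-pred N ν
  gauss-pred zero    zero    = ≡.refl
  gauss-pred (suc N) zero    = ≡.refl
  gauss-pred N       (suc ν) = gauss-binomᶻ (N ℤ.⊖ 1) ν

  shifted-index : ∀ b e → + b ℤ.- + e ℤ.+ 1ℤ ≡ suc b ℤ.⊖ e
  shifted-index b e = ≡.trans (≡.cong (ℤ._+ 1ℤ) (ℤₚ.m-n≡m⊖n b e))
    (≡.trans (ℤₚ.distribˡ-⊖-+-pos 1 b e) (≡.cong (ℤ._⊖ e) (ℕₚ.+-comm b 1)))

Φ≡φ : ∀ a b e ν → Φ a b e ν ≡ φ a b e ν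
Φ≡φ a b e ν = ≡.cong₂ (λ γ δ → q^ (ν ℕ.* ν) ℤ⟦q⟧.*
    (gauss (+ a) (+ ν) ℤ⟦q⟧.* gauss (+ b) (+ ν) ℤ⟦q⟧.- q^ e ℤ⟦q⟧.* (γ ℤ⟦q⟧.* δ)))
  (≡.trans (≡.cong₂ gauss (shifted-index b e) (≡.cong +_ (ℕₚ.+-comm ν 1))) (gauss-binomᶻ (suc b ℤ.⊖ e) (suc ν)))
  (gauss-pred (a ℕ.+ e) ν)

-- Weak chains

module ListSums {c ℓ} (R : CommutativeRing c ℓ) where
  open CommutativeRing R
  open IntegerSolver R
  open SetoidReasoning setoid

  private variable
    X Y Z : Set

  ∑ : List X → (X → Carrier) → Carrier
  ∑ L f = foldr (λ x a → f x + a) 0# L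

  ⟨_⟩ : Bool → Carrier
  ⟨ b ⟩ = if b then 1# else 0#

  ∑-cong : ∀ L {f g : X → Carrier} → (∀ x → f x ≈ g x) → ∑ L f ≈ ∑ L g
  ∑-cong []      f≈g = refl
  ∑-cong (x ∷ L) f≈g = +-cong (f≈g x) (∑-cong L f≈g)

  ∑-zero : ∀ {L} {f : X → Carrier} → All (λ x → f x ≈ 0#) L → ∑ L f ≈ 0#
  ∑-zero []         = refl
  ∑-zero (eq ∷ eqs) = trans (+-cong eq (∑-zero eqs)) (+-identityˡ _)

  ∑-+ : ∀ L (f g : X → Carrier) → ∑ L (λ x → f x + g x) ≈ ∑ L f + ∑ L g
  ∑-+ []      f g = sym (+-identityˡ _)
  ∑-+ (x ∷ L) f g = trans (+-congˡ (∑-+ L f g))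
    (solve 4 (λ a b c d → a :+ b :+ (c :+ d) := a :+ c :+ (b :+ d)) refl _ _ _ _)

  ∑-*ˡ : ∀ L a (f : X → Carrier) → ∑ L (λ x → a * f x) ≈ a * ∑ L f
  ∑-*ˡ []      a f = sym (zeroʳ a)
  ∑-*ˡ (x ∷ L) a f = trans (+-congˡ (∑-*ˡ L a f)) (sym (distribˡ _ _ _))

  ∑-swap : ∀ L M (f : X → Y → Carrier) → ∑ L (λ x → ∑ M (f x)) ≈ ∑ M (λ y → ∑ L (λ x → f x y))
  ∑-swap []      M f = sym (∑-zero (All.universal (λ _ → refl) M))
  ∑-swap (x ∷ L) M f = trans (+-congˡ (∑-swap L M f)) (sym (∑-+ M (f x) (λ y → ∑ L (λ x → f x y))))

  ∑-++ : ∀ L M (f : X → Carrier) → ∑ (L ++ M) f ≈ ∑ L f + ∑ M f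
  ∑-++ []      M f = sym (+-identityˡ _)
  ∑-++ (x ∷ L) M f = trans (+-congˡ (∑-++ L M f)) (sym (+-assoc _ _ _))

  ∑-map : ∀ (h : X → Y) L (f : Y → Carrier) → ∑ (List.map h L) f ≈ ∑ L (f ∘ h)
  ∑-map h []      f = refl
  ∑-map h (x ∷ L) f = +-congˡ (∑-map h L f)

  ∑-cartesianProductWith : ∀ (h : X → Y → Z) L M (f : Z → Carrier) →
    ∑ (cartesianProductWith h L M) f ≈ ∑ L (λ x → ∑ M (λ y → f (h x y)))
  ∑-cartesianProductWith h []      M f = refl
  ∑-cartesianProductWith h (x ∷ L) M f = trans (∑-++ (List.map (h x) M) (cartesianProductWith h L M) f)
    (+-cong (∑-map (h x) M f) (∑-cartesianProductWith h L M f))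

  ∑-filter : ∀ {P : Pred X 0ℓ} (P? : Decidable P) L f →
    ∑ (filter P? L) f ≈ ∑ L (λ x → ⟨ does (P? x) ⟩ * f x)
  ∑-filter P? []      f = refl
  ∑-filter P? (x ∷ L) f with does (P? x)
  ... | true  = +-cong (sym (*-identityˡ _)) (∑-filter P? L f)
  ... | false = trans (∑-filter P? L f) (trans (sym (+-identityˡ _)) (+-congʳ (sym (zeroˡ _))))

  ⟨⟩-true : ∀ {p} {P : Set p} (P? : Dec P) → P → ⟨ does P? ⟩ ≈ 1#
  ⟨⟩-true P? p = reflexive (≡.cong ⟨_⟩ (dec-true P? p))

  ⟨⟩-false : ∀ {p} {P : Set p} (P? : Dec P) → ¬ P → ⟨ does P? ⟩ ≈ 0#
  ⟨⟩-false P? ¬p = reflexive (≡.cong ⟨_⟩ (dec-false P? ¬p))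

  ⟨⟩-⇔ : ∀ {p q} {P : Set p} {Q : Set q} (P? : Dec P) (Q? : Dec Q) → P ⇔ Q → ⟨ does P? ⟩ ≈ ⟨ does Q? ⟩
  ⟨⟩-⇔ P? Q? P⇔Q = reflexive (≡.cong ⟨_⟩ (does-⇔ P⇔Q P? Q?))

  ⟨∧⟩ : ∀ a b → ⟨ a ∧ b ⟩ ≈ ⟨ a ⟩ * ⟨ b ⟩
  ⟨∧⟩ false b = sym (zeroˡ _)
  ⟨∧⟩ true  b = sym (*-identityˡ _)

  ⟨≤⟩-suc : ∀ m n → ⟨ does (m ℕₚ.≤? n) ⟩ ≈ ⟨ does (suc m ℕₚ.≤? n) ⟩ + ⟨ does (m ℕₚ.≟ n) ⟩
  ⟨≤⟩-suc m n with ℕₚ.<-cmp m n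
  ... | tri< m<n m≢n _ = trans (⟨⟩-true (m ℕₚ.≤? n) (ℕₚ.<⇒≤ m<n))
          (sym (trans (+-cong (⟨⟩-true (suc m ℕₚ.≤? n) m<n) (⟨⟩-false (m ℕₚ.≟ n) m≢n)) (+-identityʳ _)))
  ... | tri≈ m≮n m≡n _ = trans (⟨⟩-true (m ℕₚ.≤? n) (ℕₚ.≤-reflexive m≡n))
          (sym (trans (+-cong (⟨⟩-false (suc m ℕₚ.≤? n) m≮n) (⟨⟩-true (m ℕₚ.≟ n) m≡n)) (+-identityˡ _)))
  ... | tri> m≮n m≢n m>n = trans (⟨⟩-false (m ℕₚ.≤? n) (ℕₚ.<⇒≱ m>n))
          (sym (trans (+-cong (⟨⟩-false (suc m ℕₚ.≤? n) m≮n) (⟨⟩-false (m ℕₚ.≟ n) m≢n)) (+-identityˡ _)))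

-- With the order given by two coordinates, every principal ideal is a quadrant, which makes
-- inclusion-exclusion on quadrants available.
module PlanarChains {c ℓ} {R : CommutativeRing c ℓ} (qPowers : QPowers R)
  (P : FiniteGradedPosetWithMaximum)
  (row col : FiniteGradedPosetWithMaximum.Carrier P → ℕ)
  (⊑⇔ : ∀ {x y} → FiniteGradedPosetWithMaximum._⊑_ P x y ⇔ (row y ≤ row x × col x ≤ col y))
  where

  open FiniteGradedPosetWithMaximum P renaming (Carrier to V; _≈_ to _≈ᵖ_)
  open CommutativeRing R
  open QPowers qPowers
  open IntegerSolver R
  open ListSums R
  open SetoidReasoning setoid
  open PowerSeriesRing R using (_≋_; _⊞_; _⊛_; ⊟_; 𝟙)
  open BivariateΦ qPowers using (weight; weight-⊛-0; weight-⊛-suc)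

  private
    module ⊑⇔ {x y} = Equivalence (⊑⇔ {x} {y})

    ω : V → Carrier
    ω x = Q (rank x)

  chainSum : ℕ → Carrier
  chainSum m = ∑ (weakChains P m) (λ x → Q (Vec.sum (Vec.map rank x)))

  -- The chains x₁ ≤ ⋯ ≤ xₘ with x ≤ x₁; weakChains peels off the smallest element.
  upper : ℕ → V → Carrier
  upper m x = ∑ (tuples P m) (λ v → ⟨ does (linked? _≤?_ (x ∷ v)) ⟩ * Q (Vec.sum (Vec.map rank v)))

  upper-0 : ∀ x → upper 0 x ≈ 1#
  upper-0 x = trans (+-identityʳ _) (trans (*-identityˡ _) Q-0)

  upper-suc : ∀ m x → upper (suc m) x ≈ ∑ elements (λ y → ⟨ does (x ≤? y) ⟩ * (ω y * upper m y))
  upper-suc m x = trans (∑-cartesianProductWith _∷_ elements (tuples P m) _) (∑-cong elements λ y →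
    trans (∑-cong (tuples P m) λ v → begin
      ⟨ does (x ≤? y) ∧ does (linked? _≤?_ (y ∷ v)) ⟩ * Q (rank y ℕ.+ Vec.sum (Vec.map rank v))
        ≈⟨ *-cong (⟨∧⟩ (does (x ≤? y)) _) (Q-+ (rank y) _) ⟩
      ⟨ does (x ≤? y) ⟩ * ⟨ does (linked? _≤?_ (y ∷ v)) ⟩ * (ω y * Q (Vec.sum (Vec.map rank v)))
        ≈⟨ solve 4 (λ a b c d → a :* b :* (c :* d) := a :* (c :* (b :* d))) refl _ _ _ _ ⟩
      ⟨ does (x ≤? y) ⟩ * (ω y * (⟨ does (linked? _≤?_ (y ∷ v)) ⟩ * Q (Vec.sum (Vec.map rank v)))) ∎)
    (trans (∑-*ˡ (tuples P m) _ _) (*-congˡ (∑-*ˡ (tuples P m) _ _))))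

  chainSum-suc : ∀ m → chainSum (suc m) ≈ ∑ elements (λ x → ω x * upper m x)
  chainSum-suc m = trans (∑-filter (linked? _≤?_) (tuples P (suc m)) _)
    (trans (∑-cartesianProductWith _∷_ elements (tuples P m) _) (∑-cong elements λ x →
      trans (∑-cong (tuples P m) λ v → trans (*-congˡ (Q-+ (rank x) _))
        (solve 3 (λ a b c → a :* (b :* c) := b :* (a :* c)) refl _ _ _))
      (∑-*ˡ (tuples P m) _ _)))

  -- The chains of length m whose elements have row ≥ j and column < e.
  F : (j e m : ℕ) → Carrier
  F j e zero    = 1#
  F j e (suc m) = ∑ elements (λ z → ⟨ does (j ℕₚ.≤? row z) ⟩ * ⟨ does (suc (col z) ℕₚ.≤? e) ⟩ * (ω z * F (row z) (suc (col z)) m))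

  lower : V → ℕ → Carrier
  lower x = F (row x) (suc (col x))

  lower-suc : ∀ m y → lower y (suc m) ≈ ∑ elements (λ x → ⟨ does (x ≤? y) ⟩ * (ω x * lower x m))
  lower-suc m y = ∑-cong elements λ x → *-congʳ (trans (sym (⟨∧⟩ (does (row y ℕₚ.≤? row x)) (does (suc (col x) ℕₚ.≤? suc (col y)))))
    (⟨⟩-⇔ ((row y ℕₚ.≤? row x) ×-dec (suc (col x) ℕₚ.≤? suc (col y))) (x ≤? y)
      (mk⇔ (λ (r , c) → ⊑⇔.from (r , ℕₚ.≤-pred c)) (λ x⊑y → let r , c = ⊑⇔.to x⊑y in r , s≤s c))))

  -- Summing over the k-th element of a chain of length k + m + 1.
  lower-upper : ∀ m k → ∑ elements (λ x → ω x * (lower x k * upper m x)) ≈ ∑ elements (λ x → ω x * lower x (k ℕ.+ m))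
  lower-upper zero k = ∑-cong elements λ x → *-congˡ (trans (*-congˡ (upper-0 x))
    (trans (*-identityʳ _) (reflexive (≡.cong (lower x) (≡.sym (ℕₚ.+-identityʳ k))))))
  lower-upper (suc m) k = begin
    ∑ elements (λ x → ω x * (lower x k * upper (suc m) x))
      ≈⟨ ∑-cong elements (λ x → trans (*-congˡ (*-congˡ (upper-suc m x)))
           (trans (sym (*-assoc _ _ _)) (sym (∑-*ˡ elements _ _)))) ⟩
    ∑ elements (λ x → ∑ elements (λ y → ω x * lower x k * (⟨ does (x ≤? y) ⟩ * (ω y * upper m y))))
      ≈⟨ ∑-swap elements elements _ ⟩
    ∑ elements (λ y → ∑ elements (λ x → ω x * lower x k * (⟨ does (x ≤? y) ⟩ * (ω y * upper m y))))
      ≈⟨ ∑-cong elements (λ y → trans (∑-cong elements (λ x →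
           solve 5 (λ a b c d f → a :* b :* (c :* (d :* f)) := d :* f :* (c :* (a :* b))) refl _ _ _ _ _))
           (trans (∑-*ˡ elements _ _) (trans (*-congˡ (sym (lower-suc k y)))
             (solve 3 (λ a b c → a :* b :* c := a :* (c :* b)) refl _ _ _)))) ⟩
    ∑ elements (λ y → ω y * (lower y (suc k) * upper m y))
      ≈⟨ lower-upper m (suc k) ⟩
    ∑ elements (λ x → ω x * lower x (suc k ℕ.+ m))
      ≈⟨ ∑-cong elements (λ x → *-congˡ (reflexive (≡.cong (lower x) (≡.sym (ℕₚ.+-suc k m))))) ⟩
    ∑ elements (λ x → ω x * lower x (k ℕ.+ suc m)) ∎

  -- `weakChains` grows a chain from its smallest element and `F` from its greatest; `lower-upper`
  -- carries the splitting point from one end to the other.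
  chainSum≋lower : chainSum ≋ lower top
  chainSum≋lower zero = trans (+-identityʳ _) Q-0
  chainSum≋lower (suc m) = begin
    chainSum (suc m)                                    ≈⟨ chainSum-suc m ⟩
    ∑ elements (λ x → ω x * upper m x)                  ≈⟨ ∑-cong elements (λ x → *-congˡ (sym (*-identityˡ _))) ⟩
    ∑ elements (λ x → ω x * (lower x 0 * upper m x))    ≈⟨ lower-upper m 0 ⟩
    ∑ elements (λ x → ω x * lower x m)
      ≈⟨ ∑-cong elements (λ x → trans (sym (*-identityˡ _)) (*-congʳ (sym (⟨⟩-true (x ≤? top) (maximum x))))) ⟩
    ∑ elements (λ x → ⟨ does (x ≤? top) ⟩ * (ω x * lower x m)) ≈⟨ lower-suc m top ⟨
    lower top (suc m)                                   ∎

  -- The bounds j and e constrain the greatest element of a chain directly; the remaining elements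
  -- inherit them through the order.
  F-cong : ∀ {j e j′ e′} → (∀ z → (j ≤ row z × suc (col z) ≤ e) ⇔ (j′ ≤ row z × suc (col z) ≤ e′)) → F j e ≋ F j′ e′
  F-cong {j} {e} {j′} {e′} eqv zero    = refl
  F-cong {j} {e} {j′} {e′} eqv (suc m) = ∑-cong elements λ z → *-congʳ (begin
    ⟨ does (j ℕₚ.≤? row z) ⟩ * ⟨ does (suc (col z) ℕₚ.≤? e) ⟩    ≈⟨ ⟨∧⟩ (does (j ℕₚ.≤? row z)) (does (suc (col z) ℕₚ.≤? e)) ⟨
    ⟨ does ((j ℕₚ.≤? row z) ×-dec (suc (col z) ℕₚ.≤? e)) ⟩
      ≈⟨ ⟨⟩-⇔ ((j ℕₚ.≤? row z) ×-dec (suc (col z) ℕₚ.≤? e)) ((j′ ℕₚ.≤? row z) ×-dec (suc (col z) ℕₚ.≤? e′)) (eqv z) ⟩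
    ⟨ does ((j′ ℕₚ.≤? row z) ×-dec (suc (col z) ℕₚ.≤? e′)) ⟩     ≈⟨ ⟨∧⟩ (does (j′ ℕₚ.≤? row z)) (does (suc (col z) ℕₚ.≤? e′)) ⟩
    ⟨ does (j′ ℕₚ.≤? row z) ⟩ * ⟨ does (suc (col z) ℕₚ.≤? e′) ⟩  ∎)

  F-empty : ∀ {j e} → (∀ z → ¬ (j ≤ row z × suc (col z) ≤ e)) → F j e ≋ 𝟙
  F-empty {j} {e} none zero    = refl
  F-empty {j} {e} none (suc m) = ∑-zero (All.universal (λ z → trans (*-congʳ (begin
    ⟨ does (j ℕₚ.≤? row z) ⟩ * ⟨ does (suc (col z) ℕₚ.≤? e) ⟩    ≈⟨ ⟨∧⟩ (does (j ℕₚ.≤? row z)) (does (suc (col z) ℕₚ.≤? e)) ⟨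
    ⟨ does ((j ℕₚ.≤? row z) ×-dec (suc (col z) ℕₚ.≤? e)) ⟩
      ≈⟨ ⟨⟩-false ((j ℕₚ.≤? row z) ×-dec (suc (col z) ℕₚ.≤? e)) (none z) ⟩
    0# ∎)) (zeroˡ _)) elements)

  private
    ≈ᵖ⇒ : ∀ {x y} → x ≈ᵖ y → row x ≡ row y × col x ≡ col y
    ≈ᵖ⇒ x≈y with ⊑⇔.to (D.reflexive x≈y) | ⊑⇔.to (D.reflexive (Eq.sym x≈y))
      where module D = DecPoset decPoset
    ... | r , c | r′ , c′ = ℕₚ.≤-antisym r′ r , ℕₚ.≤-antisym c c′

    ⇒≈ᵖ : ∀ {x y} → row x ≡ row y → col x ≡ col y → x ≈ᵖ y
    ⇒≈ᵖ r c = D.antisym (⊑⇔.from (ℕₚ.≤-reflexive (≡.sym r) , ℕₚ.≤-reflexive c))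
                        (⊑⇔.from (ℕₚ.≤-reflexive r , ℕₚ.≤-reflexive (≡.sym c)))
      where module D = DecPoset decPoset

    -- The enumeration contains x exactly once up to `≈ᵖ`.
    ∑-δ : ∀ x (f : V → Carrier) → (∀ {y} → y ≈ᵖ x → f y ≈ f x) → ∀ {L} → Any (x ≈ᵖ_) L → Uniqueₛ.Unique Eq.setoid L →
          ∑ L (λ z → ⟨ does (z ≟ x) ⟩ * f z) ≈ f x
    ∑-δ x f f-cong {y ∷ L} x∈ (y∉ ∷ unique-L) with y ≟ x
    ... | yes y≈x = trans (+-cong (trans (*-identityˡ _) (f-cong y≈x)) (∑-zero (All.map (λ {z} y≉z →
            trans (*-congʳ (⟨⟩-false (z ≟ x) (λ z≈x → y≉z (Eq.trans y≈x (Eq.sym z≈x))))) (zeroˡ _)) y∉))) (+-identityʳ _)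
    ... | no  y≉x = trans (+-cong (zeroˡ _) (∑-δ x f f-cong (Any.tail (λ x≈y → y≉x (Eq.sym x≈y)) x∈) unique-L)) (+-identityˡ _)

  F-recursion : ∀ x → let j = row x; e = col x in
    F j (suc e) ⊞ F (suc j) e ≋ F (suc j) (suc e) ⊞ F j e ⊞ weight (rank x) ⊛ F j (suc e)
  F-recursion x zero    = sym (trans (+-congˡ (weight-⊛-0 (rank x) (lower x))) (+-identityʳ _))
  F-recursion x (suc m) = begin
    ∑ elements (λ z → r z * c₁ z * g z) + ∑ elements (λ z → r₁ z * c₀ z * g z)
      ≈⟨ ∑-+ elements _ _ ⟨
    ∑ elements (λ z → r z * c₁ z * g z + r₁ z * c₀ z * g z)
      ≈⟨ ∑-cong elements pointwise ⟩
    ∑ elements (λ z → r₁ z * c₁ z * g z + r z * c₀ z * g z + ⟨ does (z ≟ x) ⟩ * g z)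
      ≈⟨ trans (∑-+ elements _ _) (+-congʳ (∑-+ elements _ _)) ⟩
    F (suc j) (suc e) (suc m) + F j e (suc m) + ∑ elements (λ z → ⟨ does (z ≟ x) ⟩ * g z)
      ≈⟨ +-congˡ (∑-δ x g g-cong (enumerates x) unique) ⟩
    F (suc j) (suc e) (suc m) + F j e (suc m) + g x
      ≈⟨ +-congˡ (weight-⊛-suc (rank x) (lower x) m) ⟨
    F (suc j) (suc e) (suc m) + F j e (suc m) + (weight (rank x) ⊛ lower x) (suc m) ∎
    where
    j = row x
    e = col x
    g r r₁ c₀ c₁ : V → Carrier
    g z  = ω z * lower z m
    r z  = ⟨ does (j ℕₚ.≤? row z) ⟩
    r₁ z = ⟨ does (suc j ℕₚ.≤? row z) ⟩
    c₀ z = ⟨ does (suc (col z) ℕₚ.≤? e) ⟩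
    c₁ z = ⟨ does (suc (col z) ℕₚ.≤? suc e) ⟩
    g-cong : ∀ {y} → y ≈ᵖ x → g y ≈ g x
    g-cong y≈x with r≡ , c≡ ← ≈ᵖ⇒ y≈x =
      *-cong (reflexive (≡.cong Q (rank-cong y≈x))) (reflexive (≡.cong₂ (λ a b → F a (suc b) m) r≡ c≡))
    -- Here z is the greatest element of a chain. Writing r = r₁ + ρ and c₁ = c₀ + κ, the identity
    -- is r c₁ + r₁ c₀ = r₁ c₁ + r c₀ + ρ κ, and ρ κ detects z = x.
    pointwise : ∀ z → r z * c₁ z * g z + r₁ z * c₀ z * g z ≈ r₁ z * c₁ z * g z + r z * c₀ z * g z + ⟨ does (z ≟ x) ⟩ * g z
    pointwise z = begin
      r z * c₁ z * g z + r₁ z * c₀ z * g z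
        ≈⟨ +-congʳ (*-congʳ (*-cong (⟨≤⟩-suc j (row z)) c₁≈)) ⟩
      (r₁ z + ρ) * (c₀ z + κ) * g z + r₁ z * c₀ z * g z
        ≈⟨ solve 5 (λ r ρ c κ g → (r :+ ρ) :* (c :+ κ) :* g :+ r :* c :* g
             := r :* (c :+ κ) :* g :+ (r :+ ρ) :* c :* g :+ ρ :* κ :* g) refl (r₁ z) ρ (c₀ z) κ (g z) ⟩
      r₁ z * (c₀ z + κ) * g z + (r₁ z + ρ) * c₀ z * g z + ρ * κ * g z
        ≈⟨ +-cong (+-cong (*-congʳ (*-congˡ c₁≈)) (*-congʳ (*-congʳ (⟨≤⟩-suc j (row z)))))
                  (*-congʳ (trans (⟨⟩-⇔ (z ≟ x) ((j ℕₚ.≟ row z) ×-dec (col z ℕₚ.≟ e))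
                    (mk⇔ (λ z≈x → let r≡ , c≡ = ≈ᵖ⇒ z≈x in ≡.sym r≡ , c≡) (λ (r≡ , c≡) → ⇒≈ᵖ (≡.sym r≡) c≡)))
                    (⟨∧⟩ (does (j ℕₚ.≟ row z)) (does (col z ℕₚ.≟ e))))) ⟨
      r₁ z * c₁ z * g z + r z * c₀ z * g z + ⟨ does (z ≟ x) ⟩ * g z ∎
      where
      ρ = ⟨ does (j ℕₚ.≟ row z) ⟩
      κ = ⟨ does (col z ℕₚ.≟ e) ⟩
      c₁≈ : c₁ z ≈ c₀ z + κ
      c₁≈ = trans (⟨⟩-⇔ (suc (col z) ℕₚ.≤? suc e) (col z ℕₚ.≤? e) (mk⇔ ℕₚ.≤-pred s≤s)) (⟨≤⟩-suc (col z) e)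

-- Numerators from the recursion

-- A point with positive coordinates either has all its neighbours in the region b ≤ a + e or lies
-- on the line b = a + e, where the neighbour (a - 1, b) falls outside. Numerators and polynomiality
-- both follow this pattern.
region-induction : ∀ {p} e (P : ℕ → ℕ → Set p) →
  (∀ {b} → b ≤ e → P 0 b) → (∀ a → P a 0) →
  (∀ {a b} → suc b ≤ a ℕ.+ e → P a b → P a (suc b) → P (suc a) b → P (suc a) (suc b)) →
  (∀ {a b} → b ≡ a ℕ.+ e → P (suc a) b → P (suc a) (suc b)) →
  ∀ a {b} → b ≤ a ℕ.+ e → P a b
region-induction e P row-0 col-0 interior boundary = go
  where
  go : ∀ a {b} → b ≤ a ℕ.+ e → P a b
  go zero    b≤ = row-0 b≤
  go (suc a) {zero}  _ = col-0 (suc a)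
  go (suc a) {suc b} (s≤s b≤) with ℕₚ.m≤n⇒m<n∨m≡n b≤
  ... | inj₁ b<  = interior b< (go a b≤) (go a b<) (go (suc a) (ℕₚ.m≤n⇒m≤1+n b≤))
  ... | inj₂ b≡ = boundary b≡ (go (suc a) (ℕₚ.m≤n⇒m≤1+n b≤))

module Numerators {c ℓ} (S : CommutativeRing c ℓ) (w : ℕ → CommutativeRing.Carrier S) where
  open CommutativeRing S hiding (zero)
  open IntegerSolver S
  open Products S
  open SetoidReasoning setoid

  D : ℕ → Carrier
  D = prod (λ i → 1# - w i)

  D-suc : ∀ n f → D (suc n) * f ≈ D n * ((1# - w n) * f)
  D-suc n f = trans (*-congʳ (prod-suc (λ i → 1# - w i) n)) (*-assoc _ _ _)

  D-1 : ∀ f → D 1 * f ≈ (1# - w 0) * f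
  D-1 f = *-congʳ (*-identityʳ _)

  isolate : ∀ {n f₁₁ f₀₁ f₁₀ f₀₀} → f₁₁ + f₀₀ ≈ f₀₁ + f₁₀ + w n * f₁₁ → (1# - w n) * f₁₁ ≈ f₀₁ + f₁₀ - f₀₀
  isolate {n} {f₁₁} {f₀₁} {f₁₀} {f₀₀} eq = begin
    (1# - w n) * f₁₁                         ≈⟨ solve 3 (λ w f h → (con (+ 1) :- w) :* f := f :+ h :- h :- w :* f) refl _ _ _ ⟩
    f₁₁ + f₀₀ - f₀₀ - w n * f₁₁              ≈⟨ +-congʳ (+-congʳ eq) ⟩
    f₀₁ + f₁₀ + w n * f₁₁ - f₀₀ - w n * f₁₁  ≈⟨ solve 4 (λ a b c d → a :+ b :+ c :- d :- c := a :+ b :- d) refl _ _ _ _ ⟩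
    f₀₁ + f₁₀ - f₀₀                          ∎

  -- For steps of the recursion in which two of the regions contain the same elements.
  cancel-equal : ∀ {f g h k l} → f ≈ h + g - k → h ≈ l → k ≈ l → f ≈ g
  cancel-equal f≈ h≈l k≈l = trans f≈ (trans (+-cong (+-congʳ h≈l) (-‿cong k≈l))
    (solve 2 (λ g l → l :+ g :- l := g) refl _ _))

  private
    collect : ∀ {n f₁₁ f₀₁ f₁₀ f₀₀ h₀₁ h₁₀ h₀₀} →
      (1# - w (suc n)) * f₁₁ ≈ f₀₁ + f₁₀ - f₀₀ → D (suc n) * f₀₁ ≈ h₀₁ → D (suc n) * f₁₀ ≈ h₁₀ → D n * f₀₀ ≈ h₀₀ →
      D (2 ℕ.+ n) * f₁₁ ≈ h₀₁ + h₁₀ - (1# - w n) * h₀₀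
    collect {n} {f₁₁} {f₀₁} {f₁₀} {f₀₀} {h₀₁} {h₁₀} {h₀₀} rec eq₀₁ eq₁₀ eq₀₀ = begin
      D (2 ℕ.+ n) * f₁₁                               ≈⟨ trans (D-suc (suc n) f₁₁) (*-congˡ rec) ⟩
      D (suc n) * (f₀₁ + f₁₀ - f₀₀)
        ≈⟨ solve 4 (λ d a b c → d :* (a :+ b :- c) := d :* a :+ d :* b :- d :* c) refl _ _ _ _ ⟩
      D (suc n) * f₀₁ + D (suc n) * f₁₀ - D (suc n) * f₀₀
        ≈⟨ +-cong (+-cong eq₀₁ eq₁₀) (-‿cong (trans (D-suc n f₀₀)
             (trans (solve 3 (λ d w f → d :* (w :* f) := w :* (d :* f)) refl _ _ _) (*-congˡ eq₀₀)))) ⟩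
      h₀₁ + h₁₀ - (1# - w n) * h₀₀ ∎

    single : ∀ {n f g h} → (1# - w n) * f ≈ g → D n * g ≈ h → D (suc n) * f ≈ h
    single {n} {f} rec eq = trans (D-suc n f) (trans (*-congˡ rec) eq)

  -- G (suc u) (suc v) stands for the series of the interval from a fixed (i, c)
  -- to (i - u, c + v); G 0 v and G u 0 belong to empty sets of cells.
  module Cells (Φ : (a b e : ℕ) → Carrier) (Φ-rec : ΦRecursion S w Φ) (e : ℕ)
    (Valid : ℕ → ℕ → Set)
    (valid-row : ∀ {u v} → Valid (suc u) v → Valid u v)
    (valid-col : ∀ {u v} → Valid u (suc v) → Valid u v)
    (G : ℕ → ℕ → Carrier)
    (G-row-0 : ∀ v → G 0 v ≈ 1#) (G-col-0 : ∀ u → G u 0 ≈ 1#)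
    (G-cell : ∀ {u v} → Valid u v → v ≤ u ℕ.+ e →
      (1# - w (u ℕ.+ v)) * G (suc u) (suc v) ≈ G u (suc v) + G (suc u) v - G u v)
    (G-boundary : ∀ u → G (suc u) (suc (suc (u ℕ.+ e))) ≈ G (suc u) (suc (u ℕ.+ e)))
    where
    private
      module Φ = ΦRecursion Φ-rec

      -- Validity is a premise inside the claim because the induction runs over the whole region v ≤
      -- u + e, while the interval covers only part of it.
      Claim : ℕ → ℕ → Set ℓ
      Claim u v = Valid u v → D (suc (u ℕ.+ v)) * G (suc u) (suc v) ≈ Φ u v e

      row-0 : ∀ {v} → v ≤ e → Valid 0 v → D (suc v) * G 1 (suc v) ≈ 1#
      row-0 {zero} _ valid = begin
        D 1 * G 1 1               ≈⟨ single (trans (G-cell valid z≤n) (+-cong (+-cong (G-row-0 1) (G-col-0 1)) (-‿cong (G-row-0 0)))) (*-identityˡ _) ⟩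
        1# + 1# - 1#              ≈⟨ solve 0 (con (+ 1) :+ con (+ 1) :- con (+ 1) := con (+ 1)) refl ⟩
        1#                        ∎
      row-0 {suc v} v<e valid = single (begin
        (1# - w (suc v)) * G 1 (2 ℕ.+ v)     ≈⟨ G-cell valid v<e ⟩
        G 0 (2 ℕ.+ v) + G 1 (suc v) - G 0 (suc v)  ≈⟨ +-cong (+-congʳ (G-row-0 _)) (-‿cong (G-row-0 _)) ⟩
        1# + G 1 (suc v) - 1#                ≈⟨ solve 1 (λ g → con (+ 1) :+ g :- con (+ 1) := g) refl _ ⟩
        G 1 (suc v)                          ∎) (row-0 (ℕₚ.<⇒≤ v<e) (valid-col valid))

      col-0 : ∀ u → Claim u 0
      col-0 zero    valid = trans (row-0 z≤n valid) (sym (Φ.col-0 0 e))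
      col-0 (suc u) valid = trans (single (begin
        (1# - w (suc u ℕ.+ 0)) * G (2 ℕ.+ u) 1  ≈⟨ G-cell valid z≤n ⟩
        G (suc u) 1 + G (2 ℕ.+ u) 0 - G (suc u) 0 ≈⟨ +-cong (+-congˡ (G-col-0 _)) (-‿cong (G-col-0 _)) ⟩
        G (suc u) 1 + 1# - 1#                   ≈⟨ solve 1 (λ g → g :+ con (+ 1) :- con (+ 1) := g) refl _ ⟩
        G (suc u) 1                             ∎) (col-0 u (valid-row valid)))
        (trans (Φ.col-0 u e) (sym (Φ.col-0 (suc u) e)))

      interior : ∀ {u v} → suc v ≤ u ℕ.+ e → Claim u v → Claim u (suc v) → Claim (suc u) v → Claim (suc u) (suc v)
      interior {u} {v} v< ih₀₀ ih₀₁ ih₁₀ valid = begin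
        D (2 ℕ.+ (u ℕ.+ suc v)) * G (2 ℕ.+ u) (2 ℕ.+ v)  ≡⟨ ≡.cong (λ n → D (2 ℕ.+ n) * G (2 ℕ.+ u) (2 ℕ.+ v)) (ℕₚ.+-suc u v) ⟩
        D (3 ℕ.+ (u ℕ.+ v)) * G (2 ℕ.+ u) (2 ℕ.+ v)
          ≈⟨ collect (trans (*-congʳ (+-congˡ (-‿cong (reflexive (≡.cong (w ∘ suc) (≡.sym (ℕₚ.+-suc u v)))))))
                            (G-cell valid (ℕₚ.m≤n⇒m≤1+n v<)))
               (trans (*-congʳ (reflexive (≡.cong (D ∘ suc) (≡.sym (ℕₚ.+-suc u v))))) (ih₀₁ (valid-row valid)))
               (ih₁₀ (valid-col valid)) (ih₀₀ (valid-row (valid-col valid))) ⟩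
        Φ u (suc v) e + Φ (suc u) v e - (1# - w (suc (u ℕ.+ v))) * Φ u v e ≈⟨ Φ.interior-< v< ⟨
        Φ (suc u) (suc v) e ∎

      boundary : ∀ {u v} → v ≡ u ℕ.+ e → Claim (suc u) v → Claim (suc u) (suc v)
      boundary {u} {v} ≡.refl ih valid = begin
        D (2 ℕ.+ (u ℕ.+ suc v)) * G (2 ℕ.+ u) (2 ℕ.+ v)  ≈⟨ single (begin
          (1# - w (suc (u ℕ.+ suc v))) * G (2 ℕ.+ u) (2 ℕ.+ v)       ≈⟨ G-cell valid ℕₚ.≤-refl ⟩
          G (suc u) (2 ℕ.+ v) + G (2 ℕ.+ u) (suc v) - G (suc u) (suc v) ≈⟨ +-congʳ (+-congʳ (G-boundary u)) ⟩
          G (suc u) (suc v) + G (2 ℕ.+ u) (suc v) - G (suc u) (suc v) ≈⟨ solve 2 (λ g h → g :+ h :- g := h) refl _ _ ⟩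
          G (2 ℕ.+ u) (suc v)                                        ∎)
          (trans (*-congʳ (reflexive (≡.cong (D ∘ suc) (ℕₚ.+-suc u v)))) (ih (valid-col valid))) ⟩
        Φ (suc u) v e                                 ≈⟨ Φ.boundary ≡.refl ⟨
        Φ (suc u) (suc v) e ∎

    numerator : ∀ u {v} → v ≤ u ℕ.+ e → Valid u v → D (suc (u ℕ.+ v)) * G (suc u) (suc v) ≈ Φ u v e
    numerator = region-induction e Claim (λ v≤e valid → trans (row-0 v≤e valid) (sym (Φ.row-0 v≤e))) col-0 interior boundary

  -- G u v stands for the series of the elements with row ≥ r - u and column
  -- < r - u + v, that is, of [0̂, (r - u, r - u + v - 1)] when v ≥ 1.
  module Augmented (θ : Carrier → Carrier) (θ-hom : IsRingHomomorphism rawRing rawRing θ)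
    (θ-w : ∀ n → θ (w n) ≈ w (suc n))
    {Φ Φ⁺ : (a b e : ℕ) → Carrier} (Φ-rec : ΦRecursion S w Φ) (Φ⁺-rec : ΦRecursion S (w ∘ suc) Φ⁺) (δ : ℕ)
    (Valid : ℕ → ℕ → Set)
    (valid-row : ∀ {u v} → Valid (suc u) (suc v) → Valid u v)
    (valid-col : ∀ {u v} → Valid u (suc v) → Valid u v)
    (G : ℕ → ℕ → Carrier)
    (G-col-0 : ∀ {u} → Valid u 0 → (1# - w 0) * G u 0 ≈ 1#)
    (G-row-0 : ∀ {v} → Valid 0 (suc v) → v ≤ δ → (1# - w (suc v)) * G 0 (suc v) ≈ G 0 v)
    (G-col-1 : ∀ {u} → Valid (suc u) 1 → (1# - w 1) * G (suc u) 1 ≈ G (suc u) 0)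
    (G-cell : ∀ {u v} → Valid (suc u) (2 ℕ.+ v) → suc v ≤ δ ℕ.+ 2 ℕ.* suc u →
      (1# - w (2 ℕ.+ v)) * G (suc u) (2 ℕ.+ v) ≈ G u (suc v) + G (suc u) (suc v) - G u v)
    (G-boundary : ∀ {u v} → Valid u (suc v) → suc (δ ℕ.+ 2 ℕ.* u) ≡ v → G u (suc v) ≈ G u v)
    where
    open ΨSums S Φ-rec Φ⁺-rec
    open IsRingHomomorphism θ-hom

    private
      θN-interior : ∀ u v → v ≤ δ ℕ.+ 2 ℕ.* u → θ (N δ (suc u) (2 ℕ.+ v))
        ≈ θ (N δ u (suc v)) + θ (N δ (suc u) (suc v)) - (1# - w (suc v)) * θ (N δ u v)
      θN-interior u v v≤ = trans (⟦⟧-cong (N-interior δ u v v≤)) (trans (+-homo _ _) (+-cong (+-homo _ _)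
        (trans (-‿homo _) (-‿cong (trans (*-homo _ _) (*-congʳ (trans (+-homo _ _)
          (+-cong 1#-homo (trans (-‿homo _) (-‿cong (θ-w v)))))))))))

      double-suc : ∀ u → δ ℕ.+ 2 ℕ.* suc u ≡ 2 ℕ.+ (δ ℕ.+ 2 ℕ.* u)
      double-suc u = ≡.trans (≡.cong (δ ℕ.+_) (ℕₚ.*-suc 2 u))
        (≡.trans (ℕₚ.+-suc δ _) (≡.cong suc (ℕₚ.+-suc δ _)))

      -- Row r - u has δ + 2u + 1 cells, which is the bound on v; the interval ending at the last of
      -- v cells has maximal rank v and thus v + 1 denominator factors.
      Claim : ℕ → ℕ → Set ℓ
      Claim u v = v ≤ suc (δ ℕ.+ 2 ℕ.* u) → Valid u v → D (suc v) * G u v ≈ θ (N δ u v)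

      cell : ∀ u v → Claim u v → Claim u (suc v) → Claim (suc u) (suc v) → Claim (suc u) (2 ℕ.+ v)
      cell u v ih₀₀ ih₀₁ ih₁₀ (s≤s v<) valid
        with ℕₚ.m≤n⇒m<n∨m≡n (ℕₚ.≤-pred (≡.subst (suc v ≤_) (double-suc u) v<))
      ... | inj₁ (s≤s v≤) = trans
        (collect (G-cell valid v<) (ih₀₁ (s≤s v≤) (valid-row valid))
          (ih₁₀ (ℕₚ.m≤n⇒m≤1+n v<) (valid-col valid))
          (ih₀₀ (ℕₚ.m≤n⇒m≤1+n v≤) (valid-col (valid-row valid))))
        (sym (θN-interior u v v≤))
      -- The new cell is the last of its row. Row r - u ends one column earlier, so its two series
      -- agree and cancel.
      ... | inj₂ v≡ = trans
        (single (begin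
          (1# - w (2 ℕ.+ v)) * G (suc u) (2 ℕ.+ v)  ≈⟨ G-cell valid v< ⟩
          G u (suc v) + G (suc u) (suc v) - G u v   ≈⟨ +-congʳ (+-congʳ (G-boundary (valid-row valid) (≡.sym v≡))) ⟩
          G u v + G (suc u) (suc v) - G u v         ≈⟨ solve 2 (λ g h → g :+ h :- g := h) refl _ _ ⟩
          G (suc u) (suc v)                         ∎)
          (ih₁₀ (ℕₚ.m≤n⇒m≤1+n v<) (valid-col valid)))
        (⟦⟧-cong (sym (N-boundary δ (suc u) v (≡.trans (double-suc u) (≡.cong suc (≡.sym v≡))))))

    numerator : ∀ u v → v ≤ suc (δ ℕ.+ 2 ℕ.* u) → Valid u v → D (suc v) * G u v ≈ θ (N δ u v)
    numerator u zero v≤ valid = trans (single (G-col-0 valid) (*-identityˡ 1#)) (sym 1#-homo)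
    numerator zero (suc v) (s≤s v≤) valid = trans
      (single (G-row-0 valid (≡.subst (v ≤_) (ℕₚ.+-identityʳ δ) v≤))
        (numerator zero v (ℕₚ.m≤n⇒m≤1+n v≤) (valid-col valid)))
      (⟦⟧-cong (N-row-0 δ v))
    numerator (suc u) (suc zero) _ valid = trans
      (single (G-col-1 valid) (numerator (suc u) zero z≤n (valid-col valid)))
      (⟦⟧-cong (sym (N-col-1 δ (suc u))))
    numerator (suc u) (suc (suc v)) =
      cell u v (numerator u v) (numerator u (suc v)) (numerator (suc u) (suc v))

-- Polynomiality and the closed forms

private
  module S = CommutativeRing ℤ⟦q,t⟧-commutativeRing
  module B = BivariateΦ q-powers
  open B using (weight; dilate)

-- Equality of series is pointwise, so unification cannot recover the series
-- from an equation between them and they are given explicitly below.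

polynomial-resp : ∀ {f g} → f S.≈ g → IsPolynomial f → IsPolynomial g
polynomial-resp f≈g (N , f≡0) = N , λ m n le → ≡.trans (≡.sym (f≈g m n)) (f≡0 m n le)

polynomial-+ : ∀ {f g} → IsPolynomial f → IsPolynomial g → IsPolynomial (f S.+ g)
polynomial-+ (M , f≡0) (N , g≡0) = M ℕ.+ N , λ
  { m n (inj₁ le) → ≡.cong₂ ℤ._+_ (f≡0 m n (inj₁ (ℕₚ.m+n≤o⇒m≤o M le))) (g≡0 m n (inj₁ (ℕₚ.m+n≤o⇒n≤o M le)))
  ; m n (inj₂ le) → ≡.cong₂ ℤ._+_ (f≡0 m n (inj₂ (ℕₚ.m+n≤o⇒m≤o M le))) (g≡0 m n (inj₂ (ℕₚ.m+n≤o⇒n≤o M le))) }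

polynomial-neg : ∀ {f} → IsPolynomial f → IsPolynomial (S.- f)
polynomial-neg (N , f≡0) = N , λ m n le → ≡.cong ℤ.-_ (f≡0 m n le)

polynomial-* : ∀ {f g} → IsPolynomial f → IsPolynomial g → IsPolynomial (f S.* g)
polynomial-* {f} {g} (M , f≡0) (N , g≡0) = M ℕ.+ N , λ
  { m n (inj₁ le) → ℤ⟦q⟧-Series.⊛-vanishes M N f g (λ M≤ k → f≡0 _ k (inj₁ M≤)) (λ N≤ k → g≡0 _ k (inj₁ N≤)) le n
  ; m n (inj₂ le) → ℤ⟦q⟧-Series.⊛-preserves (λ h → ∀ {k} → M ℕ.+ N ≤ k → h k ≡ 0ℤ) (λ _ → ≡.refl)
      (λ a≡0 b≡0 le → ≡.cong₂ ℤ._+_ (a≡0 le) (b≡0 le)) f g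
      (λ i j → ℤ-Series.⊛-vanishes M N (f i) (g j) (λ M≤ → f≡0 i _ (inj₂ M≤)) (λ N≤ → g≡0 j _ (inj₂ N≤))) m le }

polynomial-1 : IsPolynomial S.1#
polynomial-1 = 1 , λ { zero zero (inj₁ ()) ; zero zero (inj₂ ()) ; (suc m) n _ → ≡.refl ; zero (suc n) _ → ≡.refl }

polynomial-t : IsPolynomial t
polynomial-t = 2 , λ
  { zero n _ → ≡.refl
  ; (suc zero) zero (inj₁ (s≤s ())) ; (suc zero) zero (inj₂ ())
  ; (suc zero) (suc n) _ → ≡.refl
  ; (suc (suc m)) n _ → ≡.refl }

q^-vanishes : ∀ {m n} → m < n → (q^ m) n ≡ 0ℤ
q^-vanishes {zero}  (s≤s _)   = ≡.refl
q^-vanishes {suc m} (s≤s m<n) = q^-vanishes m<n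

-- The factor q^m has unbounded degree as m grows, but from m = N on the coefficient of f is zero;
-- below N the factor adds less than N to the q-degree.
polynomial-dilate : ∀ {f} → IsPolynomial f → IsPolynomial (dilate f)
polynomial-dilate {f} (N , f≡0) = suc N ℕ.+ N , λ m n le → vanishes m n le (ℕₚ.≤-<-connex N m)
  where
  vanishes : ∀ m n → suc N ℕ.+ N ≤ m ⊎ suc N ℕ.+ N ≤ n → N ≤ m ⊎ m < N → dilate f m n ≡ 0ℤ
  vanishes m n _ (inj₁ N≤m) = CommutativeRing.trans ℤ⟦q⟧-commutativeRing {dilate f m} {q^ m ℤ⟦q⟧.* ℤ⟦q⟧.0#} {ℤ⟦q⟧.0#}
    (CommutativeRing.*-congˡ ℤ⟦q⟧-commutativeRing {q^ m} {f m} {ℤ⟦q⟧.0#} (λ k → f≡0 m k (inj₁ N≤m)))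
    (CommutativeRing.zeroʳ ℤ⟦q⟧-commutativeRing (q^ m)) n
  vanishes m n (inj₁ le) (inj₂ m<N) with () ← ℕₚ.<⇒≱ m<N (ℕₚ.m+n≤o⇒n≤o (suc N) le)
  vanishes m n (inj₂ le) (inj₂ m<N) = ℤ-Series.⊛-vanishes (suc N) N (q^ m) (f m)
    (λ N<k → q^-vanishes (ℕₚ.<-trans m<N N<k)) (λ N≤k → f≡0 m _ (inj₂ N≤k)) le

weight-0 : weight 0 S.≈ t
weight-0 m n = ≡.trans (ℤ⟦q⟧-Series.⊛-cong {ℤ⟦q,t⟧.const (q^ 0)} {S.1#} {t} {t} ℤ⟦q⟧-Series.const-1 (λ _ _ → ≡.refl) m n) (S.*-identityˡ t m n)

polynomial-weight : ∀ n → IsPolynomial (weight n)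
polynomial-weight zero    = polynomial-resp {t} {weight 0} (S.sym {weight 0} {t} weight-0) polynomial-t
polynomial-weight (suc n) = polynomial-resp {dilate (weight n)} {weight (suc n)} (B.dilate-weight n) (polynomial-dilate {weight n} (polynomial-weight n))

Φ-recursion : ΦRecursion ℤ⟦q,t⟧-commutativeRing weight Φ
Φ-recursion = ΦRecursion-resp ℤ⟦q,t⟧-commutativeRing {Φ′ = Φ}
  (λ a b e ν n → ≡.cong-app (≡.sym (Φ≡φ a b e ν)) n) B.Φ-recursion

Φ-dilated-recursion : ΦRecursion ℤ⟦q,t⟧-commutativeRing (weight ∘ suc) (λ a b e → Φ a b e [t↦qt])
Φ-dilated-recursion = ΦRecursion-map ℤ⟦q,t⟧-commutativeRing {Φ = Φ} B.dilate-isRingHomomorphism B.dilate-weight Φ-recursion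

module Ψ-Sums = ΨSums ℤ⟦q,t⟧-commutativeRing Φ-recursion Φ-dilated-recursion
open Ψ-Sums using (Ψ′)

Ψ≈Ψ′ : ∀ a b e → Ψ a b e S.≈ Ψ′ a b e
Ψ≈Ψ′ zero    b e = S.refl {S.1#}
Ψ≈Ψ′ (suc a) b e = S.+-congˡ {Φ (suc a) b e} {(t S.- S.1#) S.* Φ a b (suc e) [t↦qt]} {(weight 0 S.- S.1#) S.* Φ a b (suc e) [t↦qt]}
  (S.*-congʳ {Φ a b (suc e) [t↦qt]} {t S.- S.1#} {weight 0 S.- S.1#}
    (S.+-congʳ {S.- S.1#} {t} {weight 0} (S.sym {weight 0} {t} weight-0)))

-- The binomials contain the infinite series 1/(1 - qᵛ) and show no degree bound. The recursion
-- does: it builds Φ from the value 1 with polynomial coefficients.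
polynomial-Φ : ∀ e a {b} → b ≤ a ℕ.+ e → IsPolynomial (Φ a b e)
polynomial-Φ e = region-induction e (λ a b → IsPolynomial (Φ a b e))
  (λ {b} b≤e → polynomial-resp {S.1#} {Φ 0 b e} (S.sym {Φ 0 b e} {S.1#} (Rec.row-0 b≤e)) polynomial-1)
  (λ a → polynomial-resp {S.1#} {Φ a 0 e} (S.sym {Φ a 0 e} {S.1#} (Rec.col-0 a e)) polynomial-1)
  (λ {a} {b} b< p₀₀ p₀₁ p₁₀ → polynomial-resp {combination a b} {Φ (suc a) (suc b) e}
    (S.sym {Φ (suc a) (suc b) e} {combination a b} (Rec.interior-< b<))
    (polynomial-+ {Φ a (suc b) e S.+ Φ (suc a) b e} {S.- (1-weight a b S.* Φ a b e)}
      (polynomial-+ {Φ a (suc b) e} {Φ (suc a) b e} p₀₁ p₁₀)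
      (polynomial-neg {1-weight a b S.* Φ a b e} (polynomial-* {1-weight a b} {Φ a b e}
        (polynomial-+ {S.1#} {S.- weight (suc (a ℕ.+ b))} polynomial-1 (polynomial-neg {weight (suc (a ℕ.+ b))} (polynomial-weight (suc (a ℕ.+ b)))))
        p₀₀))))
  (λ { {a} {b} ≡.refl p → polynomial-resp {Φ (suc a) b e} {Φ (suc a) (suc b) e}
    (S.sym {Φ (suc a) (suc b) e} {Φ (suc a) b e} (Rec.boundary ≡.refl)) p })
  where
  module Rec = ΦRecursion Φ-recursion
  1-weight combination : ℕ → ℕ → S.Carrier
  1-weight a b = S.1# S.- weight (suc (a ℕ.+ b))
  combination a b = Φ a (suc b) e S.+ Φ (suc a) b e S.- 1-weight a b S.* Φ a b e

polynomial-Ψ′ : ∀ a {b e} → b ≤ a ℕ.+ e → IsPolynomial (Ψ′ a b e)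
polynomial-Ψ′ zero    _ = polynomial-1
polynomial-Ψ′ (suc a) {b} {e} b≤ = polynomial-+ {Φ (suc a) b e} {(weight 0 S.- S.1#) S.* Φ a b (suc e) [t↦qt]}
  (polynomial-Φ e (suc a) b≤)
  (polynomial-* {weight 0 S.- S.1#} {Φ a b (suc e) [t↦qt]}
    (polynomial-+ {weight 0} {S.- S.1#} (polynomial-weight 0) (polynomial-neg {S.1#} polynomial-1))
    (polynomial-dilate {Φ a b (suc e)} (polynomial-Φ (suc e) a (≡.subst (b ≤_) (≡.sym (ℕₚ.+-suc a e)) b≤))))

open import Data.Nat.Base using (_*_)
open Ψ-Sums using (N)

ΣΨ : (r s j d : ℕ) → S.Carrier
ΣΨ r s j d = ∑[ j ⋯ r ⊓ d ] (λ k → Ψ (k ∸ j) (d ∸ k) (s ∸ 2 * k) [t↦qt])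

ΣΨ≈N : ∀ {r s j d} δ u v → j ℕ.+ u ≡ r → j ℕ.+ v ≡ d → δ ℕ.+ 2 * r ≡ s → ΣΨ r s j d S.≈ dilate (N δ u (suc v))
ΣΨ≈N = Ψ-Sums.N-sum B.dilate-isRingHomomorphism (λ a b e → Ψ a b e [t↦qt])
  (λ a b e n → ℤ-Series.⊛-cong {q^ n} {q^ n} {Ψ a b e n} {Ψ′ a b e n} (λ _ → ≡.refl) (Ψ≈Ψ′ a b e n))

polynomial-N : ∀ δ u v → v ≤ δ ℕ.+ 2 * u → IsPolynomial (N δ u (suc v))
polynomial-N δ u v v≤ = Ψ-Sums.T-preserves IsPolynomial (λ {f} {g} → polynomial-+ {f} {g}) (λ a → polynomial-Ψ′ a) δ 0 u v v≤

open Numerators ℤ⟦q,t⟧-commutativeRing weight using (D; D-1; isolate; cancel-equal; module Cells; module Augmented)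

-- Intervals of the trapezoidal lattice

module Intervals (r s : ℕ) where
  open Trapezoid r s

  row₋ col₋ : Cell ₋ → ℕ
  row₋ ⊥₋    = suc r
  row₋ [ x ] = row x
  col₋ ⊥₋    = 0
  col₋ [ x ] = col x

  ≤₋⇔ : ∀ {x y} → (x ≤₋ y) ⇔ (row₋ y ≤ row₋ x × col₋ x ≤ col₋ y)
  ≤₋⇔ = mk⇔ to from
    where
    to : ∀ {x y} → x ≤₋ y → row₋ y ≤ row₋ x × col₋ x ≤ col₋ y
    to (⊥₋≤ ⊥₋)                            = ℕₚ.≤-refl , z≤n
    to (⊥₋≤ [ (_ , (_ , j≤r) , _) ]) = ℕₚ.m≤n⇒m≤1+n j≤r , z≤n
    to [ x≤y ]                             = x≤y
    from : ∀ {x y} → row₋ y ≤ row₋ x × col₋ x ≤ col₋ y → x ≤₋ y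
    from {⊥₋}                         _         = ⊥₋≤ _
    from {[ (_ , (_ , i≤r) , _) ]} {⊥₋} (r< , _) = ⊥-elim (ℕₚ.<⇒≱ r< i≤r)
    from {[ _ ]} {[ _ ]}              x≤y       = [ x≤y ]

  module IntervalChains {x y : Cell ₋} (x≤y : x ≤₋ y) where
    P : FiniteGradedPosetWithMaximum
    P = interval augmented x y x≤y
    open FiniteGradedPosetWithMaximum P public using (rank; top) renaming (Carrier to V)
    open PlanarChains q-powers P (row₋ ∘ proj₁) (col₋ ∘ proj₁) ≤₋⇔ public
      using (F; F-cong; F-empty; F-recursion; chainSum≋lower)

    -- Coordinates and rank enter through equations, so that truncated differences can be rewritten
    -- by the caller.
    F-step : ∀ (z : V) {j j⁺ e e⁺ n} → row₋ (proj₁ z) ≡ j → suc j ≡ j⁺ → col₋ (proj₁ z) ≡ e → suc e ≡ e⁺ → rank z ≡ n →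
      (S.1# S.- weight n) S.* F j e⁺ S.≈ F j⁺ e⁺ S.+ F j e S.- F j⁺ e
    F-step z {j} {e = e} ≡.refl ≡.refl ≡.refl ≡.refl ≡.refl =
      isolate {rank z} {F j (suc e)} {F (suc j) (suc e)} {F j e} {F (suc j) e} (F-recursion z)

    isNumerator : ∀ {H} → IsPolynomial H → D (suc (rank top)) S.* F (row₋ y) (suc (col₋ y)) S.≈ H → IsNumerator P H
    isNumerator {H} polynomial eq = polynomial , S.trans {D (suc (rank top)) S.* A P} {D (suc (rank top)) S.* F (row₋ y) (suc (col₋ y))} {H}
      (S.*-congˡ {D (suc (rank top))} {A P} {F (row₋ y) (suc (col₋ y))} chainSum≋lower) eq

rank-difference : ∀ {i c} u v → u ≤ i → i ≤ c → (c ℕ.+ v ∸ (i ∸ u) ℕ.+ 1) ∸ (c ∸ i ℕ.+ 1) ≡ u ℕ.+ v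
rank-difference u v u≤i i≤c with o , ≡.refl ← ℕₚ.m≤n⇒∃[o]m+o≡n u≤i with p , ≡.refl ← ℕₚ.m≤n⇒∃[o]m+o≡n i≤c
  rewrite ℕₚ.m+n∸m≡n u o | ℕₚ.m+n∸m≡n (u ℕ.+ o) p = ≡.trans
    (≡.cong (λ n → (n ∸ o ℕ.+ 1) ∸ (p ℕ.+ 1)) (solve 4 (λ u o p v → u :+ o :+ p :+ v := u :+ v :+ p :+ o) ≡.refl u o p v))
    (≡.trans (≡.cong (λ n → (n ℕ.+ 1) ∸ (p ℕ.+ 1)) (ℕₚ.m+n∸n≡m (u ℕ.+ v ℕ.+ p) o))
      (≡.trans (≡.cong (_∸ (p ℕ.+ 1)) (ℕₚ.+-assoc (u ℕ.+ v) p 1)) (ℕₚ.m+n∸n≡m (u ℕ.+ v) (p ℕ.+ 1))))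
  where open +-*-Solver

module IntervalNumerators (r s : ℕ) where
  open Trapezoid r s
  open Intervals r s
  open ℕₚ.≤-Reasoning

  col+row≤s : (x : Cell) → col x ℕ.+ row x ≤ s
  col+row≤s ((i , c) , (1≤i , _) , (i≤c , c≤s∸i)) with ℕₚ.≤-<-connex i s
  ... | inj₁ i≤s = ℕₚ.≤-trans (ℕₚ.+-monoˡ-≤ i c≤s∸i) (ℕₚ.≤-reflexive (ℕₚ.m∸n+n≡m i≤s))
  -- Here s ∸ i = 0, against 1 ≤ i ≤ c ≤ s ∸ i.
  ... | inj₂ s<i with () ← ℕₚ.≤-trans 1≤i (ℕₚ.≤-trans i≤c (≡.subst (c ≤_) (ℕₚ.m≤n⇒m∸n≡0 (ℕₚ.<⇒≤ s<i)) c≤s∸i))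

  module CellInterval (x y : Cell) (x≤y : x ≤ᶜ y) where
    open IntervalChains {[ x ]} {[ y ]} [ x≤y ]

    private
      i = row x
      c = col x
      j = row y
      d = col y
      e = s ∸ i ∸ c
      1≤j = proj₁ (proj₁ (proj₂ y))
      i≤r = proj₂ (proj₁ (proj₂ x))
      i≤c = proj₁ (proj₂ (proj₂ x))
      j≤i = proj₁ x≤y
      c≤d = proj₂ x≤y

      s≡ : e ℕ.+ (c ℕ.+ i) ≡ s
      s≡ = ≡.trans (≡.cong (ℕ._+ (c ℕ.+ i)) (≡.trans (ℕₚ.∸-+-assoc s i c) (≡.cong (s ∸_) (ℕₚ.+-comm i c))))
        (ℕₚ.m∸n+n≡m (col+row≤s x))

      Valid : ℕ → ℕ → Set
      Valid u v = u ≤ i ∸ j × v ≤ d ∸ c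

      u≤i : ∀ {u} → u ≤ i ∸ j → u ≤ i
      u≤i u≤ = ℕₚ.≤-trans u≤ (ℕₚ.m∸n≤m i j)

      j≤i∸u : ∀ {u} → u ≤ i ∸ j → j ≤ i ∸ u
      j≤i∸u {u} u≤ = ℕₚ.m+n≤o⇒m≤o∸n j (≡.subst (_≤ i) (ℕₚ.+-comm u j) (≡.subst (u ℕ.+ j ≤_) (ℕₚ.m∸n+n≡m j≤i) (ℕₚ.+-monoˡ-≤ j u≤)))

      c+v≤d : ∀ {v} → v ≤ d ∸ c → c ℕ.+ v ≤ d
      c+v≤d v≤ = ≡.subst (_ ≤_) (ℕₚ.m+[n∸m]≡n c≤d) (ℕₚ.+-monoʳ-≤ c v≤)

      cell : ∀ {u v} → Valid u v → v ≤ u ℕ.+ e → V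
      cell {u} {v} (u≤ , v≤) v≤u+e =
        [ (i ∸ u , c ℕ.+ v) , (ℕₚ.≤-trans 1≤j (j≤i∸u u≤) , ℕₚ.≤-trans (ℕₚ.m∸n≤m i u) i≤r)
        , (ℕₚ.≤-trans (ℕₚ.m∸n≤m i u) (ℕₚ.≤-trans i≤c (ℕₚ.m≤m+n c v)) , ℕₚ.m+n≤o⇒m≤o∸n (c ℕ.+ v) (begin
            c ℕ.+ v ℕ.+ (i ∸ u)           ≤⟨ ℕₚ.+-monoˡ-≤ (i ∸ u) (ℕₚ.+-monoʳ-≤ c v≤u+e) ⟩
            c ℕ.+ (u ℕ.+ e) ℕ.+ (i ∸ u)   ≡⟨ +-*-Solver.solve 4 (λ c u e o → c :+ (u :+ e) :+ o := e :+ (c :+ (o :+ u))) ≡.refl c u e (i ∸ u) ⟩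
            e ℕ.+ (c ℕ.+ (i ∸ u ℕ.+ u))   ≡⟨ ≡.cong (λ n → e ℕ.+ (c ℕ.+ n)) (ℕₚ.m∸n+n≡m (u≤i u≤)) ⟩
            e ℕ.+ (c ℕ.+ i)               ≡⟨ s≡ ⟩
            s                             ∎)) ]
        , [ ℕₚ.m∸n≤m i u , ℕₚ.m≤m+n c v ] , [ j≤i∸u u≤ , c+v≤d v≤ ]
        where open +-*-Solver using (_:+_; _:=_)

      -- The row bound starts at i + 1, just outside the interval, so that index 0 means an empty
      -- range in either coordinate.
      G : ℕ → ℕ → S.Carrier
      G u v = F (suc i ∸ u) (c ℕ.+ v)

      G-row-0 : ∀ v → G 0 v S.≈ S.1#
      G-row-0 v = F-empty {suc i} {c ℕ.+ v} λ { ([ _ ] , [ r≤i , _ ] , _) (i<r , _) → ℕₚ.<⇒≱ i<r r≤i }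

      G-col-0 : ∀ u → G u 0 S.≈ S.1#
      G-col-0 u = F-empty λ { ([ z ] , [ _ , c≤ ] , _) (_ , <c) →
        ℕₚ.<⇒≱ (≡.subst (col z <_) (ℕₚ.+-identityʳ c) <c) c≤ }

      G-cell : ∀ {u v} → Valid u v → v ≤ u ℕ.+ e →
        (S.1# S.- weight (u ℕ.+ v)) S.* G (suc u) (suc v) S.≈ G u (suc v) S.+ G (suc u) v S.- G u v
      G-cell {u} {v} valid v≤ = F-step (cell valid v≤) ≡.refl (≡.sym (ℕₚ.+-∸-assoc 1 (u≤i (proj₁ valid)))) ≡.refl
        (≡.sym (ℕₚ.+-suc c v)) (rank-difference u v (u≤i (proj₁ valid)) i≤c)

      -- A cell in a row from i ∸ u on has column at most s - (i ∸ u) ≤ c + u + e, so the added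
      -- column is empty.
      G-boundary : ∀ u → G (suc u) (suc (suc (u ℕ.+ e))) S.≈ G (suc u) (suc (u ℕ.+ e))
      G-boundary u = F-cong λ
        { ([ z ] , [ _ ] , _) → mk⇔
          (λ (i∸u≤ , _) → i∸u≤ , ≡.subst (suc (col z) ≤_) (≡.sym (ℕₚ.+-suc c (u ℕ.+ e))) (s≤s (ℕₚ.+-cancelʳ-≤ (i ∸ u) _ _ (begin
            col z ℕ.+ (i ∸ u)             ≤⟨ ℕₚ.+-monoʳ-≤ (col z) i∸u≤ ⟩
            col z ℕ.+ row z               ≤⟨ col+row≤s z ⟩
            s                             ≡⟨ s≡ ⟨
            e ℕ.+ (c ℕ.+ i)               ≤⟨ ℕₚ.+-monoʳ-≤ e (ℕₚ.+-monoʳ-≤ c (ℕₚ.m≤n+m∸n i u)) ⟩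
            e ℕ.+ (c ℕ.+ (u ℕ.+ (i ∸ u))) ≡⟨ +-*-Solver.solve 4 (λ c u e o → e :+ (c :+ (u :+ o)) := c :+ (u :+ e) :+ o) ≡.refl c u e (i ∸ u) ⟩
            c ℕ.+ (u ℕ.+ e) ℕ.+ (i ∸ u)   ∎))))
          (λ (i∸u≤ , c<) → i∸u≤ , ℕₚ.≤-trans c< (ℕₚ.+-monoʳ-≤ c (ℕₚ.n≤1+n _))) }
        where open +-*-Solver using (_:+_; _:=_)

      d∸c≤ : d ∸ c ≤ i ∸ j ℕ.+ e
      d∸c≤ = ℕₚ.m≤n+o⇒m∸n≤o d c (ℕₚ.+-cancelʳ-≤ j _ _ (begin
        d ℕ.+ j                       ≤⟨ col+row≤s y ⟩
        s                             ≡⟨ s≡ ⟨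
        e ℕ.+ (c ℕ.+ i)               ≡⟨ ≡.cong (λ n → e ℕ.+ (c ℕ.+ n)) (ℕₚ.m∸n+n≡m j≤i) ⟨
        e ℕ.+ (c ℕ.+ (i ∸ j ℕ.+ j))   ≡⟨ +-*-Solver.solve 4 (λ e c o j → e :+ (c :+ (o :+ j)) := c :+ (o :+ e) :+ j) ≡.refl e c (i ∸ j) j ⟩
        c ℕ.+ (i ∸ j ℕ.+ e) ℕ.+ j     ∎))
        where open +-*-Solver using (_:+_; _:=_)

      relocate : ∀ {n n′ j j′ e e′ H} → n ≡ n′ → j ≡ j′ → e ≡ e′ → D (suc n) S.* F j e S.≈ H → D (suc n′) S.* F j′ e′ S.≈ H
      relocate ≡.refl ≡.refl ≡.refl eq = eq

      i∸[i∸j]≡j : i ∸ (i ∸ j) ≡ j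
      i∸[i∸j]≡j = ℕₚ.m∸[m∸n]≡n j≤i

      c+[d∸c]≡d : c ℕ.+ (d ∸ c) ≡ d
      c+[d∸c]≡d = ℕₚ.m+[n∸m]≡n c≤d

    numerator : IsNumerator (interval augmented [ x ] [ y ] [ x≤y ]) (Φ (row x ∸ row y) (col y ∸ col x) (s ∸ row x ∸ col x))
    numerator = isNumerator {Φ (i ∸ j) (d ∸ c) e} (polynomial-Φ e (i ∸ j) d∸c≤)
      (relocate {H = Φ (i ∸ j) (d ∸ c) e}
        (≡.trans (≡.sym (rank-difference (i ∸ j) (d ∸ c) (ℕₚ.m∸n≤m i j) i≤c))
          (≡.cong₂ (λ c j → (c ∸ j ℕ.+ 1) ∸ (col x ∸ i ℕ.+ 1)) c+[d∸c]≡d i∸[i∸j]≡j))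
        i∸[i∸j]≡j (≡.trans (ℕₚ.+-suc c (d ∸ c)) (≡.cong suc c+[d∸c]≡d))
        (Cells.numerator Φ Φ-recursion e Valid
          (λ (u≤ , v≤) → ℕₚ.≤-trans (ℕₚ.n≤1+n _) u≤ , v≤) (λ (u≤ , v≤) → u≤ , ℕₚ.≤-trans (ℕₚ.n≤1+n _) v≤)
          G G-row-0 G-col-0 G-cell G-boundary (i ∸ j) d∸c≤ (ℕₚ.≤-refl , ℕₚ.≤-refl)))

  module BottomInterval {y : Cell ₋} (⊥≤y : ⊥₋ ≤₋ y) where
    open IntervalChains ⊥≤y

    ⊥∈ : V
    ⊥∈ = ⊥₋ , ⊥₋≤ ⊥₋ , ⊥≤y

    -- The other three regions are empty, so the recursion at 0̂ reads (1 - t) F = 1 + 1 - 1; F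
    -- counts the chains that repeat 0̂.
    F-⊥ : (S.1# S.- weight 0) S.* F (suc r) 1 S.≈ S.1#
    F-⊥ = S.trans {(S.1# S.- weight 0) S.* F (suc r) 1} {F (2 ℕ.+ r) 1 S.+ F (suc r) 0 S.- F (2 ℕ.+ r) 0} {S.1#}
      (F-step ⊥∈ ≡.refl ≡.refl ≡.refl ≡.refl ≡.refl)
      (S.trans {F (2 ℕ.+ r) 1 S.+ F (suc r) 0 S.- F (2 ℕ.+ r) 0} {S.1# S.+ S.1# S.- S.1#} {S.1#}
        (S.+-cong {F (2 ℕ.+ r) 1 S.+ F (suc r) 0} {S.1# S.+ S.1#} {S.- F (2 ℕ.+ r) 0} {S.- S.1#}
          (S.+-cong {F (2 ℕ.+ r) 1} {S.1#} {F (suc r) 0} {S.1#}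
            (F-empty {2 ℕ.+ r} {1} λ z (r< , _) → above-top z r<) (F-empty {suc r} {0} λ { z (_ , ()) }))
          (S.-‿cong {F (2 ℕ.+ r) 0} {S.1#} (F-empty {2 ℕ.+ r} {0} λ { z (_ , ()) })))
        λ { zero zero → ≡.refl ; zero (suc n) → ≡.refl ; (suc m) n → ≡.refl })
      where
      above-top : ∀ z → ¬ 2 ℕ.+ r ≤ row₋ (proj₁ z)
      above-top (⊥₋ , _) r< = ℕₚ.<-irrefl ≡.refl r<
      above-top ([ (_ , (_ , i≤r) , _) ] , _) r< = ℕₚ.<⇒≱ r< (ℕₚ.m≤n⇒m≤1+n i≤r)

    F-only-⊥ : ∀ {j e} → (∀ (x : Cell) → ¬ (j ≤ row x × col x < e)) → j ≤ suc r → 1 ≤ e → F j e S.≈ F (suc r) 1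
    F-only-⊥ {j} {e} none j≤ 1≤e = F-cong {j} {e} {suc r} {1} λ
      { (⊥₋ , _)    → mk⇔ (λ _ → ℕₚ.≤-refl , ℕₚ.≤-refl) (λ _ → j≤ , 1≤e)
      ; ([ x@(_ , (_ , i≤r) , _) ] , _) → mk⇔ (λ x∈ → ⊥-elim (none x x∈)) (λ (r< , _) → ⊥-elim (ℕₚ.<⇒≱ r< i≤r)) }

  module AugmentedInterval (2r≤s : 2 * r ≤ s) (y : Cell) where
    open IntervalChains (⊥₋≤ [ y ])
    open BottomInterval (⊥₋≤ [ y ]) using (F-⊥; F-only-⊥)

    private
      j = row y
      d = col y
      δ = s ∸ 2 * r
      1≤j = proj₁ (proj₁ (proj₂ y))
      j≤r = proj₂ (proj₁ (proj₂ y))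
      j≤d = proj₁ (proj₂ (proj₂ y))

      δ+2r≡s : δ ℕ.+ 2 * r ≡ s
      δ+2r≡s = ℕₚ.m∸n+n≡m 2r≤s

      -- The second bound says that the last column r - u + w - 1 is at most d, written so as to
      -- include w = 0.
      Valid : ℕ → ℕ → Set
      Valid u w = u ≤ r ∸ j × r ∸ u ℕ.+ w ≤ suc d

      u≤r : ∀ {u} → u ≤ r ∸ j → u ≤ r
      u≤r u≤ = ℕₚ.≤-trans u≤ (ℕₚ.m∸n≤m r j)

      j≤r∸u : ∀ {u} → u ≤ r ∸ j → j ≤ r ∸ u
      j≤r∸u {u} u≤ = ℕₚ.m+n≤o⇒m≤o∸n j (≡.subst (_≤ r) (ℕₚ.+-comm u j) (≡.subst (u ℕ.+ j ≤_) (ℕₚ.m∸n+n≡m j≤r) (ℕₚ.+-monoˡ-≤ j u≤)))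

      suc-r∸suc : ∀ {u} → suc u ≤ r ∸ j → suc (r ∸ suc u) ≡ r ∸ u
      suc-r∸suc u< = ≡.sym (ℕₚ.+-∸-assoc 1 (u≤r u<))

      valid-row : ∀ {u v} → Valid (suc u) (suc v) → Valid u v
      valid-row {u} {v} (u< , ≤d) = ℕₚ.<⇒≤ u< , ≡.subst (_≤ suc d)
        (≡.trans (ℕₚ.+-suc (r ∸ suc u) v) (≡.cong (ℕ._+ v) (suc-r∸suc u<))) ≤d

      valid-col : ∀ {u v} → Valid u (suc v) → Valid u v
      valid-col {u} {v} (u≤ , ≤d) = u≤ , ℕₚ.≤-trans (ℕₚ.+-monoʳ-≤ (r ∸ u) (ℕₚ.n≤1+n v)) ≤d

      s-split : ∀ {u} → u ≤ r → r ∸ u ℕ.+ (δ ℕ.+ 2 * u) ℕ.+ (r ∸ u) ≡ s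
      s-split {u} u≤r = ≡.trans
        (+-*-Solver.solve 3 (λ o u δ → o :+ (δ :+ con 2 :* u) :+ o := δ :+ con 2 :* (o :+ u)) ≡.refl (r ∸ u) u δ)
        (≡.trans (≡.cong (λ r → δ ℕ.+ 2 * r) (ℕₚ.m∸n+n≡m u≤r)) δ+2r≡s)
        where open +-*-Solver using (_:+_; _:*_; _:=_; con)

      cell : ∀ {u v} → Valid u (suc v) → v ≤ δ ℕ.+ 2 * u → V
      cell {u} {v} (u≤ , ≤d) v≤ =
        [ (r ∸ u , r ∸ u ℕ.+ v) , (ℕₚ.≤-trans 1≤j (j≤r∸u u≤) , ℕₚ.m∸n≤m r u)
        , (ℕₚ.m≤m+n (r ∸ u) v , ℕₚ.m+n≤o⇒m≤o∸n (r ∸ u ℕ.+ v)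
            (≡.subst (r ∸ u ℕ.+ v ℕ.+ (r ∸ u) ≤_) (s-split (u≤r u≤)) (ℕₚ.+-monoˡ-≤ (r ∸ u) (ℕₚ.+-monoʳ-≤ (r ∸ u) v≤)))) ]
        , ⊥₋≤ _ , [ j≤r∸u u≤ , ℕₚ.≤-pred (≡.subst (_≤ suc d) (ℕₚ.+-suc (r ∸ u) v) ≤d) ]

      G : ℕ → ℕ → S.Carrier
      G u w = F (r ∸ u) (r ∸ u ℕ.+ w)

      G-step : ∀ {u v} → Valid u (suc v) → v ≤ δ ℕ.+ 2 * u → (S.1# S.- weight (suc v)) S.* G u (suc v)
        S.≈ F (suc (r ∸ u)) (r ∸ u ℕ.+ suc v) S.+ G u v S.- F (suc (r ∸ u)) (r ∸ u ℕ.+ v)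
      G-step {u} {v} valid v≤ = F-step (cell valid v≤) ≡.refl ≡.refl ≡.refl (≡.sym (ℕₚ.+-suc (r ∸ u) v))
        (≡.trans (≡.cong (ℕ._+ 1) (ℕₚ.m+n∸m≡n (r ∸ u) v)) (ℕₚ.+-comm v 1))

      G-col-0 : ∀ {u} → Valid u 0 → (S.1# S.- weight 0) S.* G u 0 S.≈ S.1#
      G-col-0 {u} (u≤ , _) = S.trans {(S.1# S.- weight 0) S.* G u 0} {(S.1# S.- weight 0) S.* F (suc r) 1} {S.1#}
        (S.*-congˡ {S.1# S.- weight 0} {G u 0} {F (suc r) 1} (F-only-⊥
          (λ { ((i , c) , _ , i≤c , _) (r∸u≤i , c<) → ℕₚ.<⇒≱ (≡.subst (c <_) (ℕₚ.+-identityʳ (r ∸ u)) c<) (ℕₚ.≤-trans r∸u≤i i≤c) })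
          (ℕₚ.m≤n⇒m≤1+n (ℕₚ.m∸n≤m r u)) (ℕₚ.≤-trans 1≤j (ℕₚ.≤-trans (j≤r∸u u≤) (ℕₚ.m≤m+n (r ∸ u) 0))))) F-⊥

      G-row-0 : ∀ {v} → Valid 0 (suc v) → v ≤ δ → (S.1# S.- weight (suc v)) S.* G 0 (suc v) S.≈ G 0 v
      G-row-0 {v} valid v≤δ = cancel-equal {(S.1# S.- weight (suc v)) S.* G 0 (suc v)} {G 0 v} {F (suc r) (r ℕ.+ suc v)} {F (suc r) (r ℕ.+ v)} {F (suc r) 1}
        (G-step valid (ℕₚ.m≤n⇒m≤n+o 0 v≤δ)) (below (suc v)) (below v)
        where
        below : ∀ v → F (suc r) (r ℕ.+ v) S.≈ F (suc r) 1
        below v = F-only-⊥ (λ { (_ , (_ , i≤r) , _) (r<i , _) → ℕₚ.<⇒≱ r<i i≤r }) ℕₚ.≤-refl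
          (ℕₚ.≤-trans 1≤j (ℕₚ.≤-trans j≤r (ℕₚ.m≤m+n r v)))

      -- The new cell lies on the diagonal. Rows beyond ρ start at columns beyond ρ, so both
      -- auxiliary regions reduce to 0̂ and cancel.
      G-col-1 : ∀ {u} → Valid (suc u) 1 → (S.1# S.- weight 1) S.* G (suc u) 1 S.≈ G (suc u) 0
      G-col-1 {u} valid@(u< , _) = cancel-equal {(S.1# S.- weight 1) S.* G (suc u) 1} {G (suc u) 0} {F (suc ρ) (ρ ℕ.+ 1)} {F (suc ρ) (ρ ℕ.+ 0)} {F (suc r) 1}
        (G-step valid z≤n) (triangle 1 ℕₚ.≤-refl) (triangle 0 z≤n)
        where
        ρ = r ∸ suc u
        triangle : ∀ n → n ≤ 1 → F (suc ρ) (ρ ℕ.+ n) S.≈ F (suc r) 1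
        triangle n n≤1 = F-only-⊥ (λ { ((i , c) , _ , i≤c , _) (ρ<i , c<) → ℕₚ.<⇒≱ c< (begin
            ρ ℕ.+ n   ≤⟨ ℕₚ.+-monoʳ-≤ ρ n≤1 ⟩
            ρ ℕ.+ 1   ≡⟨ ℕₚ.+-comm ρ 1 ⟩
            suc ρ     ≤⟨ ρ<i ⟩
            i         ≤⟨ i≤c ⟩
            c         ∎) })
          (s≤s (ℕₚ.m∸n≤m r (suc u))) (ℕₚ.≤-trans 1≤j (ℕₚ.≤-trans (j≤r∸u u<) (ℕₚ.m≤m+n ρ n)))

      -- Offsets are counted from the diagonal: passing from row r - (u + 1) to row r - u lowers the
      -- offset of a fixed column by one, which explains the indices of the neighbours.
      G-cell : ∀ {u v} → Valid (suc u) (2 ℕ.+ v) → suc v ≤ δ ℕ.+ 2 * suc u →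
        (S.1# S.- weight (2 ℕ.+ v)) S.* G (suc u) (2 ℕ.+ v) S.≈ G u (suc v) S.+ G (suc u) (suc v) S.- G u v
      G-cell {u} {v} valid@(u< , _) v< = relocate (suc-r∸suc u<) (next (suc v)) (next v) (G-step valid v<)
        where
        next : ∀ v → r ∸ suc u ℕ.+ suc v ≡ r ∸ u ℕ.+ v
        next v = ≡.trans (ℕₚ.+-suc (r ∸ suc u) v) (≡.cong (ℕ._+ v) (suc-r∸suc u<))
        relocate : ∀ {f g j j′ e₁ e₁′ e₀ e₀′} → j ≡ j′ → e₁ ≡ e₁′ → e₀ ≡ e₀′ → f S.≈ F j e₁ S.+ g S.- F j e₀ → f S.≈ F j′ e₁′ S.+ g S.- F j′ e₀′
        relocate ≡.refl ≡.refl ≡.refl eq = eq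

      G-boundary : ∀ {u v} → Valid u (suc v) → suc (δ ℕ.+ 2 * u) ≡ v → G u (suc v) S.≈ G u v
      G-boundary {u} (u≤ , _) ≡.refl = F-cong λ
        { (⊥₋ , _) → mk⇔ (λ (≤r , _) → ≤r , ≡.subst (1 ≤_) (≡.sym (ℕₚ.+-suc (r ∸ u) _)) (s≤s z≤n))
                        (λ (≤r , _) → ≤r , ≡.subst (1 ≤_) (≡.sym (ℕₚ.+-suc (r ∸ u) _)) (s≤s z≤n))
        ; ([ x ] , _) → mk⇔
            (λ (r∸u≤ , _) → r∸u≤ , ≡.subst (col x <_) (≡.sym (ℕₚ.+-suc (r ∸ u) _)) (s≤s (ℕₚ.+-cancelʳ-≤ (r ∸ u) _ _ (begin
              col x ℕ.+ (r ∸ u)                          ≤⟨ ℕₚ.+-monoʳ-≤ (col x) r∸u≤ ⟩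
              col x ℕ.+ row x                            ≤⟨ col+row≤s x ⟩
              s                                          ≡⟨ s-split (u≤r u≤) ⟨
              r ∸ u ℕ.+ (δ ℕ.+ 2 * u) ℕ.+ (r ∸ u)        ∎))))
            (λ (r∸u≤ , x<) → r∸u≤ , ℕₚ.≤-trans x< (ℕₚ.+-monoʳ-≤ (r ∸ u) (ℕₚ.n≤1+n _))) }

      u = r ∸ j
      v = d ∸ j

      r∸u≡j : r ∸ u ≡ j
      r∸u≡j = ℕₚ.m∸[m∸n]≡n j≤r

      v≤ : v ≤ δ ℕ.+ 2 * u
      v≤ = ℕₚ.m≤n+o⇒m∸n≤o d j (ℕₚ.+-cancelʳ-≤ j _ _ (begin
        d ℕ.+ j                            ≤⟨ col+row≤s y ⟩
        s                                  ≡⟨ s-split (u≤r ℕₚ.≤-refl) ⟨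
        r ∸ u ℕ.+ (δ ℕ.+ 2 * u) ℕ.+ (r ∸ u) ≡⟨ ≡.cong (λ j → j ℕ.+ (δ ℕ.+ 2 * u) ℕ.+ j) r∸u≡j ⟩
        j ℕ.+ (δ ℕ.+ 2 * u) ℕ.+ j          ∎))

      end : r ∸ u ℕ.+ suc v ≡ suc d
      end = ≡.trans (≡.cong (ℕ._+ suc v) r∸u≡j) (≡.trans (ℕₚ.+-suc j v) (≡.cong suc (ℕₚ.m+[n∸m]≡n j≤d)))

      relocate : ∀ {n n′ j j′ e e′ H} → n ≡ n′ → j ≡ j′ → e ≡ e′ → D (suc n) S.* F j e S.≈ H → D (suc n′) S.* F j′ e′ S.≈ H
      relocate ≡.refl ≡.refl ≡.refl eq = eq

      ΣΨ≈ : ΣΨ r s j d S.≈ dilate (N δ u (suc v))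
      ΣΨ≈ = ΣΨ≈N δ u v (ℕₚ.m+[n∸m]≡n j≤r) (ℕₚ.m+[n∸m]≡n j≤d) δ+2r≡s

      polynomial : IsPolynomial (ΣΨ r s j d)
      polynomial = polynomial-resp {dilate (N δ u (suc v))} {ΣΨ r s j d} (S.sym {ΣΨ r s j d} {dilate (N δ u (suc v))} ΣΨ≈)
        (polynomial-dilate {N δ u (suc v)} (polynomial-N δ u v v≤))

      D*G : D (2 ℕ.+ v) S.* G u (suc v) S.≈ dilate (N δ u (suc v))
      D*G = Augmented.numerator dilate B.dilate-isRingHomomorphism B.dilate-weight Φ-recursion Φ-dilated-recursion δ
        Valid valid-row valid-col G G-col-0 G-row-0 G-col-1 G-cell G-boundary u (suc v) (s≤s v≤)
        (ℕₚ.≤-refl , ℕₚ.≤-reflexive end)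

      D*F : D (suc (rank top)) S.* F j (suc d) S.≈ dilate (N δ u (suc v))
      D*F = relocate {H = dilate (N δ u (suc v))} (ℕₚ.+-comm 1 v) r∸u≡j end D*G

    numerator : IsNumerator P (ΣΨ r s j d)
    numerator = isNumerator {ΣΨ r s j d} polynomial
      (S.trans {D (suc (rank top)) S.* F j (suc d)} {dilate (N δ u (suc v))} {ΣΨ r s j d} D*F
        (S.sym {ΣΨ r s j d} {dilate (N δ u (suc v))} ΣΨ≈))

  module BottomSingleton where
    open IntervalChains (⊥₋≤ ⊥₋)
    open BottomInterval (⊥₋≤ ⊥₋) using (F-⊥)

    private
      D*F : D 1 S.* F (suc r) 1 S.≈ S.1#
      D*F = S.trans {D 1 S.* F (suc r) 1} {(S.1# S.- weight 0) S.* F (suc r) 1} {S.1#} (D-1 (F (suc r) 1)) F-⊥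

      relocate : ∀ {n n′ H} → n ≡ n′ → D (suc n) S.* F (suc r) 1 S.≈ H → D (suc n′) S.* F (suc r) 1 S.≈ H
      relocate ≡.refl eq = eq

    numerator : IsNumerator P S.1#
    numerator = isNumerator {S.1#} polynomial-1 (relocate {0} {rank top} {S.1#} ≡.refl D*F)

theorem4p5 : (r s : ℕ) → 2 * r ≤ s → 2 ≤ 2 * r →
    let open Trapezoid r s in
    (∀ (y : Cell) →
       IsNumerator (interval augmented ⊥₋ [ y ] (⊥₋≤ [ y ]))
         (∑[ row y ⋯ r ⊓ col y ] (λ k →
            Ψ (k ∸ row y) (col y ∸ k) (s ∸ 2 * k) [t↦qt])))
    × (∀ (x y : Cell) (x≤y : x ≤ᶜ y) →
       IsNumerator (interval augmented [ x ] [ y ] [ x≤y ])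
         (Φ (row x ∸ row y) (col y ∸ col x) (s ∸ row x ∸ col x)))
    × IsNumerator (interval augmented ⊥₋ ⊥₋ (⊥₋≤ ⊥₋)) ℤ⟦q,t⟧.1#
theorem4p5 r s 2r≤s _ =
  AugmentedInterval.numerator 2r≤s , CellInterval.numerator , BottomSingleton.numerator
  where open IntervalNumerators r s
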